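{- Let $\widetilde{W}/W\in\{\widetilde{C}_n/C_n,\widetilde{B}_n/B_n,\widetilde{B}_n/D_n,\widetilde{D}_n/D_n\}$. The root lattice coordinate of an element $w\in\widetilde{W}/W$ (the image of $0\in V$ under $w$) is $$\sum_{i=1}^n \mathrm{level}_i(\mathcal{A}(w))\,e_i,$$ where $\mathrm{level}_i(\mathcal{A}(w))$ denotes the level of the lowest bead in column $i$ of the abacus $\mathcal{A}(w)$. Moreover, this gives a bijection from $\widetilde{W}/W$ onto the following set of points $\sum_i a_ie_i$: all $(a_1,\dots,a_n)\in\mathbb{Z}^n$ in types $\widetilde{C}/C$ and $\widetilde{B}/D$; all $(a_1,\dots,a_n)\in\mathbb{Z}^n$ with $\sum_{i=1}^n|a_i|$ even in types $\widetilde{B}/B$ and $\widetilde{D}/D$.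
   Context: Groups. Let $N=2n+1$. A mirrored $\mathbb{Z}$-permutation is a bijection $w:\mathbb{Z}\to\mathbb{Z}$ with $w(i+N)=w(i)+N$ and $w(-i)=-w(i)$ for all $i\in\mathbb{Z}$; it is determined by $(w(1),\dots,w(n))$. Under composition these form the affine Coxeter group $\widetilde{C}_n$. Define elements by their images $(w(1),\dots,w(n))$: $s_i=(1,\dots,i-1,i+1,i,i+2,\dots,n)$ for $1\le i\le n-1$; $s_0^C=(-1,2,3,\dots,n)$; $s_0^D=(-2,-1,3,\dots,n)$; $s_n^C=(1,\dots,n-1,n+1)$; $s_n^D=(1,\dots,n-2,n+1,n+2)$. The four types are: - $\widetilde{C}/C$: $\widetilde{W}=\widetilde{C}_n$ is all mirrored $\mathbb{Z}$-permutations, generators $s_0=s_0^C,s_1,\dots,s_{n-1},s_n=s_n^C$ ($n\ge2$). - $\widetilde{B}/B$: those with $|\{i\le0:w(i)\ge1\}|$ even, generators $s_0=s_0^D,s_1,\dots,s_{n-1},s_n=s_n^C$ ($n\ge3$). - $\widetilde{B}/D$: those with $|\{i\le n:w(i)\ge n+1\}|$ even, generators $s_0=s_0^C,s_1,\dots,s_{n-1},s_n=s_n^D$ ($n\ge3$). - $\widetilde{D}/D$: those satisfying both parity conditions, generators $s_0=s_0^D,s_1,\dots,s_{n-1},s_n=s_n^D$ ($n\ge4$). $W$ is generated by $s_1,\dots,s_n$, and $\widetilde{W}/W$ denotes the set of minimal length representatives of the cosets $wW$. Abaci. An abacus has runners (columns) $1,\dots,2n$; runner $i$ has entries labeled $mN+i$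 for each level $m\in\mathbb{Z}$. Some entries are beads, the others gaps. "Lowest" means largest label. The abacus is flush if no bead is preceded (in the order of labels) by a gap on the same runner. $\mathcal{A}(w)$ is the flush abacus whose lowest bead in each runner is an element of $\{w(1),\dots,w(2n)\}$. Action on $V$. $V=\mathbb{R}^n$ with orthonormal basis $e_1,\dots,e_n$ and inner product $\langle\cdot,\cdot\rangle$. $\widetilde{W}$ acts on $V$ with $s_i$ ($1\le i\le n$) acting as the reflection across the hyperplane perpendicular to the simple root $\alpha_i$, and $s_0$ acting as the affine reflection $s_0(v)=v-(\langle v,\widetilde{\alpha}\rangle-1)\frac{2}{\langle\widetilde{\alpha},\widetilde{\alpha}\rangle}\widetilde{\alpha}$. Here $\alpha_i=e_i-e_{i+1}$ for $1\le i\le n-1$; $\alpha_n=2e_n$ in type $\widetilde{C}/C$, $\alpha_n=e_n$ in type $\widetilde{B}/B$, $\alpha_n=e_{n-1}+e_n$ in types $\widetilde{B}/D$ and $\widetilde{D}/D$; and $\widetilde{\alpha}=2e_1$ in types $\widetilde{C}/C,\widetilde{B}/D$, $\widetilde{\alpha}=e_1+e_2$ in types $\widetilde{B}/B,\widetilde{D}/D$. The root lattice coordinate of $w\in\widetilde{W}/W$ is $w(0)\in V$, the result of acting by $w$ on $0$. -}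

module Defs where

open import Algebra.Apartness.Bundles using (HeytingCommutativeRing; HeytingField)
open import Algebra.Bundles using (AbelianGroup; CommutativeRing)
import Algebra.Apartness.Properties.HeytingCommutativeRing as HeytingProperties
import Algebra.Properties.CommutativeMonoid.Sum as CommutativeMonoidSum
import Algebra.Properties.Group as GroupProperties
import Algebra.Properties.Monoid.Mult as MonoidMult
import Algebra.Properties.Ring as RingProperties
import Algebra.Properties.Semiring.Sum as SemiringSum
import Relation.Binary.Reasoning.Setoid as SetoidReasoning
open import Data.Bool.Base using (if_then_else_)
open import Data.Fin.Base using (Fin; zero; suc; toℕ; fromℕ<; inject≤)
open import Data.Fin.Properties using (toℕ<n; toℕ-fromℕ<; toℕ-injective)
  renaming (suc-injective to Fin-suc-injective)
open import Data.Integer.Base as ℤ using (ℤ; +_; -[1+_]; 0ℤ; 1ℤ; _/ℕ_; _%ℕ_)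
open import Data.Integer.DivMod
  using (n%ℕd<d; a≡a%ℕn+[a/ℕn]*n; [n/ℕd]*d≤n; n<s[n/ℕd]*d)
import Data.Integer.Properties as ℤ
open import Data.Integer.Tactic.RingSolver using (solve-∀)
open import Data.List.Base using (List; []; _∷_; length; map)
open import Data.Nat.Base using (ℕ; zero; suc; _≤_; _<_; z≤n; s≤s; _∸_)
  renaming (_+_ to _+ℕ_; _*_ to _*ℕ_)
open import Data.Nat.Divisibility using (_∣_)
import Data.Nat.Properties as ℕ
open import Data.Product.Base using (Σ; ∃-syntax; _×_; _,_; proj₁; proj₂)
open import Data.Sum.Base using (inj₁; inj₂)
open import Data.Unit.Base using (⊤)
open import Data.Vec.Functional using (Vector)
open import Function.Base using (_∘_)
open import Function.Bundles using (_↔_; mk↔ₛ′; module Inverse)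
open import Function.Construct.Composition using (_↔-∘_)
open import Function.Construct.Identity using (↔-id)
open import Relation.Binary.PropositionalEquality
  using (_≡_; _≢_; refl; sym; trans; cong; cong₂; subst; module ≡-Reasoning)
open import Relation.Nullary using (Dec; yes; no; does; contradiction)
open import Relation.Nullary.Decidable using (dec-true; dec-false)

------------------------------------------------------------------------
-- Mirrored ℤ-permutations

N : ℕ → ℕ
N n = suc (2 *ℕ n)

record MirroredPerm (n : ℕ) : Set where
  field
    perm  : ℤ ↔ ℤ
  open Inverse perm public using (to; from; strictlyInverseˡ; strictlyInverseʳ)
  field
    shift : ∀ i → to (i ℤ.+ + N n) ≡ to i ℤ.+ + N n
    odd   : ∀ i → to (ℤ.- i) ≡ ℤ.- to i

open MirroredPerm public using () renaming (to to infixl 10 _⟨$⟩_)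

infix 4 _≈ₘ_
_≈ₘ_ : ∀ {n} → MirroredPerm n → MirroredPerm n → Set
v ≈ₘ w = ∀ i → v ⟨$⟩ i ≡ w ⟨$⟩ i

idₘ : ∀ {n} → MirroredPerm n
idₘ = record { perm = ↔-id ℤ ; shift = λ _ → refl ; odd = λ _ → refl }

infixr 9 _∘ₘ_
_∘ₘ_ : ∀ {n} → MirroredPerm n → MirroredPerm n → MirroredPerm n
v ∘ₘ w = record
  { perm  = v.perm ↔-∘ w.perm
  ; shift = λ i → trans (cong v.to (w.shift i)) (v.shift (w.to i))
  ; odd   = λ i → trans (cong v.to (w.odd i)) (v.odd (w.to i))
  }
  where module v = MirroredPerm v
        module w = MirroredPerm w

divMod-unique : ∀ n {r s : ℕ} {p q : ℤ} → r < N n → s < N n →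
                + r ℤ.+ p ℤ.* + N n ≡ + s ℤ.+ q ℤ.* + N n → r ≡ s × p ≡ q
divMod-unique n {r} {s} {p} {q} r<N s<N eq = r≡s , p≡q
  where
  quotient-≤ : ∀ {a b : ℕ} {x y : ℤ} → a < N n →
               + a ℤ.+ x ℤ.* + N n ≡ + b ℤ.+ y ℤ.* + N n → y ℤ.≤ x
  quotient-≤ {a} {b} {x} {y} a<N e =
    subst (y ℤ.≤_) (ℤ.pred-suc x) (ℤ.i<j⇒i≤pred[j] (ℤ.*-cancelʳ-<-nonNeg {y} {ℤ.suc x} (+ N n) yN<))
    where
    open ℤ.≤-Reasoning
    yN< : y ℤ.* + N n ℤ.< ℤ.suc x ℤ.* + N n
    yN< = begin-strict
      y ℤ.* + N n              ≤⟨ ℤ.i≤j+i _ (+ b) ⟩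
      + b ℤ.+ y ℤ.* + N n      ≡⟨ e ⟨
      + a ℤ.+ x ℤ.* + N n      <⟨ ℤ.+-monoˡ-< (x ℤ.* + N n) (ℤ.+<+ a<N) ⟩
      + N n ℤ.+ x ℤ.* + N n    ≡⟨ ℤ.suc-* x (+ N n) ⟨
      ℤ.suc x ℤ.* + N n        ∎
  p≡q : p ≡ q
  p≡q = ℤ.≤-antisym (quotient-≤ s<N (sym eq)) (quotient-≤ r<N eq)
  r≡s : r ≡ s
  r≡s = ℤ.+-injective (ℤ-cancelʳ (p ℤ.* + N n) (+ r) (+ s)
          (trans eq (cong (λ z → + s ℤ.+ z ℤ.* + N n) (sym p≡q))))
    where open GroupProperties (AbelianGroup.group ℤ.+-0-abelianGroup) renaming (∙-cancelʳ to ℤ-cancelʳ)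

-- The candidate mirrored permutation with prescribed images of 1, …, n, read off
-- from x = r + q N with 0 ≤ r < N; it is a bijection only for suitable images.
extendResidue : ∀ n → (ℕ → ℤ) → ℕ → ℤ
extendResidue n a r with r ℕ.≟ 0 | r ℕ.≤? n
... | yes _ | _     = 0ℤ
... | no  _ | yes _ = a r
... | no  _ | no  _ = + N n ℤ.- a (N n ∸ r)

extend : ∀ n → (ℕ → ℤ) → ℤ → ℤ
extend n a x = extendResidue n a (x %ℕ N n) ℤ.+ (x /ℕ N n) ℤ.* + N n

module Extend (n : ℕ) (a : ℕ → ℤ) where

  f : ℤ → ℤ
  f = extend n a

  n<N : n < N n
  n<N = s≤s (ℕ.m≤m+n n _)

  at : ∀ r q → r < N n → f (+ r ℤ.+ q ℤ.* + N n) ≡ extendResidue n a r ℤ.+ q ℤ.* + N n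
  at r q r<N =
    cong₂ (λ s p → extendResidue n a s ℤ.+ p ℤ.* + N n) (proj₁ same) (proj₂ same)
    where
    x = + r ℤ.+ q ℤ.* + N n
    same : x %ℕ N n ≡ r × x /ℕ N n ≡ q
    same = divMod-unique n (n%ℕd<d x (N n)) r<N (sym (a≡a%ℕn+[a/ℕn]*n x (N n)))

  data DivMod : ℤ → Set where
    divMod : ∀ r q → r < N n → DivMod (+ r ℤ.+ q ℤ.* + N n)

  divModOf : ∀ x → DivMod x
  divModOf x = subst DivMod (sym (a≡a%ℕn+[a/ℕn]*n x (N n)))
                 (divMod (x %ℕ N n) (x /ℕ N n) (n%ℕd<d x (N n)))

  shiftBy : ∀ p x → f (x ℤ.+ p ℤ.* + N n) ≡ f x ℤ.+ p ℤ.* + N n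
  shiftBy p x with divModOf x
  ... | divMod r q r<N = begin
    f (+ r ℤ.+ q ℤ.* M ℤ.+ p ℤ.* M)                  ≡⟨ cong f (regroup (+ r) q p M) ⟩
    f (+ r ℤ.+ (q ℤ.+ p) ℤ.* M)                      ≡⟨ at r (q ℤ.+ p) r<N ⟩
    extendResidue n a r ℤ.+ (q ℤ.+ p) ℤ.* M          ≡⟨ regroup (extendResidue n a r) q p M ⟨
    extendResidue n a r ℤ.+ q ℤ.* M ℤ.+ p ℤ.* M      ≡⟨ cong (ℤ._+ p ℤ.* M) (at r q r<N) ⟨
    f (+ r ℤ.+ q ℤ.* M) ℤ.+ p ℤ.* M                  ∎
    where
    open ≡-Reasoning
    M = + N n
    regroup : ∀ b q p m → b ℤ.+ q ℤ.* m ℤ.+ p ℤ.* m ≡ b ℤ.+ (q ℤ.+ p) ℤ.* m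
    regroup = solve-∀

  shift₁ : ∀ x → f (x ℤ.+ + N n) ≡ f x ℤ.+ + N n
  shift₁ x = subst (λ m → f (x ℤ.+ m) ≡ f x ℤ.+ m) (ℤ.*-identityˡ (+ N n)) (shiftBy 1ℤ x)

  residue-0 : extendResidue n a 0 ≡ 0ℤ
  residue-0 = refl

  residue-low : ∀ r → 1 ≤ r → r ≤ n → extendResidue n a r ≡ a r
  residue-low r 1≤r r≤n with r ℕ.≟ 0 | r ℕ.≤? n
  ... | yes refl | _       = contradiction 1≤r λ ()
  ... | no _     | yes _   = refl
  ... | no _     | no r≰n  = contradiction r≤n r≰n

  residue-high : ∀ r → n < r → extendResidue n a r ≡ + N n ℤ.- a (N n ∸ r)
  residue-high r n<r with r ℕ.≟ 0 | r ℕ.≤? n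
  ... | yes refl | _       = contradiction n<r λ ()
  ... | no _     | yes r≤n = contradiction r≤n (ℕ.<⇒≱ n<r)
  ... | no _     | no _    = refl

  N-n : N n ∸ n ≡ suc n
  N-n = trans (cong (λ m → suc (n +ℕ m) ∸ n) (ℕ.+-identityʳ n))
          (trans (cong (_∸ n) (ℕ.+-comm (suc n) n)) (ℕ.m+n∸m≡n n (suc n)))

  reflect-high : ∀ r → r ≤ n → n < N n ∸ r
  reflect-high r r≤n = subst (_≤ N n ∸ r) N-n (ℕ.∸-monoʳ-≤ (N n) r≤n)

  reflect-low : ∀ r → n < r → N n ∸ r ≤ n
  reflect-low r n<r = subst (N n ∸ r ≤_) eq (ℕ.∸-monoʳ-≤ (N n) n<r)
    where
    eq : N n ∸ suc n ≡ n
    eq = trans (ℕ.m+n∸m≡n n (n +ℕ 0)) (ℕ.+-identityʳ n)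

  residue-reflect : ∀ r → 1 ≤ r → r < N n →
                    extendResidue n a (N n ∸ r) ≡ + N n ℤ.- extendResidue n a r
  residue-reflect r 1≤r r<N with ℕ.≤-<-connex r n
  ... | inj₁ r≤n = begin
    extendResidue n a (N n ∸ r)        ≡⟨ residue-high _ (reflect-high r r≤n) ⟩
    + N n ℤ.- a (N n ∸ (N n ∸ r))      ≡⟨ cong (λ k → + N n ℤ.- a k) (ℕ.m∸[m∸n]≡n (ℕ.<⇒≤ r<N)) ⟩
    + N n ℤ.- a r                      ≡⟨ cong (λ z → + N n ℤ.- z) (residue-low r 1≤r r≤n) ⟨
    + N n ℤ.- extendResidue n a r      ∎
    where open ≡-Reasoning
  ... | inj₂ n<r = begin
    extendResidue n a (N n ∸ r)               ≡⟨ residue-low _ (ℕ.m<n⇒0<n∸m r<N) (reflect-low r n<r) ⟩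
    a (N n ∸ r)                               ≡⟨ involutive (+ N n) (a (N n ∸ r)) ⟨
    + N n ℤ.- (+ N n ℤ.- a (N n ∸ r))         ≡⟨ cong (λ z → + N n ℤ.- z) (residue-high r n<r) ⟨
    + N n ℤ.- extendResidue n a r             ∎
    where
    open ≡-Reasoning
    involutive : ∀ m z → m ℤ.- (m ℤ.- z) ≡ z
    involutive = solve-∀

  odd₁ : ∀ x → f (ℤ.- x) ≡ ℤ.- f x
  odd₁ x with divModOf x
  ... | divMod zero q r<N = begin
    f (ℤ.- (0ℤ ℤ.+ q ℤ.* M))             ≡⟨ cong f (negate q M) ⟩
    f (0ℤ ℤ.+ ℤ.- q ℤ.* M)               ≡⟨ at 0 (ℤ.- q) r<N ⟩
    0ℤ ℤ.+ ℤ.- q ℤ.* M                   ≡⟨ negate q M ⟨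
    ℤ.- (0ℤ ℤ.+ q ℤ.* M)                 ≡⟨ cong ℤ.-_ (at 0 q r<N) ⟨
    ℤ.- f (0ℤ ℤ.+ q ℤ.* M)               ∎
    where
    open ≡-Reasoning
    M = + N n
    negate : ∀ q m → ℤ.- (0ℤ ℤ.+ q ℤ.* m) ≡ 0ℤ ℤ.+ ℤ.- q ℤ.* m
    negate = solve-∀
  ... | divMod r@(suc r′) q r<N = begin
    f (ℤ.- (+ r ℤ.+ q ℤ.* M))                          ≡⟨ cong f (negate (+ r) q M) ⟩
    f ((M ℤ.- + r) ℤ.+ (ℤ.- q ℤ.- 1ℤ) ℤ.* M)           ≡⟨ cong (λ z → f (z ℤ.+ (ℤ.- q ℤ.- 1ℤ) ℤ.* M)) N-r ⟩
    f (+ (N n ∸ r) ℤ.+ (ℤ.- q ℤ.- 1ℤ) ℤ.* M)           ≡⟨ at (N n ∸ r) (ℤ.- q ℤ.- 1ℤ) (s≤s (ℕ.m∸n≤m (2 *ℕ n) r′)) ⟩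
    extendResidue n a (N n ∸ r) ℤ.+ (ℤ.- q ℤ.- 1ℤ) ℤ.* M
      ≡⟨ cong (ℤ._+ (ℤ.- q ℤ.- 1ℤ) ℤ.* M) (residue-reflect r (s≤s z≤n) r<N) ⟩
    (M ℤ.- extendResidue n a r) ℤ.+ (ℤ.- q ℤ.- 1ℤ) ℤ.* M ≡⟨ negate (extendResidue n a r) q M ⟨
    ℤ.- (extendResidue n a r ℤ.+ q ℤ.* M)              ≡⟨ cong ℤ.-_ (at r q r<N) ⟨
    ℤ.- f (+ r ℤ.+ q ℤ.* M)                            ∎
    where
    open ≡-Reasoning
    M = + N n
    negate : ∀ b q m → ℤ.- (b ℤ.+ q ℤ.* m) ≡ (m ℤ.- b) ℤ.+ (ℤ.- q ℤ.- 1ℤ) ℤ.* m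
    negate = solve-∀
    N-r : M ℤ.- + r ≡ + (N n ∸ r)
    N-r = trans (ℤ.m-n≡m⊖n (N n) r) (ℤ.⊖-≥ (ℕ.<⇒≤ r<N))

  low : ∀ r → 1 ≤ r → r ≤ n → f (+ r) ≡ a r
  low r 1≤r r≤n = begin
    f (+ r)                              ≡⟨ cong f (plus0 (+ r) M) ⟩
    f (+ r ℤ.+ 0ℤ ℤ.* M)                 ≡⟨ at r 0ℤ (ℕ.≤-<-trans r≤n n<N) ⟩
    extendResidue n a r ℤ.+ 0ℤ ℤ.* M     ≡⟨ plus0 (extendResidue n a r) M ⟨
    extendResidue n a r                  ≡⟨ residue-low r 1≤r r≤n ⟩
    a r                                  ∎
    where
    open ≡-Reasoning
    M = + N n
    plus0 : ∀ z m → z ≡ z ℤ.+ 0ℤ ℤ.* m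
    plus0 = solve-∀

  mirror : ∀ x → f (+ N n ℤ.- x) ≡ + N n ℤ.- f x
  mirror x = begin
    f (+ N n ℤ.- x)        ≡⟨ cong f (ℤ.+-comm (+ N n) (ℤ.- x)) ⟩
    f (ℤ.- x ℤ.+ + N n)    ≡⟨ shift₁ (ℤ.- x) ⟩
    f (ℤ.- x) ℤ.+ + N n    ≡⟨ cong (ℤ._+ + N n) (odd₁ x) ⟩
    ℤ.- f x ℤ.+ + N n      ≡⟨ ℤ.+-comm (ℤ.- f x) (+ N n) ⟩
    + N n ℤ.- f x          ∎
    where open ≡-Reasoning

  module _ (involution : ∀ r → 1 ≤ r → r ≤ n → f (a r) ≡ + r) where

    residue-involutive : ∀ r → r < N n → f (extendResidue n a r) ≡ + r
    residue-involutive r r<N with r ℕ.≟ 0 | r ℕ.≤? n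
    ... | yes refl | _       = at 0 0ℤ r<N
    ... | no r≢0   | yes r≤n = involution r (ℕ.n≢0⇒n>0 r≢0) r≤n
    ... | no _     | no r≰n  = begin
      f (+ N n ℤ.- a (N n ∸ r))    ≡⟨ mirror (a (N n ∸ r)) ⟩
      + N n ℤ.- f (a (N n ∸ r))    ≡⟨ cong (λ z → + N n ℤ.- z)
                                        (involution _ (ℕ.m<n⇒0<n∸m r<N) (reflect-low r (ℕ.≰⇒> r≰n))) ⟩
      + N n ℤ.- + (N n ∸ r)        ≡⟨ ℤ.m-n≡m⊖n (N n) (N n ∸ r) ⟩
      N n ℤ.⊖ (N n ∸ r)            ≡⟨ ℤ.⊖-≥ (ℕ.m∸n≤m (N n) r) ⟩
      + (N n ∸ (N n ∸ r))          ≡⟨ cong +_ (ℕ.m∸[m∸n]≡n (ℕ.<⇒≤ r<N)) ⟩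
      + r                          ∎
      where open ≡-Reasoning

    involutive : ∀ x → f (f x) ≡ x
    involutive x with divModOf x
    ... | divMod r q r<N = begin
      f (f (+ r ℤ.+ q ℤ.* + N n))                        ≡⟨ cong f (at r q r<N) ⟩
      f (extendResidue n a r ℤ.+ q ℤ.* + N n)            ≡⟨ shiftBy q (extendResidue n a r) ⟩
      f (extendResidue n a r) ℤ.+ q ℤ.* + N n            ≡⟨ cong (ℤ._+ q ℤ.* + N n) (residue-involutive r r<N) ⟩
      + r ℤ.+ q ℤ.* + N n                                ∎
      where open ≡-Reasoning

    mirrored : MirroredPerm n
    mirrored = record
      { perm  = mk↔ₛ′ f f involutive involutive
      ; shift = shift₁
      ; odd   = odd₁
      }

shiftBy : ∀ {n} (w : MirroredPerm n) q x → w ⟨$⟩ (x ℤ.+ q ℤ.* + N n) ≡ w ⟨$⟩ x ℤ.+ q ℤ.* + N n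
shiftBy {n} w = go
  where
  open MirroredPerm w using (to; shift)
  M = + N n
  up : ∀ k x → to (x ℤ.+ + k ℤ.* M) ≡ to x ℤ.+ + k ℤ.* M
  up zero    x = trans (cong to (plus0 x M)) (sym (plus0 (to x) M))
    where
    plus0 : ∀ z m → z ℤ.+ 0ℤ ℤ.* m ≡ z
    plus0 = solve-∀
  up (suc k) x = begin
    to (x ℤ.+ + suc k ℤ.* M)            ≡⟨ cong to (step x (+ k) M) ⟩
    to ((x ℤ.+ + k ℤ.* M) ℤ.+ M)        ≡⟨ shift _ ⟩
    to (x ℤ.+ + k ℤ.* M) ℤ.+ M          ≡⟨ cong (ℤ._+ M) (up k x) ⟩
    (to x ℤ.+ + k ℤ.* M) ℤ.+ M          ≡⟨ step (to x) (+ k) M ⟨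
    to x ℤ.+ + suc k ℤ.* M              ∎
    where
    open ≡-Reasoning
    step : ∀ z k m → z ℤ.+ (1ℤ ℤ.+ k) ℤ.* m ≡ (z ℤ.+ k ℤ.* m) ℤ.+ m
    step = solve-∀
  go : ∀ q x → to (x ℤ.+ q ℤ.* M) ≡ to x ℤ.+ q ℤ.* M
  go (+ k)      x = up k x
  go q@(-[1+ k ]) x = begin
    to y                                        ≡⟨ undo (to y) (+ suc k) M ⟩
    (to y ℤ.+ + suc k ℤ.* M) ℤ.+ q ℤ.* M        ≡⟨ cong (ℤ._+ q ℤ.* M) (up (suc k) y) ⟨
    to (y ℤ.+ + suc k ℤ.* M) ℤ.+ q ℤ.* M        ≡⟨ cong (λ z → to z ℤ.+ q ℤ.* M) (redo x (+ suc k) M) ⟩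
    to x ℤ.+ q ℤ.* M                            ∎
    where
    open ≡-Reasoning
    y = x ℤ.+ q ℤ.* M
    undo : ∀ z k m → z ≡ (z ℤ.+ k ℤ.* m) ℤ.+ (ℤ.- k) ℤ.* m
    undo = solve-∀
    redo : ∀ z k m → (z ℤ.+ (ℤ.- k) ℤ.* m) ℤ.+ k ℤ.* m ≡ z
    redo = solve-∀

------------------------------------------------------------------------
-- The four quotients

data Quotient : Set where
  C̃/C B̃/B B̃/D D̃/D : Quotient

-- The least n for which each type is considered.
minRank : Quotient → ℕ
minRank C̃/C = 2
minRank B̃/B = 3
minRank B̃/D = 3
minRank D̃/D = 4

EvenlyMany : (ℤ → Set) → Set
EvenlyMany P = ∃[ k ] 2 ∣ k × (Fin k ↔ Σ ℤ P)

-- i crosses the mirror at 0, respectively at N/2, when it starts at or below that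
-- mirror and w(i) lies above it.
CrossesZeroEvenly CrossesMiddleEvenly : ∀ {n} → MirroredPerm n → Set
CrossesZeroEvenly       w = EvenlyMany λ i → i ℤ.≤ 0ℤ × 1ℤ ℤ.≤ w ⟨$⟩ i
CrossesMiddleEvenly {n} w = EvenlyMany λ i → i ℤ.≤ + n × + suc n ℤ.≤ w ⟨$⟩ i

Member : Quotient → ∀ {n} → MirroredPerm n → Set
Member C̃/C w = ⊤
Member B̃/B w = CrossesZeroEvenly w
Member B̃/D w = CrossesMiddleEvenly w
Member D̃/D w = CrossesZeroEvenly w × CrossesMiddleEvenly w

s₀ᶜ s₀ᴰ : ℕ → ℤ
s₀ᶜ j = if does (j ℕ.≟ 1) then -[1+ 0 ] else + j
s₀ᴰ j = if does (j ℕ.≟ 1) then -[1+ 1 ] else if does (j ℕ.≟ 2) then -[1+ 0 ] else + j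

adjacent sₙᶜ sₙᴰ : ℕ → ℕ → ℤ
adjacent i j = if does (j ℕ.≟ i) then + suc i else if does (j ℕ.≟ suc i) then + i else + j
sₙᶜ n j = if does (j ℕ.≟ n) then + suc n else + j
sₙᴰ n j = if does (suc j ℕ.≟ n) then + suc n else if does (j ℕ.≟ n) then + suc (suc n) else + j

firstImages : Quotient → ℕ → ℤ
firstImages C̃/C = s₀ᶜ
firstImages B̃/B = s₀ᴰ
firstImages B̃/D = s₀ᶜ
firstImages D̃/D = s₀ᴰ

lastImages : Quotient → ℕ → ℕ → ℤ
lastImages C̃/C = sₙᶜ
lastImages B̃/B = sₙᶜ
lastImages B̃/D = sₙᴰ
lastImages D̃/D = sₙᴰ

-- generatorImages t n i j is the image of j under sᵢ, for 0 ≤ i ≤ n and 1 ≤ j ≤ n.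
generatorImages : Quotient → ℕ → ℕ → ℕ → ℤ
generatorImages t n i =
  if does (i ℕ.≟ 0) then firstImages t else
  if does (i ℕ.≟ n) then lastImages t n else
  adjacent i

Involution : ℕ → (ℕ → ℤ) → Set
Involution n a = ∀ r → 1 ≤ r → r ≤ n → extend n a (a r) ≡ + r

if-yes : ∀ {A : Set} {i j : ℕ} {x y : A} → i ≡ j → (if does (i ℕ.≟ j) then x else y) ≡ x
if-yes {x = x} {y} p = cong (if_then x else y) (dec-true (_ ℕ.≟ _) p)

if-no : ∀ {A : Set} {i j : ℕ} {x y : A} → i ≢ j → (if does (i ℕ.≟ j) then x else y) ≡ y
if-no {x = x} {y} p = cong (if_then x else y) (dec-false (_ ℕ.≟ _) p)

swaps⇒ : ∀ n a {p q : ℕ} → 1 ≤ q → q ≤ n → a p ≡ + q → a q ≡ + p → extend n a (a p) ≡ + p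
swaps⇒ n a {q = q} 1≤q q≤n ap aq = trans (cong (extend n a) ap) (trans (Extend.low n a q 1≤q q≤n) aq)

swapsNeg⇒ : ∀ n a {p q : ℕ} → 1 ≤ q → q ≤ n → a p ≡ ℤ.- + q → a q ≡ ℤ.- + p → extend n a (a p) ≡ + p
swapsNeg⇒ n a {p} {q} 1≤q q≤n ap aq = begin
  extend n a (a p)           ≡⟨ cong (extend n a) ap ⟩
  extend n a (ℤ.- + q)       ≡⟨ Extend.odd₁ n a (+ q) ⟩
  ℤ.- extend n a (+ q)       ≡⟨ cong ℤ.-_ (trans (Extend.low n a q 1≤q q≤n) aq) ⟩
  ℤ.- (ℤ.- + p)              ≡⟨ ℤ.neg-involutive (+ p) ⟩
  + p                        ∎
  where open ≡-Reasoning

swapsMirror⇒ : ∀ n a {p q : ℕ} → 1 ≤ q → q ≤ n →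
               a p ≡ + N n ℤ.- + q → a q ≡ + N n ℤ.- + p → extend n a (a p) ≡ + p
swapsMirror⇒ n a {p} {q} 1≤q q≤n ap aq = begin
  extend n a (a p)                     ≡⟨ cong (extend n a) ap ⟩
  extend n a (+ N n ℤ.- + q)           ≡⟨ Extend.mirror n a (+ q) ⟩
  + N n ℤ.- extend n a (+ q)           ≡⟨ cong (λ z → + N n ℤ.- z) (trans (Extend.low n a q 1≤q q≤n) aq) ⟩
  + N n ℤ.- (+ N n ℤ.- + p)            ≡⟨ cancel (+ N n) (+ p) ⟩
  + p                                  ∎
  where
  open ≡-Reasoning
  cancel : ∀ m z → m ℤ.- (m ℤ.- z) ≡ z
  cancel = solve-∀

N-minus : ∀ n (p q : ℕ) → p +ℕ q ≡ N n → + p ≡ + N n ℤ.- + q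
N-minus n p q eq = begin
  + p                        ≡⟨ back (+ p) (+ q) ⟩
  + (p +ℕ q) ℤ.- + q         ≡⟨ cong (λ k → + k ℤ.- + q) eq ⟩
  + N n ℤ.- + q              ∎
  where
  open ≡-Reasoning
  back : ∀ x y → x ≡ (x ℤ.+ y) ℤ.- y
  back = solve-∀

s₀ᶜ-involution : ∀ n → 1 ≤ n → Involution n s₀ᶜ
s₀ᶜ-involution n 1≤n r 1≤r r≤n with r ℕ.≟ 1
... | yes refl = swapsNeg⇒ n s₀ᶜ {1} {1} ℕ.≤-refl 1≤n refl refl
... | no r≢1   = swaps⇒ n s₀ᶜ 1≤r r≤n fixed fixed
  where
  fixed = if-no r≢1

s₀ᴰ-involution : ∀ n → 2 ≤ n → Involution n s₀ᴰ
s₀ᴰ-involution n 2≤n r 1≤r r≤n = case (r ℕ.≟ 1) (r ℕ.≟ 2)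
  where
  case : Dec (r ≡ 1) → Dec (r ≡ 2) → extend n s₀ᴰ (s₀ᴰ r) ≡ + r
  case (yes refl) _          = swapsNeg⇒ n s₀ᴰ {1} {2} (s≤s z≤n) 2≤n refl refl
  case (no _)     (yes refl) = swapsNeg⇒ n s₀ᴰ {2} {1} (s≤s z≤n) (ℕ.<⇒≤ 2≤n) refl refl
  case (no r≢1)   (no r≢2)   = swaps⇒ n s₀ᴰ 1≤r r≤n fixed fixed
    where
    fixed : s₀ᴰ r ≡ + r
    fixed = trans (if-no r≢1) (if-no r≢2)

adjacent-involution : ∀ n i → 1 ≤ i → i < n → Involution n (adjacent i)
adjacent-involution n i 1≤i i<n r 1≤r r≤n = case (r ℕ.≟ i) (r ℕ.≟ suc i)
  where
  at-i : adjacent i i ≡ + suc i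
  at-i = if-yes {i = i} refl
  at-suc : adjacent i (suc i) ≡ + i
  at-suc = trans (if-no (ℕ.1+n≢n {i})) (if-yes {i = suc i} refl)
  case : Dec (r ≡ i) → Dec (r ≡ suc i) → extend n (adjacent i) (adjacent i r) ≡ + r
  case (yes refl) _          = swaps⇒ n (adjacent i) (s≤s z≤n) i<n at-i at-suc
  case (no _)     (yes refl) = swaps⇒ n (adjacent i) 1≤i (ℕ.<⇒≤ i<n) at-suc at-i
  case (no r≢i)   (no r≢si)  = swaps⇒ n (adjacent i) 1≤r r≤n fixed fixed
    where
    fixed : adjacent i r ≡ + r
    fixed = trans (if-no r≢i) (if-no r≢si)

sₙᶜ-involution : ∀ n → Involution n (sₙᶜ n)
sₙᶜ-involution n r 1≤r r≤n = case (r ℕ.≟ n)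
  where
  case : Dec (r ≡ n) → extend n (sₙᶜ n) (sₙᶜ n r) ≡ + r
  case (yes refl) = swapsMirror⇒ n (sₙᶜ n) 1≤r r≤n at-n at-n
    where
    at-n : sₙᶜ n n ≡ + N n ℤ.- + n
    at-n = trans (if-yes {i = n} refl) (N-minus n (suc n) n (cong (λ k → suc (n +ℕ k)) (sym (ℕ.+-identityʳ n))))
  case (no r≢n)   = swaps⇒ n (sₙᶜ n) 1≤r r≤n fixed fixed
    where
    fixed : sₙᶜ n r ≡ + r
    fixed = if-no r≢n

sₙᴰ-involution : ∀ n → 2 ≤ n → Involution n (sₙᴰ n)
sₙᴰ-involution n@(suc k) (s≤s 1≤k) r 1≤r r≤n = case (r ℕ.≟ k) (r ℕ.≟ n)
  where
  at-k : sₙᴰ n k ≡ + N n ℤ.- + n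
  at-k = trans (if-yes {i = n} refl) (N-minus n (suc n) n (cong (λ m → suc (n +ℕ m)) (sym (ℕ.+-identityʳ n))))
  at-n : sₙᴰ n n ≡ + N n ℤ.- + k
  at-n = trans (trans (if-no (ℕ.1+n≢n {n})) (if-yes {i = n} refl))
           (N-minus n (suc (suc n)) k (cong suc (trans (cong suc (sym (ℕ.+-suc k k)))
             (cong (λ m → suc (k +ℕ m)) (cong suc (sym (ℕ.+-identityʳ k)))))))
  case : Dec (r ≡ k) → Dec (r ≡ n) → extend n (sₙᴰ n) (sₙᴰ n r) ≡ + r
  case (yes refl) _          = swapsMirror⇒ n (sₙᴰ n) (s≤s z≤n) ℕ.≤-refl at-k at-n
  case (no _)     (yes refl) = swapsMirror⇒ n (sₙᴰ n) 1≤k (ℕ.n≤1+n k) at-n at-k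
  case (no r≢k)   (no r≢n)   = swaps⇒ n (sₙᴰ n) 1≤r r≤n fixed fixed
    where
    fixed : sₙᴰ n r ≡ + r
    fixed = trans (if-no (r≢k ∘ ℕ.suc-injective)) (if-no r≢n)

minRank≥2 : ∀ t → 2 ≤ minRank t
minRank≥2 C̃/C = s≤s (s≤s z≤n)
minRank≥2 B̃/B = s≤s (s≤s z≤n)
minRank≥2 B̃/D = s≤s (s≤s z≤n)
minRank≥2 D̃/D = s≤s (s≤s z≤n)

generatorImages-involution : ∀ t n → minRank t ≤ n → ∀ i → i ≤ n → Involution n (generatorImages t n i)
generatorImages-involution t n rank i i≤n = case (i ℕ.≟ 0) (i ℕ.≟ n)
  where
  2≤n = ℕ.≤-trans (minRank≥2 t) rank
  first : ∀ t → Involution n (firstImages t)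
  first C̃/C = s₀ᶜ-involution n (ℕ.<⇒≤ 2≤n)
  first B̃/B = s₀ᴰ-involution n 2≤n
  first B̃/D = s₀ᶜ-involution n (ℕ.<⇒≤ 2≤n)
  first D̃/D = s₀ᴰ-involution n 2≤n
  last : ∀ t → Involution n (lastImages t n)
  last C̃/C = sₙᶜ-involution n
  last B̃/B = sₙᶜ-involution n
  last B̃/D = sₙᴰ-involution n 2≤n
  last D̃/D = sₙᴰ-involution n 2≤n
  case : Dec (i ≡ 0) → Dec (i ≡ n) → Involution n (generatorImages t n i)
  case (yes i≡0) _         = subst (Involution n) (sym (if-yes i≡0)) (first t)
  case (no i≢0)  (yes i≡n) = subst (Involution n) (sym (trans (if-no i≢0) (if-yes i≡n))) (last t)
  case (no i≢0)  (no i≢n)  = subst (Involution n) (sym (trans (if-no i≢0) (if-no i≢n)))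
                               (adjacent-involution n i (ℕ.n≢0⇒n>0 i≢0) (ℕ.≤∧≢⇒< i≤n i≢n))

module AffineGroup (t : Quotient) (n : ℕ) (rank : minRank t ≤ n) where

  generator : Fin (suc n) → MirroredPerm n
  generator i = Extend.mirrored n (generatorImages t n (toℕ i))
                  (generatorImages-involution t n rank (toℕ i) (ℕ.≤-pred (toℕ<n i)))

  Word : Set
  Word = List (Fin (suc n))

  product : Word → MirroredPerm n
  product []       = idₘ
  product (i ∷ is) = generator i ∘ₘ product is

  infix 4 _Expresses_
  _Expresses_ : Word → MirroredPerm n → Set
  is Expresses w = product is ≈ₘ w

  record HasLength (w : MirroredPerm n) (k : ℕ) : Set where
    field
      word     : Word
      express  : word Expresses w
      length≡k : length word ≡ k
      shortest : ∀ is → is Expresses w → k ≤ length is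

  -- The subgroup W generated by s₁, …, sₙ; the generators are involutions, so
  -- inverses need not be allowed in words.
  InParabolic : MirroredPerm n → Set
  InParabolic x = ∃[ is ] (map suc is) Expresses x

  -- Minimal length representatives of the cosets wW, i.e. the elements of W̃/W.
  record MinimalRep : Set where
    field
      element       : MirroredPerm n
      member        : Member t element
      len           : ℕ
      hasLength     : HasLength element len
      minimal       : ∀ x → InParabolic x → ∀ l → HasLength (element ∘ₘ x) l → len ≤ l

  open MinimalRep public using (element)

  infix 4 _≈ᵣ_
  _≈ᵣ_ : MinimalRep → MinimalRep → Set
  v ≈ᵣ w = element v ≈ₘ element w

------------------------------------------------------------------------
-- Abaci

-- Runner i : Fin (2 n) is column 1 + toℕ i; entries that are not beads are gaps.
record Abacus (n : ℕ) : Set₁ where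
  field
    Bead : (runner : Fin (2 *ℕ n)) (level : ℤ) → Set

open Abacus public

entry : ∀ n → Fin (2 *ℕ n) → ℤ → ℤ
entry n i m = m ℤ.* + N n ℤ.+ + suc (toℕ i)

Flush : ∀ {n} → Abacus n → Set
Flush A = ∀ i {m m′} → m′ ℤ.≤ m → Bead A i m → Bead A i m′

LowestBead : ∀ {n} → Abacus n → Fin (2 *ℕ n) → ℤ → Set
LowestBead A i m = Bead A i m × (∀ m′ → Bead A i m′ → m′ ℤ.≤ m)

InWindow : ∀ {n} → MirroredPerm n → ℤ → Set
InWindow {n} w x = ∃[ j ] x ≡ w ⟨$⟩ (+ suc (toℕ {2 *ℕ n} j))

-- 𝒜-flush, lowestBead and lowestBead-inWindow below show that this is the flush
-- abacus whose lowest beads are w(1), …, w(2n).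
𝒜 : ∀ {n} → MirroredPerm n → Abacus n
𝒜 {n} w .Bead i m = ∃[ m′ ] m ℤ.≤ m′ × InWindow w (entry n i m′)

𝒜-flush : ∀ {n} (w : MirroredPerm n) → Flush (𝒜 w)
𝒜-flush w i m′≤m (k , m≤k , k∈) = k , ℤ.≤-trans m′≤m m≤k , k∈

lowestBead-inWindow : ∀ {n} (w : MirroredPerm n) i m → LowestBead (𝒜 w) i m → InWindow w (entry n i m)
lowestBead-inWindow {n} w i m ((k , m≤k , k∈) , max) =
  subst (λ l → InWindow w (entry n i l)) (ℤ.≤-antisym (max k (k , ℤ.≤-refl , k∈)) m≤k) k∈

lowestBead : ∀ {n} (w : MirroredPerm n) i → ∃[ m ] LowestBead (𝒜 w) i m
lowestBead {n} w i = find (Extend.divModOf n +_ (from (+ c))) refl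
  where
  open MirroredPerm w using (to; from; strictlyInverseˡ; strictlyInverseʳ)
  M = + N n
  c = suc (toℕ i)
  c<N : c < N n
  c<N = s≤s (toℕ<n i)
  swap : ∀ c q m → c ≡ (q ℤ.* m ℤ.+ c) ℤ.+ (ℤ.- q) ℤ.* m
  swap = solve-∀
  flip : ∀ c q m → (c ℤ.+ q ℤ.* m) ℤ.+ (ℤ.- q) ℤ.* m ≡ c
  flip = solve-∀
  window⇒ : ∀ r q {k} → r < N n → from (+ c) ≡ + r ℤ.+ q ℤ.* M → InWindow w (entry n i k) → k ≡ ℤ.- q
  window⇒ r q {k} r<N eq (j , k∈) =
    trans (sym (ℤ.neg-involutive k)) (cong ℤ.-_ (proj₂ (divMod-unique n {p = ℤ.- k} {q} (s≤s (toℕ<n j)) r<N same)))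
    where
    open ≡-Reasoning
    d = + suc (toℕ j)
    same : d ℤ.+ (ℤ.- k) ℤ.* M ≡ + r ℤ.+ q ℤ.* M
    same = begin
      d ℤ.+ (ℤ.- k) ℤ.* M                      ≡⟨ strictlyInverseʳ _ ⟨
      from (to (d ℤ.+ (ℤ.- k) ℤ.* M))          ≡⟨ cong from (shiftBy w (ℤ.- k) d) ⟩
      from (to d ℤ.+ (ℤ.- k) ℤ.* M)            ≡⟨ cong (λ z → from (z ℤ.+ (ℤ.- k) ℤ.* M)) k∈ ⟨
      from (entry n i k ℤ.+ (ℤ.- k) ℤ.* M)       ≡⟨ cong from (swap (+ c) k M) ⟨
      from (+ c)                               ≡⟨ eq ⟩
      + r ℤ.+ q ℤ.* M                          ∎
  image : ∀ r q → from (+ c) ≡ + r ℤ.+ q ℤ.* M → + c ≡ to (+ r) ℤ.+ q ℤ.* M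
  image r q eq = begin
    + c                        ≡⟨ strictlyInverseˡ (+ c) ⟨
    to (from (+ c))            ≡⟨ cong to eq ⟩
    to (+ r ℤ.+ q ℤ.* M)       ≡⟨ shiftBy w q (+ r) ⟩
    to (+ r) ℤ.+ q ℤ.* M       ∎
    where open ≡-Reasoning
  self-neg : ∀ z → z ≡ ℤ.- z → z ≡ 0ℤ
  self-neg (+ zero) _ = refl
  to0 : to 0ℤ ≡ 0ℤ
  to0 = self-neg (to 0ℤ) (MirroredPerm.odd w 0ℤ)
  find : ∀ {x} → Extend.DivMod n +_ x → from (+ c) ≡ x → ∃[ m ] LowestBead (𝒜 w) i m
  find (Extend.divMod zero q r<N) eq =
    contradiction (proj₁ (divMod-unique n {c} {0} {0ℤ} {q} c<N r<N
      (trans (ℤ.+-identityʳ (+ c)) (trans (image 0 q eq) (cong (ℤ._+ q ℤ.* M) to0))))) λ ()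
  find (Extend.divMod (suc r) q r<N@(s≤s r<2n)) eq =
    ℤ.- q , (ℤ.- q , ℤ.≤-refl , fromℕ< r<2n , hit)
          , λ m (k , m≤k , k∈) → subst (m ℤ.≤_) (window⇒ (suc r) q r<N eq k∈) m≤k
    where
    open ≡-Reasoning
    hit : entry n i (ℤ.- q) ≡ to (+ suc (toℕ (fromℕ< r<2n)))
    hit = begin
      (ℤ.- q) ℤ.* M ℤ.+ + c                                   ≡⟨ ℤ.+-comm ((ℤ.- q) ℤ.* M) (+ c) ⟩
      + c ℤ.+ (ℤ.- q) ℤ.* M                                   ≡⟨ cong (ℤ._+ (ℤ.- q) ℤ.* M) (image (suc r) q eq) ⟩
      (to (+ suc r) ℤ.+ q ℤ.* M) ℤ.+ (ℤ.- q) ℤ.* M            ≡⟨ flip (to (+ suc r)) q M ⟩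
      to (+ suc r)                                            ≡⟨ cong (λ k → to (+ suc k)) (toℕ-fromℕ< r<2n) ⟨
      to (+ suc (toℕ (fromℕ< r<2n)))                          ∎

level : ∀ {n} → MirroredPerm n → Fin n → ℤ
level {n} w i = proj₁ (lowestBead w (inject≤ i (ℕ.m≤m+n n _)))

------------------------------------------------------------------------
-- The action on V

-- V is Kⁿ for a field K of characteristic zero; the real numbers are the case of
-- interest.
CharacteristicZero : ∀ {c ℓ₁ ℓ₂} → HeytingField c ℓ₁ ℓ₂ → Set ℓ₂
CharacteristicZero K = ∀ k → (suc k ×# 1#) # 0#
  where
  open HeytingField K using (heytingCommutativeRing; _#_; 0#; 1#)
  open CommutativeRing (HeytingCommutativeRing.commutativeRing heytingCommutativeRing) using (+-monoid)
  open MonoidMult +-monoid using () renaming (_×_ to _×#_)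

module VectorSpace {c ℓ₁ ℓ₂} (K : HeytingField c ℓ₁ ℓ₂) (n : ℕ) where

  open HeytingField K hiding (sym; trans; refl; zero)
  open CommutativeRing (HeytingCommutativeRing.commutativeRing heytingCommutativeRing)
    using (ring; semiring; +-monoid)
  open MonoidMult +-monoid using () renaming (_×_ to _×#_)
  open SemiringSum semiring using (sum; sum-cong-≋; ∑-distrib-+; *-distribˡ-sum)

  fromℤ : ℤ → Carrier
  fromℤ (+ k)    = k ×# 1#
  fromℤ -[1+ k ] = - (suc k ×# 1#)

  V : Set c
  V = Vector Carrier n

  infix 4 _≈ᵥ_
  _≈ᵥ_ : V → V → Set ℓ₁
  u ≈ᵥ v = ∀ k → u k ≈ v k

  infixl 6 _+ᵥ_ _-ᵥ_
  infixr 7 _·ᵥ_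
  _+ᵥ_ _-ᵥ_ : V → V → V
  (u +ᵥ v) k = u k + v k
  (u -ᵥ v) k = u k - v k

  _·ᵥ_ : Carrier → V → V
  (a ·ᵥ v) k = a * v k

  0ᵥ : V
  0ᵥ k = 0#

  ⟨_,_⟩ : V → V → Carrier
  ⟨ u , v ⟩ = sum λ k → u k * v k

  -- e i is the basis vector eᵢ for 1 ≤ i ≤ n, numbered from 1.
  e : ℕ → V
  e i k = if does (i ℕ.≟ suc (toℕ k)) then 1# else 0#

  -- Σᵢ aᵢ eᵢ
  latticePoint : (Fin n → ℤ) → V
  latticePoint a k = sum λ i → (fromℤ (a i) ·ᵥ e (suc (toℕ i))) k

  2# : Carrier
  2# = 1# + 1#

  -- #⇒invertible supplies the inverse of x - 0#, which equals x.
  2/⟨_⟩ : ∀ {x} → x # 0# → Carrier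
  2/⟨ x#0 ⟩ = 2# * proj₁ (#⇒invertible x#0)

  reflection : (α : V) → ⟨ α , α ⟩ # 0# → V → V
  reflection α α#0 v = v -ᵥ (⟨ v , α ⟩ * 2/⟨ α#0 ⟩) ·ᵥ α

  affineReflection : (α : V) → ⟨ α , α ⟩ # 0# → V → V
  affineReflection α α#0 v = v -ᵥ ((⟨ v , α ⟩ - 1#) * 2/⟨ α#0 ⟩) ·ᵥ α

  lastRoot α̃ : Quotient → V
  lastRoot C̃/C = 2# ·ᵥ e n
  lastRoot B̃/B = e n
  lastRoot B̃/D = e (n ∸ 1) +ᵥ e n
  lastRoot D̃/D = e (n ∸ 1) +ᵥ e n

  α̃ C̃/C = 2# ·ᵥ e 1
  α̃ B̃/B = e 1 +ᵥ e 2
  α̃ B̃/D = 2# ·ᵥ e 1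
  α̃ D̃/D = e 1 +ᵥ e 2

  α : Quotient → ℕ → V
  α t i = if does (i ℕ.≟ n) then lastRoot t else e i -ᵥ e (suc i)

  module RootsNonzero (char0 : CharacteristicZero K) where

    open HeytingField K using () renaming (sym to ≈-sym; trans to ≈-trans; refl to ≈-refl)
    open HeytingProperties heytingCommutativeRing using (#-congʳ; x#0y#0→xy#0; 1#0)
    open RingProperties ring using (-‿distribˡ-*; -‿involutive)
    open SetoidReasoning setoid

    NonIsotropic : V → Set ℓ₂
    NonIsotropic v = ⟨ v , v ⟩ # 0#

    2#0 : 2# # 0#
    2#0 = #-congʳ (+-congˡ (+-identityʳ 1#)) (char0 1)

    sum-zero : ∀ {m} (f : Vector Carrier m) → (∀ k → f k ≈ 0#) → sum f ≈ 0#
    sum-zero {zero}  f f≈0 = ≈-refl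
    sum-zero {suc m} f f≈0 = ≈-trans (+-cong (f≈0 zero) (sum-zero (f ∘ suc) (f≈0 ∘ suc))) (+-identityˡ 0#)

    sum-single : ∀ {m} (f : Vector Carrier m) k → (∀ j → j ≢ k → f j ≈ 0#) → sum f ≈ f k
    sum-single {suc m} f zero    f≈0 =
      ≈-trans (+-congˡ (sum-zero (f ∘ suc) λ j → f≈0 (suc j) λ ())) (+-identityʳ _)
    sum-single {suc m} f (suc k) f≈0 =
      ≈-trans (+-cong (f≈0 zero λ ()) (sum-single (f ∘ suc) k λ j j≢k → f≈0 (suc j) (j≢k ∘ Fin-suc-injective)))
            (+-identityˡ _)

    e-yes : ∀ i k → i ≡ suc (toℕ k) → e i k ≡ 1#
    e-yes i k p = cong (if_then 1# else 0#) (dec-true (i ℕ.≟ suc (toℕ k)) p)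

    e-no : ∀ i k → i ≢ suc (toℕ k) → e i k ≡ 0#
    e-no i k p = cong (if_then 1# else 0#) (dec-false (i ℕ.≟ suc (toℕ k)) p)

    ⟨e,⟩ : ∀ (k : Fin n) v → ⟨ e (suc (toℕ k)) , v ⟩ ≈ v k
    ⟨e,⟩ k v = begin
      sum (λ j → e (suc (toℕ k)) j * v j)    ≈⟨ sum-single _ k off ⟩
      e (suc (toℕ k)) k * v k                ≡⟨ cong (_* v k) (e-yes _ k refl) ⟩
      1# * v k                               ≈⟨ *-identityˡ (v k) ⟩
      v k                                    ∎
      where
      off : ∀ j → j ≢ k → e (suc (toℕ k)) j * v j ≈ 0#
      off j j≢k = ≈-trans (reflexive (cong (_* v j) (e-no _ j λ p → j≢k (sym (toℕ-injective (ℕ.suc-injective p))))))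
                        (zeroˡ (v j))

    sum-combination : ∀ {m} (b : Carrier) (f g : Vector Carrier m) →
                      sum (λ k → f k + b * g k) ≈ sum f + b * sum g
    sum-combination b f g =
      ≈-trans (∑-distrib-+ f (λ k → b * g k)) (+-congˡ (≈-sym (*-distribˡ-sum b g)))

    -- ⟨eᵢ + b eⱼ , eᵢ + b eⱼ⟩ = 1 + b² for i ≠ j.
    norm : ∀ (i j : Fin n) b (v : V) → i ≢ j →
           (∀ k → v k ≈ e (suc (toℕ i)) k + b * e (suc (toℕ j)) k) → ⟨ v , v ⟩ ≈ 1# + b * b
    norm i j b v i≢j v≈ = begin
      sum (λ k → v k * v k)
        ≈⟨ sum-cong-≋ (λ k → ≈-trans (*-congʳ (v≈ k)) (≈-trans (distribʳ _ _ _) (+-congˡ (*-assoc _ _ _)))) ⟩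
      sum (λ k → e (suc (toℕ i)) k * v k + b * (e (suc (toℕ j)) k * v k))
        ≈⟨ sum-combination b (λ k → e (suc (toℕ i)) k * v k) (λ k → e (suc (toℕ j)) k * v k) ⟩
      ⟨ e (suc (toℕ i)) , v ⟩ + b * ⟨ e (suc (toℕ j)) , v ⟩
        ≈⟨ +-cong (⟨e,⟩ i v) (*-congˡ (⟨e,⟩ j v)) ⟩
      v i + b * v j
        ≈⟨ +-cong (v≈ i) (*-congˡ (v≈ j)) ⟩
      (e (suc (toℕ i)) i + b * e (suc (toℕ j)) i) + b * (e (suc (toℕ i)) j + b * e (suc (toℕ j)) j)
        ≡⟨ cong₂ (λ x y → (x + b * e (suc (toℕ j)) i) + b * (e (suc (toℕ i)) j + b * y))
             (e-yes _ i refl) (e-yes _ j refl) ⟩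
      (1# + b * e (suc (toℕ j)) i) + b * (e (suc (toℕ i)) j + b * 1#)
        ≡⟨ cong₂ (λ x y → (1# + b * x) + b * (y + b * 1#))
             (e-no _ i λ p → i≢j (sym (toℕ-injective (ℕ.suc-injective p))))
             (e-no _ j λ p → i≢j (toℕ-injective (ℕ.suc-injective p))) ⟩
      (1# + b * 0#) + b * (0# + b * 1#)
        ≈⟨ +-cong (≈-trans (+-congˡ (zeroʳ b)) (+-identityʳ 1#))
                  (*-congˡ (≈-trans (+-identityˡ _) (*-identityʳ b))) ⟩
      1# + b * b  ∎

    index : ∀ {i} → suc i ≤ n → Fin n
    index i<n = fromℕ< i<n

    e-index : ∀ {i} (i<n : suc i ≤ n) k → e (suc i) k ≡ e (suc (toℕ (index i<n))) k
    e-index i<n k = cong (λ m → e (suc m) k) (sym (toℕ-fromℕ< i<n))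

    index-≢ : ∀ {i j} (p : suc i ≤ n) (q : suc j ≤ n) → i ≢ j → index p ≢ index q
    index-≢ p q i≢j eq = i≢j (trans (sym (toℕ-fromℕ< p)) (trans (cong toℕ eq) (toℕ-fromℕ< q)))

    1+1#0 : ∀ {b} → b * b ≈ 1# → 1# + b * b # 0#
    1+1#0 b²≈1 = #-congʳ (+-congˡ (≈-sym b²≈1)) 2#0

    e-nonIsotropic : ∀ i → 1 ≤ i → i ≤ n → NonIsotropic (e i)
    e-nonIsotropic (suc i) _ i<n = #-congʳ (≈-sym (begin
      ⟨ e (suc i) , e (suc i) ⟩    ≡⟨ cong (λ m → ⟨ e (suc m) , e (suc i) ⟩) (toℕ-fromℕ< i<n) ⟨
      ⟨ e (suc (toℕ (index i<n))) , e (suc i) ⟩    ≈⟨ ⟨e,⟩ (index i<n) _ ⟩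
      e (suc i) (index i<n)        ≡⟨ e-yes _ _ (cong suc (sym (toℕ-fromℕ< i<n))) ⟩
      1#                           ∎)) 1#0

    2e-nonIsotropic : ∀ i → 1 ≤ i → i ≤ n → NonIsotropic (2# ·ᵥ e i)
    2e-nonIsotropic i 1≤i i≤n = #-congʳ (≈-sym (begin
      sum (λ k → (2# * e i k) * (2# * e i k))    ≈⟨ sum-cong-≋ (λ k → rearrange (e i k)) ⟩
      sum (λ k → (2# * 2#) * (e i k * e i k))    ≈⟨ *-distribˡ-sum (2# * 2#) (λ k → e i k * e i k) ⟨
      (2# * 2#) * ⟨ e i , e i ⟩                  ∎))
      (x#0y#0→xy#0 (x#0y#0→xy#0 2#0 2#0) (e-nonIsotropic i 1≤i i≤n))
      where
      rearrange : ∀ x → (2# * x) * (2# * x) ≈ (2# * 2#) * (x * x)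
      rearrange x = begin
        (2# * x) * (2# * x)    ≈⟨ *-assoc 2# x (2# * x) ⟩
        2# * (x * (2# * x))    ≈⟨ *-congˡ (≈-trans (≈-sym (*-assoc x 2# x)) (≈-trans (*-congʳ (*-comm x 2#)) (*-assoc 2# x x))) ⟩
        2# * (2# * (x * x))    ≈⟨ *-assoc 2# 2# (x * x) ⟨
        (2# * 2#) * (x * x)    ∎

    e+e-nonIsotropic : ∀ i j → 1 ≤ i → i ≤ n → 1 ≤ j → j ≤ n → i ≢ j → NonIsotropic (e i +ᵥ e j)
    e+e-nonIsotropic (suc i) (suc j) _ i<n _ j<n i≢j =
      #-congʳ (≈-sym (norm (index i<n) (index j<n) 1# _ (index-≢ i<n j<n (i≢j ∘ cong suc)) λ k →
        +-cong (reflexive (e-index i<n k))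
               (≈-trans (reflexive (e-index j<n k)) (≈-sym (*-identityˡ _)))))
        (1+1#0 (*-identityˡ 1#))

    e-e-nonIsotropic : ∀ i j → 1 ≤ i → i ≤ n → 1 ≤ j → j ≤ n → i ≢ j → NonIsotropic (e i -ᵥ e j)
    e-e-nonIsotropic (suc i) (suc j) _ i<n _ j<n i≢j =
      #-congʳ (≈-sym (norm (index i<n) (index j<n) (- 1#) _ (index-≢ i<n j<n (i≢j ∘ cong suc)) λ k →
        +-cong (reflexive (e-index i<n k))
               (≈-trans (-‿cong (≈-trans (reflexive (e-index j<n k)) (≈-sym (*-identityˡ _))))
                      (-‿distribˡ-* 1# _))))
        (1+1#0 (≈-trans (≈-sym (-‿distribˡ-* 1# (- 1#)))
                 (≈-trans (-‿cong (*-identityˡ (- 1#))) (-‿involutive 1#))))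

    module _ (t : Quotient) (rank : minRank t ≤ n) where

      2≤n : 2 ≤ n
      2≤n = ℕ.≤-trans (minRank≥2 t) rank

      1≤n : 1 ≤ n
      1≤n = ℕ.<⇒≤ 2≤n

      α̃-nonIsotropic : NonIsotropic (α̃ t)
      α̃-nonIsotropic = go t
        where
        go : ∀ t → NonIsotropic (α̃ t)
        go C̃/C = 2e-nonIsotropic 1 ℕ.≤-refl 1≤n
        go B̃/B = e+e-nonIsotropic 1 2 ℕ.≤-refl 1≤n (s≤s z≤n) 2≤n λ ()
        go B̃/D = 2e-nonIsotropic 1 ℕ.≤-refl 1≤n
        go D̃/D = e+e-nonIsotropic 1 2 ℕ.≤-refl 1≤n (s≤s z≤n) 2≤n λ ()

      lastRoot-nonIsotropic : NonIsotropic (lastRoot t)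
      lastRoot-nonIsotropic = go t
        where
        pair : NonIsotropic (e (n ∸ 1) +ᵥ e n)
        pair = e+e-nonIsotropic (n ∸ 1) n (ℕ.∸-monoˡ-≤ 1 2≤n) (ℕ.m∸n≤m n 1) 1≤n ℕ.≤-refl
                 λ p → ℕ.<-irrefl p (ℕ.∸-monoʳ-< {n} (s≤s z≤n) 1≤n)
        go : ∀ t → NonIsotropic (lastRoot t)
        go C̃/C = 2e-nonIsotropic n 1≤n ℕ.≤-refl
        go B̃/B = e-nonIsotropic n 1≤n ℕ.≤-refl
        go B̃/D = pair
        go D̃/D = pair

      α-nonIsotropic : ∀ i → 1 ≤ i → i ≤ n → NonIsotropic (α t i)
      α-nonIsotropic i 1≤i i≤n = go (i ℕ.≟ n)
        where
        go : Dec (i ≡ n) → NonIsotropic (α t i)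
        go (yes p) = subst NonIsotropic (sym (cong (if_then lastRoot t else (e i -ᵥ e (suc i))) (dec-true (i ℕ.≟ n) p)))
                       lastRoot-nonIsotropic
        go (no p)  = subst NonIsotropic (sym (cong (if_then lastRoot t else (e i -ᵥ e (suc i))) (dec-false (i ℕ.≟ n) p)))
                       (e-e-nonIsotropic i (suc i) 1≤i i≤n (s≤s z≤n) (ℕ.≤∧≢⇒< i≤n p) (ℕ.1+n≢n ∘ sym))

module Action {c ℓ₁ ℓ₂} (K : HeytingField c ℓ₁ ℓ₂) (char0 : CharacteristicZero K)
              (t : Quotient) (n : ℕ) (rank : minRank t ≤ n) where

  open VectorSpace K n public
  open RootsNonzero char0 using (α̃-nonIsotropic; α-nonIsotropic)
  open AffineGroup t n rank public

  generatorAct : Fin (suc n) → V → V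
  generatorAct zero    = affineReflection (α̃ t) (α̃-nonIsotropic t rank)
  generatorAct (suc i) = reflection (α t (suc (toℕ i))) (α-nonIsotropic t rank (suc (toℕ i)) (s≤s z≤n) (toℕ<n i))

  act : Word → V → V
  act []       v = v
  act (i ∷ is) v = generatorAct i (act is v)

  -- w(0), computed along the reduced word carried by w.  That every other word for w
  -- gives the same point is part of the main statement.
  rootLatticeCoordinate : MinimalRep → V
  rootLatticeCoordinate w = act (HasLength.word (MinimalRep.hasLength w)) 0ᵥ

open CommutativeMonoidSum ℕ.+-0-commutativeMonoid using () renaming (sum to sumℕ)

-- The integer points of the image of w ↦ w(0), by coefficient vector.
InImage : Quotient → ∀ {n} → (Fin n → ℤ) → Set
InImage C̃/C a = ⊤
InImage B̃/B a = 2 ∣ sumℕ λ i → ℤ.∣ a i ∣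
InImage B̃/D a = ⊤
InImage D̃/D a = 2 ∣ sumℕ λ i → ℤ.∣ a i ∣

{-# OPTIONS --safe #-}
module Submission where

open import Algebra.Apartness.Bundles using (HeytingCommutativeRing; HeytingField)
open import Algebra.Bundles using (CommutativeRing)
import Algebra.Properties.CommutativeMonoid.Sum as CommutativeMonoidSum
import Algebra.Properties.Monoid.Mult as MonoidMult
import Algebra.Properties.Ring as RingProperties
import Algebra.Properties.Semiring.Sum as SemiringSum
open import Data.Bool.Base using (if_then_else_)
open import Data.Empty using (⊥)
open import Data.Fin.Base using (Fin; zero; suc; toℕ; fromℕ<; inject≤; opposite; punchIn; punchOut)
open import Data.Fin.Properties as Fin using (toℕ<n; toℕ-fromℕ<; toℕ-injective)
open import Data.Integer.Base as ℤ using (ℤ; +_; -[1+_]; 0ℤ; 1ℤ)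
import Data.Integer.Properties as ℤ
open import Data.Integer.Tactic.RingSolver using (solve-∀)
open import Data.List.Base using (List; []; _∷_; length; map)
open import Data.Nat.Base as ℕ using (ℕ; zero; suc; _≤_; z≤n; s≤s)
open import Data.Nat.Divisibility using (_∣_; ∣m+n∣m⇒∣n; ∣m∣n⇒∣m+n; ∣-refl; ∣1⇒≡1; _∣0; m∣m*n)
import Data.Nat.Properties as ℕ
import Data.Nat.Tactic.RingSolver as ℕSolver
open import Data.Product.Base using (∃; ∃-syntax; Σ; _×_; _,_; proj₁; proj₂)
open import Data.Sum.Base using (_⊎_; inj₁; inj₂)
open import Data.Unit.Base using (tt)
open import Function.Base using (_∘_)
open import Function.Bundles using (_⇔_; mk⇔; mk↔ₛ′; module Inverse)
open import Function.Construct.Symmetry using (↔-sym)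
open import Function.Definitions using (Injective)
open import Relation.Binary.Definitions using (tri<; tri≈; tri>)
open import Relation.Binary.PropositionalEquality
  using (_≡_; _≢_; refl; sym; trans; cong; cong₂; subst; subst₂; module ≡-Reasoning)
import Relation.Binary.Reasoning.Setoid as SetoidReasoning
open import Relation.Nullary using (Dec; yes; no; contradiction; ¬_; Irrelevant)
open import Relation.Nullary.Decidable using (toWitness; _→-dec_; _⊎-dec_; map′; dec-true; dec-false)
open import Relation.Unary using (Decidable)
open import Defs

-- A word acts on 0 exactly as its product acts on levels: if s exchanges the columns
-- i and j, up to the mirrors x ↦ −x and x ↦ N − x, then level_i(s w) is level_j(w),
-- −level_j(w) or 1 − level_j(w), and these are the coordinates of the reflected point.
--
-- For injectivity, let s_r swap p < q.  If w(p) > w(q), some letter s of a word for w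
-- first reverses the pair; s then coincides with the reflection exchanging the two
-- values, so deleting it gives a shorter word for w s_r.  Hence the window of a minimal
-- representative is sorted, and a sorted window is determined by the levels.  When
-- s_n is double, w(n) and w(n+1) may be out of order, but exchanging them changes the
-- parity of |{i ≤ n : w(i) ≥ n+1}|.
--
-- For surjectivity, every lattice point satisfying the parity condition is carried to
-- 0 by the generators, and a shortest word with given levels is minimal in its coset.

-- Mirrored permutations

-- The action on V is given along words. Levels depend only on the product, so comparing the image
-- of 0 with them is what makes it independent of the word. Lengths, too, are controlled through
-- words alone: an inverted pair lets a letter be deleted.
--
-- The obstacle is that a generator may reverse more pairs than it exchanges. s₀ also reverses pairs
-- containing a multiple of N, and s₀ᴰ and sₙᴰ reverse pairs of mirror images. The values of a
-- permutation at the two positions swapped by a parabolic generator are never multiples of N, and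
-- they are mirror images only for a single last generator, as x and N - x. This can collide with
-- s₀ᴰ only in type B̃/B; there a reversed mirror pair sums to an even multiple of N, whereas x and
-- N - x sum to N.
--
-- For surjectivity the obstacle is that double generators change two coordinates at a time. What
-- every type offers is translation along eᵢ + eⱼ, which moves all coordinates into one; a sign
-- change in a second coordinate then removes any even remainder.

pos : ∀ {n} → Fin n → ℤ
pos k = + suc (toℕ k)

module Mirrored (n : ℕ) where

  private
    M = + N n

  infix 20 _⁻¹ₘ
  _⁻¹ₘ : MirroredPerm n → MirroredPerm n
  w ⁻¹ₘ = record
    { perm  = ↔-sym perm
    ; shift = λ i → trans (cong (λ z → from (z ℤ.+ M)) (sym (strictlyInverseˡ i)))
                      (trans (cong from (sym (shift (from i)))) (strictlyInverseʳ _))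
    ; odd   = λ i → trans (cong (λ z → from (ℤ.- z)) (sym (strictlyInverseˡ i)))
                      (trans (cong from (sym (odd (from i)))) (strictlyInverseʳ _))
    }
    where open MirroredPerm w

  inverseˡ : ∀ (w : MirroredPerm n) z → w ⟨$⟩ (w ⁻¹ₘ ⟨$⟩ z) ≡ z
  inverseˡ w = MirroredPerm.strictlyInverseˡ w

  inverseʳ : ∀ (w : MirroredPerm n) z → w ⁻¹ₘ ⟨$⟩ (w ⟨$⟩ z) ≡ z
  inverseʳ w = MirroredPerm.strictlyInverseʳ w

  ⟨$⟩-injective : ∀ (w : MirroredPerm n) {x y} → w ⟨$⟩ x ≡ w ⟨$⟩ y → x ≡ y
  ⟨$⟩-injective w {x} {y} e = trans (sym (inverseʳ w x)) (trans (cong (w ⁻¹ₘ ⟨$⟩_) e) (inverseʳ w y))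

  ⟨$⟩-0 : ∀ (w : MirroredPerm n) → w ⟨$⟩ 0ℤ ≡ 0ℤ
  ⟨$⟩-0 w = self-neg (w ⟨$⟩ 0ℤ) (MirroredPerm.odd w 0ℤ)
    where
    self-neg : ∀ z → z ≡ ℤ.- z → z ≡ 0ℤ
    self-neg (+ zero) _ = refl

  shiftBy-neg : ∀ (w : MirroredPerm n) q x → w ⟨$⟩ (ℤ.- x ℤ.+ q ℤ.* M) ≡ ℤ.- (w ⟨$⟩ x) ℤ.+ q ℤ.* M
  shiftBy-neg w q x = trans (shiftBy w q (ℤ.- x)) (cong (ℤ._+ q ℤ.* M) (MirroredPerm.odd w x))

  +0*M : ∀ x → x ≡ x ℤ.+ 0ℤ ℤ.* M
  +0*M x = lemma x M
    where
    lemma : ∀ x m → x ≡ x ℤ.+ 0ℤ ℤ.* m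
    lemma = solve-∀

  no-multiple : ∀ r q → 0 ℕ.< r → r ℕ.< N n → + r ≢ q ℤ.* M
  no-multiple r q 0<r r<N e = ℕ.<-irrefl (sym (proj₁ (divMod-unique n {r} {0} {0ℤ} {q} r<N (s≤s z≤n)
    (trans (sym (+0*M (+ r))) (trans e (sym (ℤ.+-identityˡ _))))))) 0<r

  1+n+n : suc (n ℕ.+ n) ≡ N n
  1+n+n = cong (λ m → suc (n ℕ.+ m)) (sym (ℕ.+-identityʳ n))

  suc-n≡M-n : + suc n ≡ M ℤ.- + n
  suc-n≡M-n = N-minus n (suc n) n 1+n+n

  -- Residues modulo N are represented by 0, ±1, ..., ±n: oddness and the shift rule then carry the
  -- values at 1, ..., n to all integers.
  data Column : ℤ → Set where
    origin   : ∀ q → Column (0ℤ ℤ.+ q ℤ.* M)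
    positive : ∀ k q → Column (pos {n} k ℤ.+ q ℤ.* M)
    negative : ∀ k q → Column (ℤ.- pos {n} k ℤ.+ q ℤ.* M)

  columnOf : ∀ z → Column z
  columnOf z with Extend.divModOf n +_ z
  ... | Extend.divMod zero q _ = origin q
  ... | Extend.divMod (suc r) q r<N with suc r ℕ.≤? n
  ...   | yes r<n = subst (λ m → Column (+ suc m ℤ.+ q ℤ.* M)) (toℕ-fromℕ< r<n) (positive (fromℕ< r<n) q)
  ...   | no  r≮n = reflected (N n ℕ.∸ suc r) (ℕ.m<n⇒0<n∸m r<N) (Extend.reflect-low n +_ (suc r) (ℕ.≰⇒> r≮n))
                      (N-minus n (suc r) (N n ℕ.∸ suc r) (ℕ.m+[n∸m]≡n (ℕ.<⇒≤ r<N)))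
    where
    regroup : ∀ a q m → ℤ.- a ℤ.+ (1ℤ ℤ.+ q) ℤ.* m ≡ (m ℤ.- a) ℤ.+ q ℤ.* m
    regroup = solve-∀
    reflected : ∀ m → 1 ℕ.≤ m → m ℕ.≤ n → + suc r ≡ M ℤ.- + m → Column (+ suc r ℤ.+ q ℤ.* M)
    reflected (suc m) _ m<n e = subst Column
      (trans (regroup (pos k) q M) (cong (ℤ._+ q ℤ.* M)
        (trans (cong (λ a → M ℤ.- + suc a) (toℕ-fromℕ< m<n)) (sym e))))
      (negative k (1ℤ ℤ.+ q))
      where k = fromℕ< m<n

  -- Orbits under negation and shift

  infix 4 _∼_
  -- The orbits of the group generated by x ↦ -x and x ↦ x + N. Mirrored permutations commute with
  -- this group, so they permute its orbits, and two of them that agree at a point agree on its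
  -- orbit.
  data _∼_ (x z : ℤ) : Set where
    along  : ∀ q → z ≡ x ℤ.+ q ℤ.* M → x ∼ z
    across : ∀ q → z ≡ ℤ.- x ℤ.+ q ℤ.* M → x ∼ z

  ∼-refl : ∀ {x} → x ∼ x
  ∼-refl {x} = along 0ℤ (+0*M x)

  ∼-sym : ∀ {x z} → x ∼ z → z ∼ x
  ∼-sym {x} (along q refl) = along (ℤ.- q) (lemma x q M)
    where
    lemma : ∀ x q m → x ≡ (x ℤ.+ q ℤ.* m) ℤ.+ (ℤ.- q) ℤ.* m
    lemma = solve-∀
  ∼-sym {x} (across q refl) = across q (lemma x q M)
    where
    lemma : ∀ x q m → x ≡ ℤ.- (ℤ.- x ℤ.+ q ℤ.* m) ℤ.+ q ℤ.* m
    lemma = solve-∀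

  ∼-trans : ∀ {x y z} → x ∼ y → y ∼ z → x ∼ z
  ∼-trans {x} (along p refl) (along q refl) = along (p ℤ.+ q) (lemma x p q M)
    where
    lemma : ∀ x p q m → (x ℤ.+ p ℤ.* m) ℤ.+ q ℤ.* m ≡ x ℤ.+ (p ℤ.+ q) ℤ.* m
    lemma = solve-∀
  ∼-trans {x} (along p refl) (across q refl) = across (q ℤ.- p) (lemma x p q M)
    where
    lemma : ∀ x p q m → ℤ.- (x ℤ.+ p ℤ.* m) ℤ.+ q ℤ.* m ≡ ℤ.- x ℤ.+ (q ℤ.- p) ℤ.* m
    lemma = solve-∀
  ∼-trans {x} (across p refl) (along q refl) = across (p ℤ.+ q) (lemma x p q M)
    where
    lemma : ∀ x p q m → (ℤ.- x ℤ.+ p ℤ.* m) ℤ.+ q ℤ.* m ≡ ℤ.- x ℤ.+ (p ℤ.+ q) ℤ.* m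
    lemma = solve-∀
  ∼-trans {x} (across p refl) (across q refl) = along (q ℤ.- p) (lemma x p q M)
    where
    lemma : ∀ x p q m → ℤ.- (ℤ.- x ℤ.+ p ℤ.* m) ℤ.+ q ℤ.* m ≡ x ℤ.+ (q ℤ.- p) ℤ.* m
    lemma = solve-∀

  ⟨$⟩-∼ : ∀ (w : MirroredPerm n) {x z} → x ∼ z → w ⟨$⟩ x ∼ w ⟨$⟩ z
  ⟨$⟩-∼ w {x} (along q refl)  = along q (shiftBy w q x)
  ⟨$⟩-∼ w {x} (across q refl) = across q (shiftBy-neg w q x)

  ⟨$⟩-∼⁻ : ∀ (w : MirroredPerm n) {x z} → w ⟨$⟩ x ∼ w ⟨$⟩ z → x ∼ z
  ⟨$⟩-∼⁻ w {x} {z} x∼z = subst₂ _∼_ (inverseʳ w x) (inverseʳ w z) (⟨$⟩-∼ (w ⁻¹ₘ) x∼z)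

  ⟨$⟩-agree : ∀ (v w : MirroredPerm n) {x z} → x ∼ z → v ⟨$⟩ x ≡ w ⟨$⟩ x → v ⟨$⟩ z ≡ w ⟨$⟩ z
  ⟨$⟩-agree v w {x} (along q refl) e =
    trans (shiftBy v q x) (trans (cong (ℤ._+ q ℤ.* M) e) (sym (shiftBy w q x)))
  ⟨$⟩-agree v w {x} (across q refl) e =
    trans (shiftBy-neg v q x) (trans (cong (λ y → ℤ.- y ℤ.+ q ℤ.* M) e) (sym (shiftBy-neg w q x)))

  ⟨$⟩-ext : ∀ (v w : MirroredPerm n) → (∀ k → v ⟨$⟩ pos {n} k ≡ w ⟨$⟩ pos {n} k) → v ≈ₘ w
  ⟨$⟩-ext v w e z with columnOf z
  ... | origin q     = ⟨$⟩-agree v w (along q refl) (trans (⟨$⟩-0 v) (sym (⟨$⟩-0 w)))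
  ... | positive k q = ⟨$⟩-agree v w (along q refl) (e k)
  ... | negative k q = ⟨$⟩-agree v w (across q refl) (e k)

  pos<N : ∀ (k : Fin n) → suc (toℕ k) ℕ.< N n
  pos<N k = s≤s (ℕ.≤-trans (toℕ<n k) (ℕ.m≤m+n n _))

  0≁pos : ∀ (k : Fin n) → ¬ 0ℤ ∼ pos k
  0≁pos k (along q e)  = no-multiple _ q (s≤s z≤n) (pos<N k) (trans e (ℤ.+-identityˡ _))
  0≁pos k (across q e) = no-multiple _ q (s≤s z≤n) (pos<N k) (trans e (ℤ.+-identityˡ _))

  -- Opposite signs are impossible because the sum of two columns lies strictly between 0 and N.
  pos∼pos⇒≡ : ∀ (i j : Fin n) → pos i ∼ pos j → i ≡ j
  pos∼pos⇒≡ i j (along q e) = sym (toℕ-injective (ℕ.suc-injective (proj₁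
    (divMod-unique n {p = 0ℤ} {q} (pos<N j) (pos<N i) (trans (sym (+0*M (pos j))) e)))))
  pos∼pos⇒≡ i j (across q e) = contradiction
    (trans (cong (ℤ._+ pos i) e) (lemma (pos i) (q ℤ.* M)))
    (no-multiple (suc (toℕ j) ℕ.+ suc (toℕ i)) q (s≤s z≤n)
      (s≤s (ℕ.≤-trans (ℕ.+-mono-≤ (toℕ<n j) (toℕ<n i)) (ℕ.≤-reflexive (ℕ.suc-injective 1+n+n)))))
    where
    lemma : ∀ x y → (ℤ.- x ℤ.+ y) ℤ.+ x ≡ y
    lemma = solve-∀

-- Reflections in mirrored permutations

-- `swap` is for s₁, ..., sₙ₋₁, `flip` for sₙ and `affine` for s₀. The last name refers to the
-- action on V; on the integers it is `flip` whose mirror x ↦ N - x is not linear.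
data Kind : Set where
  swap flip affine : Kind

module Reflections (n : ℕ) where

  open Mirrored n

  private
    M = + N n

  img : Kind → ℤ → ℤ
  img swap   x = x
  img flip   x = M ℤ.- x
  img affine x = ℤ.- x

  img-involutive : ∀ κ x → img κ (img κ x) ≡ x
  img-involutive swap   x = refl
  img-involutive flip   x = lemma M x
    where
    lemma : ∀ m x → m ℤ.- (m ℤ.- x) ≡ x
    lemma = solve-∀
  img-involutive affine x = ℤ.neg-involutive x

  M-x : ∀ x → M ℤ.- x ≡ ℤ.- x ℤ.+ 1ℤ ℤ.* M
  M-x x = lemma M x
    where
    lemma : ∀ m x → m ℤ.- x ≡ ℤ.- x ℤ.+ 1ℤ ℤ.* m
    lemma = solve-∀

  ⟨$⟩-img : ∀ (w : MirroredPerm n) κ x → w ⟨$⟩ img κ x ≡ img κ (w ⟨$⟩ x)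
  ⟨$⟩-img w swap   x = refl
  ⟨$⟩-img w flip   x = trans (cong (w ⟨$⟩_) (M-x x)) (trans (shiftBy-neg w 1ℤ x) (sym (M-x (w ⟨$⟩ x))))
  ⟨$⟩-img w affine x = MirroredPerm.odd w x

  ∼-img : ∀ κ x → x ∼ img κ x
  ∼-img swap   x = ∼-refl
  ∼-img flip   x = across 1ℤ (M-x x)
  ∼-img affine x = across 0ℤ (+0*M (ℤ.- x))

  -- The case i = j is allowed and describes s₀ᶜ and sₙᶜ, which send one column to its own mirror
  -- image.
  record Reflects (s : MirroredPerm n) (κ : Kind) (i j : Fin n) : Set where
    field
      at-i  : s ⟨$⟩ pos i ≡ img κ (pos j)
      at-j  : s ⟨$⟩ pos j ≡ img κ (pos i)
      fixed : ∀ k → k ≢ i → k ≢ j → s ⟨$⟩ pos k ≡ pos k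

    moved : ∀ z → s ⟨$⟩ z ≡ z ⊎ pos i ∼ z ⊎ pos j ∼ z
    moved z with columnOf z
    ... | origin q = inj₁ (⟨$⟩-agree s idₘ {0ℤ} (along q refl) (⟨$⟩-0 s))
    ... | positive k q with k Fin.≟ i | k Fin.≟ j
    ...   | yes refl | _        = inj₂ (inj₁ (along q refl))
    ...   | no _     | yes refl = inj₂ (inj₂ (along q refl))
    ...   | no k≢i   | no k≢j   = inj₁ (⟨$⟩-agree s idₘ (along q refl) (fixed k k≢i k≢j))
    moved z | negative k q with k Fin.≟ i | k Fin.≟ j
    ...   | yes refl | _        = inj₂ (inj₁ (across q refl))
    ...   | no _     | yes refl = inj₂ (inj₂ (across q refl))
    ...   | no k≢i   | no k≢j   = inj₁ (⟨$⟩-agree s idₘ (across q refl) (fixed k k≢i k≢j))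

    involutive : ∀ z → s ⟨$⟩ (s ⟨$⟩ z) ≡ z
    involutive z with moved z
    ... | inj₁ e          = trans (cong (s ⟨$⟩_) e) e
    ... | inj₂ (inj₁ i∼z) = ⟨$⟩-agree (s ∘ₘ s) idₘ i∼z
          (trans (cong (s ⟨$⟩_) at-i) (trans (⟨$⟩-img s κ (pos j)) (trans (cong (img κ) at-j) (img-involutive κ (pos i)))))
    ... | inj₂ (inj₂ j∼z) = ⟨$⟩-agree (s ∘ₘ s) idₘ j∼z
          (trans (cong (s ⟨$⟩_) at-j) (trans (⟨$⟩-img s κ (pos i)) (trans (cong (img κ) at-i) (img-involutive κ (pos j)))))

  open Reflects

  -- s and u r u⁻¹ are reflections that agree at one point they move.
  intertwine : ∀ {s u r κ i j κ′ i′ j′} → Reflects s κ′ i′ j′ → Reflects r κ i j →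
               u ⟨$⟩ pos i ≢ u ⟨$⟩ img κ (pos j) → s ⟨$⟩ (u ⟨$⟩ pos i) ≡ u ⟨$⟩ img κ (pos j) →
               s ∘ₘ u ≈ₘ u ∘ₘ r
  intertwine {s} {u} {r} {κ} {i} {j} {κ′} {i′} {j′} S R moves swaps z = go (moved R z) (moved S (u ⟨$⟩ z)) (moved S (u ⟨$⟩ pos i))
    where
    Agree : ℤ → Set
    Agree z = s ⟨$⟩ (u ⟨$⟩ z) ≡ u ⟨$⟩ (r ⟨$⟩ z)
    agree : ∀ {x z} → x ∼ z → Agree x → Agree z
    agree = ⟨$⟩-agree (s ∘ₘ u) (u ∘ₘ r)
    agree-i : Agree (pos i)
    agree-i = trans swaps (cong (u ⟨$⟩_) (sym (at-i R)))
    agree-j : Agree (pos j)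
    agree-j = begin
      s ⟨$⟩ (u ⟨$⟩ pos j)                        ≡⟨ cong (λ x → s ⟨$⟩ (u ⟨$⟩ x)) (img-involutive κ (pos j)) ⟨
      s ⟨$⟩ (u ⟨$⟩ img κ (img κ (pos j)))        ≡⟨ ⟨$⟩-img (s ∘ₘ u) κ _ ⟩
      img κ (s ⟨$⟩ (u ⟨$⟩ img κ (pos j)))        ≡⟨ cong (λ x → img κ (s ⟨$⟩ x)) swaps ⟨
      img κ (s ⟨$⟩ (s ⟨$⟩ (u ⟨$⟩ pos i)))        ≡⟨ cong (img κ) (involutive S _) ⟩
      img κ (u ⟨$⟩ pos i)                        ≡⟨ ⟨$⟩-img u κ (pos i) ⟨
      u ⟨$⟩ img κ (pos i)                        ≡⟨ cong (u ⟨$⟩_) (at-j R) ⟨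
      u ⟨$⟩ (r ⟨$⟩ pos j)                        ∎
      where open ≡-Reasoning
    same : u ⟨$⟩ pos i ∼ u ⟨$⟩ z → Agree z
    same i∼z = agree (⟨$⟩-∼⁻ u i∼z) agree-i
    other : s ⟨$⟩ (u ⟨$⟩ pos i) ∼ u ⟨$⟩ z → Agree z
    other e = agree (∼-trans (∼-img κ (pos j)) (⟨$⟩-∼⁻ u (subst (_∼ u ⟨$⟩ z) swaps e))) agree-j
    i′∼sj′ : pos i′ ∼ s ⟨$⟩ pos j′
    i′∼sj′ = subst (pos i′ ∼_) (sym (at-j S)) (∼-img κ′ (pos i′))
    j′∼si′ : pos j′ ∼ s ⟨$⟩ pos i′
    j′∼si′ = subst (pos j′ ∼_) (sym (at-i S)) (∼-img κ′ (pos j′))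
    go : r ⟨$⟩ z ≡ z ⊎ pos i ∼ z ⊎ pos j ∼ z →
         s ⟨$⟩ (u ⟨$⟩ z) ≡ u ⟨$⟩ z ⊎ pos i′ ∼ u ⟨$⟩ z ⊎ pos j′ ∼ u ⟨$⟩ z →
         s ⟨$⟩ (u ⟨$⟩ pos i) ≡ u ⟨$⟩ pos i ⊎ pos i′ ∼ u ⟨$⟩ pos i ⊎ pos j′ ∼ u ⟨$⟩ pos i →
         Agree z
    go (inj₂ (inj₁ i∼z)) _ _ = agree i∼z agree-i
    go (inj₂ (inj₂ j∼z)) _ _ = agree j∼z agree-j
    go (inj₁ rz) (inj₁ sz) _ = trans sz (cong (u ⟨$⟩_) (sym rz))
    go _ _ (inj₁ stays) = contradiction (trans (sym stays) swaps) moves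
    -- Here s moves u(pos i), so both this value and u(z) lie in the two orbits that s exchanges.
    -- They share an orbit, or s carries the one into the other; so z lies in the orbit of pos i or
    -- of pos j.
    go _ (inj₂ (inj₁ z′)) (inj₂ (inj₁ p′)) = same (∼-trans (∼-sym p′) z′)
    go _ (inj₂ (inj₂ z′)) (inj₂ (inj₂ p′)) = same (∼-trans (∼-sym p′) z′)
    go _ (inj₂ (inj₁ z′)) (inj₂ (inj₂ p′)) = other (∼-trans (∼-sym (∼-trans i′∼sj′ (⟨$⟩-∼ s p′))) z′)
    go _ (inj₂ (inj₂ z′)) (inj₂ (inj₁ p′)) = other (∼-trans (∼-sym (∼-trans j′∼si′ (⟨$⟩-∼ s p′))) z′)

  -- On a progression b + q N the condition T ≤ z becomes a bound t ≤ q, and `raise` turns such a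
  -- bound into the same condition on the image progression. Every preserved half-line below is
  -- checked by this pair.
  quotient-≥ : ∀ t b q {T} → b ℤ.+ ℤ.pred t ℤ.* M ℤ.< T → T ℤ.≤ b ℤ.+ q ℤ.* M → t ℤ.≤ q
  quotient-≥ t b q low high = ℤ.≮⇒≥ λ q<t → ℤ.<-irrefl refl (ℤ.≤-<-trans high (ℤ.≤-<-trans
    (ℤ.+-monoʳ-≤ b (ℤ.*-monoʳ-≤-nonNeg M (ℤ.i<j⇒i≤pred[j] q<t))) low))

  raise : ∀ b q {t T} → t ℤ.≤ q → T ℤ.≤ b ℤ.+ t ℤ.* M → T ℤ.≤ b ℤ.+ q ℤ.* M
  raise b q t≤q high = ℤ.≤-trans high (ℤ.+-monoʳ-≤ b (ℤ.*-monoʳ-≤-nonNeg M t≤q))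

  pos≤n : ∀ (k : Fin n) → pos k ℤ.≤ + n
  pos≤n k = ℤ.+≤+ (toℕ<n k)

  suc-n≤M-pos : ∀ (k : Fin n) → + suc n ℤ.≤ M ℤ.- pos k
  suc-n≤M-pos k = subst (ℤ._≤ M ℤ.- pos k) (sym suc-n≡M-n) (ℤ.+-monoʳ-≤ M (ℤ.neg-mono-≤ (pos≤n k)))

  -- For an involution the complement z < T is then stable as well, so nothing is moved across T -
  -- 1/2.
  Preserves : MirroredPerm n → ℤ → Set
  Preserves s T = ∀ z → T ℤ.≤ z → T ℤ.≤ s ⟨$⟩ z

  preserves-< : ∀ {s T} → (∀ z → s ⟨$⟩ (s ⟨$⟩ z) ≡ z) → Preserves s T → ∀ z → z ℤ.< T → s ⟨$⟩ z ℤ.< T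
  preserves-< {s} {T} invol P z z<T = ℤ.≰⇒> λ T≤sz →
    ℤ.<⇒≱ z<T (subst (T ℤ.≤_) (invol z) (P _ T≤sz))

  data Moves (κ : Kind) (i j : Fin n) (z z′ : ℤ) : Set where
    up   : ∀ q → z ≡ pos i ℤ.+ q ℤ.* M → z′ ≡ img κ (pos j) ℤ.+ q ℤ.* M → Moves κ i j z z′
    down : ∀ q → z ≡ ℤ.- pos i ℤ.+ q ℤ.* M → z′ ≡ ℤ.- img κ (pos j) ℤ.+ q ℤ.* M → Moves κ i j z z′

  moves : ∀ {s κ i j} → Reflects s κ i j → ∀ z →
          s ⟨$⟩ z ≡ z ⊎ Moves κ i j z (s ⟨$⟩ z) ⊎ Moves κ j i z (s ⟨$⟩ z)
  moves {s} {κ} S z with moved S z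
  ... | inj₁ e                     = inj₁ e
  ... | inj₂ (inj₁ (along q refl))  = inj₂ (inj₁ (up q refl (trans (shiftBy s q _) (cong (ℤ._+ q ℤ.* M) (at-i S)))))
  ... | inj₂ (inj₁ (across q refl)) = inj₂ (inj₁ (down q refl (trans (shiftBy-neg s q _) (cong (λ x → ℤ.- x ℤ.+ q ℤ.* M) (at-i S)))))
  ... | inj₂ (inj₂ (along q refl))  = inj₂ (inj₂ (up q refl (trans (shiftBy s q _) (cong (ℤ._+ q ℤ.* M) (at-j S)))))
  ... | inj₂ (inj₂ (across q refl)) = inj₂ (inj₂ (down q refl (trans (shiftBy-neg s q _) (cong (λ x → ℤ.- x ℤ.+ q ℤ.* M) (at-j S)))))

  neg-img-flip : ∀ b q → ℤ.- b ℤ.+ q ℤ.* M ≡ (M ℤ.- b) ℤ.+ ℤ.pred q ℤ.* M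
  neg-img-flip b q = lemma b q M
    where
    lemma : ∀ b q m → ℤ.- b ℤ.+ q ℤ.* m ≡ (m ℤ.- b) ℤ.+ (ℤ.- 1ℤ ℤ.+ q) ℤ.* m
    lemma = solve-∀

  -pos≤pos : ∀ (k l : Fin n) → ℤ.- pos k ℤ.≤ pos l
  -pos≤pos k l = ℤ.-≤+

  suc-n≤M+pos : ∀ (k : Fin n) → + suc n ℤ.≤ pos k ℤ.+ 1ℤ ℤ.* M
  suc-n≤M+pos k = ℤ.≤-trans (suc-n≤M-pos k) (subst (ℤ._≤ pos k ℤ.+ 1ℤ ℤ.* M) (sym (M-x (pos k)))
    (ℤ.+-monoˡ-≤ (1ℤ ℤ.* M) (-pos≤pos k k)))

  preserves : ∀ {s κ i j T} → Reflects s κ i j →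
              (∀ {z z′} → Moves κ i j z z′ → T ℤ.≤ z → T ℤ.≤ z′) →
              (∀ {z z′} → Moves κ j i z z′ → T ℤ.≤ z → T ℤ.≤ z′) → Preserves s T
  preserves {T = T} S ij ji z T≤z with moves S z
  ... | inj₁ e        = subst (T ℤ.≤_) (sym e) T≤z
  ... | inj₂ (inj₁ m) = ij m T≤z
  ... | inj₂ (inj₂ m) = ji m T≤z

  -- Both columns lie below T, so a moved point at or above T belongs to a translate with q ≥ 1, and
  -- its image is at least N - n = n + 1.
  preserves-affine : ∀ {s i j} → Reflects s affine i j → ∀ {T} → pos i ℤ.< T → pos j ℤ.< T →
                     T ℤ.≤ + suc n → Preserves s T
  preserves-affine S {T} i<T j<T T≤ = preserves S (half i<T) (half j<T)
    where
    half : ∀ {i j z z′} → pos i ℤ.< T → Moves affine i j z z′ → T ℤ.≤ z → T ℤ.≤ z′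
    half {i} {j} i<T (up q refl refl) T≤z =
      raise (ℤ.- pos j) q (quotient-≥ 1ℤ (pos i) q (subst (ℤ._< T) (+0*M _) i<T) T≤z)
        (ℤ.≤-trans T≤ (subst (+ suc n ℤ.≤_) (M-x (pos j)) (suc-n≤M-pos j)))
    half {i} {j} i<T (down q refl refl) T≤z =
      raise (ℤ.- ℤ.- pos j) q (quotient-≥ 1ℤ (ℤ.- pos i) q (subst (ℤ._< T) (+0*M _) (ℤ.≤-<-trans (-pos≤pos i i) i<T)) T≤z)
        (ℤ.≤-trans T≤ (suc-n≤M+pos j))

  M-pos-M<0 : ∀ (k : Fin n) → pos k ℤ.- M ℤ.< 0ℤ
  M-pos-M<0 k = subst (ℤ._< 0ℤ) (lemma (pos k) M) (ℤ.neg-mono-< {0ℤ} (ℤ.<-≤-trans (ℤ.+<+ (s≤s z≤n)) (suc-n≤M-pos k)))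
    where
    lemma : ∀ x m → ℤ.- (m ℤ.- x) ≡ x ℤ.- m
    lemma = solve-∀

  -- A moved point at or above T is pos i + q N with q ≥ 0 or -pos i + q N with q ≥ 1. Its image is
  -- at least N - pos j, respectively pos j, and both are at least T.
  preserves-flip : ∀ {s i j} → Reflects s flip i j → ∀ {T} → 0ℤ ℤ.≤ T → T ℤ.≤ pos i → T ℤ.≤ pos j →
                   Preserves s T
  preserves-flip S {T} 0≤T T≤i T≤j = preserves S (half T≤j) (half T≤i)
    where
    T≤n+1 : T ℤ.≤ + suc n
    T≤n+1 = ℤ.≤-trans T≤i (ℤ.≤-trans (pos≤n _) (ℤ.+≤+ (ℕ.n≤1+n n)))
    half : ∀ {i j z z′} → T ℤ.≤ pos j → Moves flip i j z z′ → T ℤ.≤ z → T ℤ.≤ z′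
    half {i} {j} T≤j (up q refl refl) T≤z =
      raise (M ℤ.- pos j) q (quotient-≥ 0ℤ (pos i) q (ℤ.<-≤-trans (subst (ℤ._< 0ℤ) (lemma (pos i) M) (M-pos-M<0 i)) 0≤T) T≤z)
        (subst (T ℤ.≤_) (+0*M _) (ℤ.≤-trans T≤n+1 (suc-n≤M-pos j)))
      where
      lemma : ∀ x m → x ℤ.- m ≡ x ℤ.+ ℤ.- 1ℤ ℤ.* m
      lemma = solve-∀
    half {i} {j} T≤j (down q refl refl) T≤z =
      raise (ℤ.- (M ℤ.- pos j)) q (quotient-≥ 1ℤ (ℤ.- pos i) q (subst (ℤ._< T) (+0*M _) (ℤ.<-≤-trans ℤ.-<+ 0≤T)) T≤z)
        (subst (T ℤ.≤_) (lemma (pos j) M) T≤j)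
      where
      lemma : ∀ x m → x ≡ ℤ.- (m ℤ.- x) ℤ.+ 1ℤ ℤ.* m
      lemma = solve-∀

  -- Maps that move every integer by at most one

  Step : ℤ → ℤ → Set
  Step z z′ = z′ ≡ z ⊎ z′ ≡ 1ℤ ℤ.+ z ⊎ z ≡ 1ℤ ℤ.+ z′

  private
    +-shift : ∀ a b c → a ≡ 1ℤ ℤ.+ b → a ℤ.+ c ≡ 1ℤ ℤ.+ (b ℤ.+ c)
    +-shift a b c refl = ℤ.+-assoc 1ℤ b c
    neg-shift : ∀ a b c → a ≡ 1ℤ ℤ.+ b → ℤ.- b ℤ.+ c ≡ 1ℤ ℤ.+ (ℤ.- a ℤ.+ c)
    neg-shift a b c refl = lemma b c
      where
      lemma : ∀ b c → ℤ.- b ℤ.+ c ≡ 1ℤ ℤ.+ (ℤ.- (1ℤ ℤ.+ b) ℤ.+ c)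
      lemma = solve-∀

  moves-step : ∀ {κ i j z z′} → img κ (pos j) ≡ 1ℤ ℤ.+ pos i ⊎ pos i ≡ 1ℤ ℤ.+ img κ (pos j) →
               Moves κ i j z z′ → Step z z′
  moves-step {κ} {i} {j} (inj₁ e) (up q refl refl)   = inj₂ (inj₁ (+-shift (img κ (pos j)) (pos i) (q ℤ.* M) e))
  moves-step {κ} {i} {j} (inj₂ e) (up q refl refl)   = inj₂ (inj₂ (+-shift (pos i) (img κ (pos j)) (q ℤ.* M) e))
  moves-step {κ} {i} {j} (inj₁ e) (down q refl refl) = inj₂ (inj₂ (neg-shift (img κ (pos j)) (pos i) (q ℤ.* M) e))
  moves-step {κ} {i} {j} (inj₂ e) (down q refl refl) = inj₂ (inj₁ (neg-shift (pos i) (img κ (pos j)) (q ℤ.* M) e))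

  step-≤ : ∀ z z′ → Step z z′ → z′ ℤ.≤ 1ℤ ℤ.+ z × z ℤ.≤ 1ℤ ℤ.+ z′
  step-≤ z z′ (inj₁ refl)        = ℤ.i≤suc[i] z , ℤ.i≤suc[i] z
  step-≤ z z′ (inj₂ (inj₁ refl)) = ℤ.≤-refl , ℤ.≤-trans (ℤ.i≤suc[i] z) (ℤ.i≤suc[i] _)
  step-≤ z z′ (inj₂ (inj₂ refl)) = ℤ.≤-trans (ℤ.i≤suc[i] z′) (ℤ.i≤suc[i] _) , ℤ.≤-refl

  -- Only the end point needs checking: a point above T drops by at most one and so does not fall
  -- below T.
  step-preserves : ∀ {s : MirroredPerm n} → (∀ z → Step z (s ⟨$⟩ z)) → ∀ {T} → T ℤ.≤ s ⟨$⟩ T → Preserves s T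
  step-preserves {s} step {T} T≤sT z T≤z with T ℤ.≟ z
  ... | yes refl = T≤sT
  ... | no T≢z   = subst (T ℤ.≤_) (ℤ.pred-suc (s ⟨$⟩ z)) (ℤ.i<j⇒i≤pred[j] (ℤ.<-≤-trans (ℤ.≤∧≢⇒< T≤z T≢z) (proj₂ (step-≤ z (s ⟨$⟩ z) (step z)))))

  -- s x ≤ x + 1 ≤ y ≤ s y + 1 ≤ s x, so equality holds throughout.
  step-reverses : ∀ {s : MirroredPerm n} → (∀ z → Step z (s ⟨$⟩ z)) → ∀ {x y} → x ℤ.< y → s ⟨$⟩ y ℤ.< s ⟨$⟩ x → s ⟨$⟩ x ≡ y
  step-reverses {s} step {x} {y} x<y sy<sx = ℤ.≤-antisym
    (ℤ.≤-trans (proj₁ (step-≤ x (s ⟨$⟩ x) (step x))) (ℤ.i<j⇒suc[i]≤j x<y))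
    (ℤ.≤-trans (proj₂ (step-≤ y (s ⟨$⟩ y) (step y))) (ℤ.i<j⇒suc[i]≤j sy<sx))

  preserves-shift : ∀ {s T} → Preserves s T → ∀ q → Preserves s (T ℤ.+ q ℤ.* M)
  preserves-shift {s} {T} P q z T≤z = subst₂ ℤ._≤_ refl back
    (ℤ.+-monoˡ-≤ (q ℤ.* M) (P (z ℤ.+ (ℤ.- q) ℤ.* M) (subst (ℤ._≤ z ℤ.+ (ℤ.- q) ℤ.* M) (lemma T q M) (ℤ.+-monoˡ-≤ ((ℤ.- q) ℤ.* M) T≤z))))
    where
    lemma : ∀ t q m → (t ℤ.+ q ℤ.* m) ℤ.+ (ℤ.- q) ℤ.* m ≡ t
    lemma = solve-∀
    lemma′ : ∀ t q m → (t ℤ.+ (ℤ.- q) ℤ.* m) ℤ.+ q ℤ.* m ≡ t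
    lemma′ = solve-∀
    back : s ⟨$⟩ (z ℤ.+ (ℤ.- q) ℤ.* M) ℤ.+ q ℤ.* M ≡ s ⟨$⟩ z
    back = trans (cong (ℤ._+ q ℤ.* M) (shiftBy s (ℤ.- q) z)) (lemma′ (s ⟨$⟩ z) q M)

  -- A pair reversed by s has a moved member; the half-lines bounding its block
  -- then trap the other member in the same block.
  module Block (s : MirroredPerm n) (involutive : ∀ z → s ⟨$⟩ (s ⟨$⟩ z) ≡ z)
    (c : ℤ) {m : ℕ} (π : Fin m → Fin m)
    (at : ∀ a → s ⟨$⟩ (c ℤ.+ + toℕ a) ≡ c ℤ.+ + toℕ (π a))
    (low : Preserves s c) (high : Preserves s (c ℤ.+ + m))
    (outside : ∀ z → s ⟨$⟩ z ≡ z ⊎ ∃[ a ] ∃[ q ] z ≡ c ℤ.+ + toℕ {m} a ℤ.+ q ℤ.* M) where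

    In : ℤ → ℤ → Set
    In q z = c ℤ.+ q ℤ.* M ℤ.≤ z × z ℤ.< c ℤ.+ + m ℤ.+ q ℤ.* M

    elem-in : ∀ q a → In q (c ℤ.+ + toℕ {m} a ℤ.+ q ℤ.* M)
    elem-in q a = ℤ.+-monoˡ-≤ (q ℤ.* M) (ℤ.i≤i+j c (+ toℕ a))
                , ℤ.+-monoˡ-< (q ℤ.* M) (ℤ.+-monoʳ-< c (ℤ.+<+ (toℕ<n a)))

    at-shift : ∀ q a → s ⟨$⟩ (c ℤ.+ + toℕ a ℤ.+ q ℤ.* M) ≡ c ℤ.+ + toℕ (π a) ℤ.+ q ℤ.* M
    at-shift q a = trans (shiftBy s q _) (cong (ℤ._+ q ℤ.* M) (at a))

    position : ∀ q z → In q z → ∃[ a ] z ≡ c ℤ.+ + toℕ {m} a ℤ.+ q ℤ.* M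
    position q z (lo , hi) = go (z ℤ.- (c ℤ.+ q ℤ.* M)) (ℤ.i≤j⇒0≤j-i lo)
        (subst (z ℤ.- (c ℤ.+ q ℤ.* M) ℤ.<_) (cancel c (+ m) (q ℤ.* M)) (ℤ.+-monoˡ-< (ℤ.- (c ℤ.+ q ℤ.* M)) hi)) refl
      where
      cancel : ∀ c m y → (c ℤ.+ m ℤ.+ y) ℤ.- (c ℤ.+ y) ≡ m
      cancel = solve-∀
      restore : ∀ c y z → c ℤ.+ (z ℤ.- (c ℤ.+ y)) ℤ.+ y ≡ z
      restore = solve-∀
      go : ∀ d → 0ℤ ℤ.≤ d → d ℤ.< + m → d ≡ z ℤ.- (c ℤ.+ q ℤ.* M) → ∃[ a ] z ≡ c ℤ.+ + toℕ {m} a ℤ.+ q ℤ.* M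
      go (+ r) _ (ℤ.+<+ r<m) e = fromℕ< r<m , (begin
        z                                                     ≡⟨ restore c (q ℤ.* M) z ⟨
        c ℤ.+ (z ℤ.- (c ℤ.+ q ℤ.* M)) ℤ.+ q ℤ.* M             ≡⟨ cong (λ d → c ℤ.+ d ℤ.+ q ℤ.* M) e ⟨
        c ℤ.+ + r ℤ.+ q ℤ.* M                                 ≡⟨ cong (λ r → c ℤ.+ + r ℤ.+ q ℤ.* M) (toℕ-fromℕ< r<m) ⟨
        c ℤ.+ + toℕ (fromℕ< r<m) ℤ.+ q ℤ.* M                  ∎)
        where open ≡-Reasoning

    below : ∀ {T} → Preserves s T → ∀ {z} → s ⟨$⟩ z ℤ.< T → z ℤ.< T
    below P {z} sz<T = ℤ.≰⇒> λ T≤z → ℤ.<⇒≱ sz<T (P z T≤z)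

    above : ∀ {T} → Preserves s T → ∀ {z} → T ℤ.≤ s ⟨$⟩ z → T ℤ.≤ z
    above {T} P {z} T≤sz = subst (T ℤ.≤_) (involutive z) (P (s ⟨$⟩ z) T≤sz)

    reversed : ∀ {x y} → x ℤ.< y → s ⟨$⟩ y ℤ.< s ⟨$⟩ x →
               ∃[ a ] ∃[ b ] ∃[ q ] x ≡ c ℤ.+ + toℕ {m} a ℤ.+ q ℤ.* M × y ≡ c ℤ.+ + toℕ {m} b ℤ.+ q ℤ.* M
                 × toℕ a ℕ.< toℕ b × toℕ (π b) ℕ.< toℕ (π a)
    reversed {x} {y} x<y sy<sx = start (outside x) (outside y)
      where
      unshift : ∀ {q a b} → c ℤ.+ + a ℤ.+ q ℤ.* M ℤ.< c ℤ.+ + b ℤ.+ q ℤ.* M → a ℕ.< b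
      unshift {q} {a} {b} lt = ℤ.drop‿+<+ (subst₂ ℤ._<_ (cancel c (+ a) (q ℤ.* M)) (cancel c (+ b) (q ℤ.* M))
          (ℤ.+-monoˡ-< (ℤ.- (c ℤ.+ q ℤ.* M)) lt))
        where
        cancel : ∀ c m y → (c ℤ.+ m ℤ.+ y) ℤ.- (c ℤ.+ y) ≡ m
        cancel = solve-∀
      both : ∀ q → In q x → In q y → _
      both q x∈ y∈ with position q x x∈ | position q y y∈
      ... | a , ex | b , ey = a , b , q , ex , ey , unshift {q} (subst₂ ℤ._<_ ex ey x<y)
          , unshift {q} (subst₂ ℤ._<_ (trans (cong (s ⟨$⟩_) ey) (at-shift q b)) (trans (cong (s ⟨$⟩_) ex) (at-shift q a)) sy<sx)
      image-in : ∀ q a {z} → z ≡ c ℤ.+ + toℕ {m} a ℤ.+ q ℤ.* M → In q z × In q (s ⟨$⟩ z)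
      image-in q a refl = elem-in q a , subst (In q) (sym (at-shift q a)) (elem-in q (π a))
      start : s ⟨$⟩ x ≡ x ⊎ ∃[ a ] ∃[ q ] x ≡ c ℤ.+ + toℕ {m} a ℤ.+ q ℤ.* M →
              s ⟨$⟩ y ≡ y ⊎ ∃[ a ] ∃[ q ] y ≡ c ℤ.+ + toℕ {m} a ℤ.+ q ℤ.* M → _
      start (inj₁ ex) (inj₁ ey) = contradiction (subst₂ ℤ._<_ ey ex sy<sx) (ℤ.<-asym x<y)
      start (inj₂ (a , q , ex)) _ with image-in q a ex
      -- The lower end of the block bounds y because x < y. The upper end bounds s y because s y < s
      -- x, and hence y, as the half-line from there is preserved.
      ... | x∈ , sx∈ = both q x∈ (ℤ.≤-trans (proj₁ x∈) (ℤ.<⇒≤ x<y)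
                              , below (preserves-shift {s} high q) (ℤ.<-trans sy<sx (proj₂ sx∈)))
      start (inj₁ _) (inj₂ (b , q , ey)) with image-in q b ey
      ... | y∈ , sy∈ = both q (above (preserves-shift {s} low q) (ℤ.≤-trans (proj₁ sy∈) (ℤ.<⇒≤ sy<sx))
                              , ℤ.<-trans x<y (proj₂ y∈)) y∈

  Antitone : (ℤ → ℤ) → Set
  Antitone f = ∀ {x y} → x ℤ.≤ y → f y ℤ.≤ f x

  flip-antitone : Antitone (img flip)
  flip-antitone x≤y = ℤ.+-monoʳ-≤ M (ℤ.neg-mono-≤ x≤y)

  -- Being an involution, s also preserves z < T, and s commutes with the mirror, which carries z <
  -- T to the half-line from 1 + `img κ T`.
  preserves-reflect : ∀ {s} κ → Antitone (img κ) → (∀ z → s ⟨$⟩ (s ⟨$⟩ z) ≡ z) → ∀ {T} →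
                      Preserves s T → Preserves s (1ℤ ℤ.+ img κ T)
  preserves-reflect {s} κ antitone invol {T} P z T≤z = ℤ.≮⇒≥ λ sz<T → ℤ.<⇒≱ (ℤ.suc[i]≤j⇒i<j T≤z)
    (subst₂ ℤ._≤_ (img-involutive κ z) refl (antitone (subst (T ℤ.≤_) (invol (img κ z)) (P _
      (subst₂ ℤ._≤_ (img-involutive κ T) (sym (⟨$⟩-img s κ z))
        (antitone (subst (s ⟨$⟩ z ℤ.≤_) (ℤ.pred-suc (img κ T)) (ℤ.i<j⇒i≤pred[j] sz<T))))))))

-- The generators of the four types

-- The four types arise from independent choices at the two ends: a generator there moves one column
-- (single, superscript C) or two (double, superscript D).
data SingleFirst : Quotient → Set where
  C̃/C : SingleFirst C̃/C
  B̃/D : SingleFirst B̃/D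

data DoubleFirst : Quotient → Set where
  B̃/B : DoubleFirst B̃/B
  D̃/D : DoubleFirst D̃/D

data SingleLast : Quotient → Set where
  C̃/C : SingleLast C̃/C
  B̃/B : SingleLast B̃/B

data DoubleLast : Quotient → Set where
  B̃/D : DoubleLast B̃/D
  D̃/D : DoubleLast D̃/D

first? : ∀ t → SingleFirst t ⊎ DoubleFirst t
first? C̃/C = inj₁ C̃/C
first? B̃/B = inj₂ B̃/B
first? B̃/D = inj₁ B̃/D
first? D̃/D = inj₂ D̃/D

last? : ∀ t → SingleLast t ⊎ DoubleLast t
last? C̃/C = inj₁ C̃/C
last? B̃/B = inj₁ B̃/B
last? B̃/D = inj₂ B̃/D
last? D̃/D = inj₂ D̃/D

single-double : ∀ {t} → SingleLast t → DoubleLast t → ⊥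
single-double C̃/C ()
single-double B̃/B ()

-- s₀ᴰ permutes the positions −2, …, 2 and sₙᴰ the positions n−1, …, n+2.
π₅ : Fin 5 → Fin 5
π₅ zero                         = suc (suc (suc zero))
π₅ (suc zero)                   = suc (suc (suc (suc zero)))
π₅ (suc (suc zero))             = suc (suc zero)
π₅ (suc (suc (suc zero)))       = zero
π₅ (suc (suc (suc (suc zero)))) = suc zero

π₄ : Fin 4 → Fin 4
π₄ zero                   = suc (suc zero)
π₄ (suc zero)             = suc (suc (suc zero))
π₄ (suc (suc zero))       = zero
π₄ (suc (suc (suc zero))) = suc zero

-- Besides the exchanged pairs, the three tables leave as exceptions the centre of an odd block,
-- which is the offset of 0, and pairs of offsets symmetric about the centre, which are mirror
-- images. `RootPair` is designed to exclude these.
reversed₃ : ∀ (a b : Fin 3) → toℕ a ℕ.< toℕ b → toℕ (opposite b) ℕ.< toℕ (opposite a) →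
            opposite a ≡ b ⊎ toℕ a ≡ 1 ⊎ toℕ b ≡ 1
reversed₃ = toWitness {a? = Fin.all? λ a → Fin.all? λ b → (toℕ a ℕ.<? toℕ b) →-dec
  (toℕ (opposite b) ℕ.<? toℕ (opposite a)) →-dec
  ((opposite a Fin.≟ b) ⊎-dec (toℕ a ℕ.≟ 1) ⊎-dec (toℕ b ℕ.≟ 1))} _

reversed₅ : ∀ (a b : Fin 5) → toℕ a ℕ.< toℕ b → toℕ (π₅ b) ℕ.< toℕ (π₅ a) →
            π₅ a ≡ b ⊎ toℕ a ≡ 2 ⊎ toℕ b ≡ 2 ⊎ toℕ a ℕ.+ toℕ b ≡ 4
reversed₅ = toWitness {a? = Fin.all? λ a → Fin.all? λ b → (toℕ a ℕ.<? toℕ b) →-dec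
  (toℕ (π₅ b) ℕ.<? toℕ (π₅ a)) →-dec
  ((π₅ a Fin.≟ b) ⊎-dec (toℕ a ℕ.≟ 2) ⊎-dec (toℕ b ℕ.≟ 2) ⊎-dec (toℕ a ℕ.+ toℕ b ℕ.≟ 4))} _

reversed₄ : ∀ (a b : Fin 4) → toℕ a ℕ.< toℕ b → toℕ (π₄ b) ℕ.< toℕ (π₄ a) →
            π₄ a ≡ b ⊎ toℕ a ℕ.+ toℕ b ≡ 3
reversed₄ = toWitness {a? = Fin.all? λ a → Fin.all? λ b → (toℕ a ℕ.<? toℕ b) →-dec
  (toℕ (π₄ b) ℕ.<? toℕ (π₄ a)) →-dec
  ((π₄ a Fin.≟ b) ⊎-dec (toℕ a ℕ.+ toℕ b ℕ.≟ 3))} _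

module Generators (t : Quotient) (n : ℕ) (rank : minRank t ≤ n) where

  open AffineGroup t n rank public
  open Mirrored n public
  open Reflections n public
  open Reflects

  private
    M = + N n

  2≤n : 2 ≤ n
  2≤n = ℕ.≤-trans (minRank≥2 t) rank

  data View : Fin (suc n) → Kind → Fin n → Fin n → Set where
    first₁ : SingleFirst t → ∀ {i} → toℕ i ≡ 0 → View zero affine i i
    first₂ : DoubleFirst t → ∀ {i j} → toℕ i ≡ 0 → toℕ j ≡ 1 → View zero affine i j
    adj    : ∀ {i j} → toℕ j ≡ suc (toℕ i) → View (suc i) swap i j
    last₁  : SingleLast t → ∀ {i} → suc (toℕ i) ≡ n → View (suc i) flip i i
    last₂  : DoubleLast t → ∀ {i j} → toℕ j ≡ suc (toℕ i) → suc (toℕ j) ≡ n → View (suc j) flip i j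

  view : ∀ g → ∃[ κ ] ∃[ i ] ∃[ j ] View g κ i j
  view zero with first? t
  ... | inj₁ single = affine , _ , _ , first₁ single (toℕ-fromℕ< (ℕ.<⇒≤ 2≤n))
  ... | inj₂ double = affine , _ , _ , first₂ double (toℕ-fromℕ< (ℕ.<⇒≤ 2≤n)) (toℕ-fromℕ< 2≤n)
  view (suc i) with suc (toℕ i) ℕ.≟ n
  ... | no i≢n = swap , _ , _ , adj (toℕ-fromℕ< (ℕ.≤∧≢⇒< (toℕ<n i) i≢n))
  ... | yes i≡n with last? t
  ...   | inj₁ single = flip , _ , _ , last₁ single i≡n
  ...   | inj₂ double = flip , fromℕ< pred<n , _ , last₂ double (trans toℕi≡ (cong suc (sym (toℕ-fromℕ< pred<n)))) i≡n
    where
    toℕi≡ : toℕ i ≡ suc (ℕ.pred (toℕ i))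
    toℕi≡ = sym (ℕ.suc-pred (toℕ i) {{ℕ.>-nonZero (ℕ.≤-pred (ℕ.≤-trans 2≤n (ℕ.≤-reflexive (sym i≡n))))}})
    pred<n : ℕ.pred (toℕ i) ℕ.< n
    pred<n = ℕ.≤-<-trans (ℕ.pred[n]≤n {toℕ i}) (toℕ<n i)

  private
    images : ∀ g k → generator g ⟨$⟩ pos k ≡ generatorImages t n (toℕ g) (suc (toℕ k))
    images g k = Extend.low n (generatorImages t n (toℕ g)) (suc (toℕ k)) (s≤s z≤n) (toℕ<n k)

    ≢-suc : ∀ {k i : Fin n} → k ≢ i → suc (toℕ k) ≢ suc (toℕ i)
    ≢-suc k≢i e = k≢i (toℕ-injective (ℕ.suc-injective e))

    lastImage : ∀ {i : Fin n} → suc (toℕ i) ≡ n → ∀ k →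
                generator (suc i) ⟨$⟩ pos k ≡ lastImages t n (suc (toℕ k))
    lastImage {i} i≡n k = trans (images (suc i) k) (cong (λ (f : ℕ → ℤ) → f (suc (toℕ k))) (if-yes i≡n))

  reflects : ∀ {g κ i j} → View g κ i j → Reflects (generator g) κ i j
  reflects (first₁ single {i} i≡0) = record
    { at-i = at ; at-j = at
    ; fixed = λ k k≢i _ → trans (images zero k) (trans (cong (λ f → f (suc (toℕ k))) (table single)) (if-no (λ e → ≢-suc k≢i (trans e (cong suc (sym i≡0)))))) }
    where
    table : ∀ {t} → SingleFirst t → firstImages t ≡ s₀ᶜ
    table C̃/C = refl
    table B̃/D = refl
    at : generator zero ⟨$⟩ pos i ≡ ℤ.- pos i
    at = trans (images zero i) (trans (cong₂ (λ f m → f (suc m)) (table single) i≡0) (cong (λ m → -[1+ m ]) (sym i≡0)))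
  reflects (first₂ double {i} {j} i≡0 j≡1) = record
    { at-i = trans (images zero i) (trans (cong₂ (λ f m → f (suc m)) (table double) i≡0) (cong (λ m → -[1+ m ]) (sym j≡1)))
    ; at-j = trans (images zero j) (trans (cong₂ (λ f m → f (suc m)) (table double) j≡1) (cong (λ m → -[1+ m ]) (sym i≡0)))
    ; fixed = λ k k≢i k≢j → trans (images zero k) (trans (cong (λ f → f (suc (toℕ k))) (table double))
        (trans (if-no (λ e → ≢-suc k≢i (trans e (cong suc (sym i≡0))))) (if-no (λ e → ≢-suc k≢j (trans e (cong suc (sym j≡1))))))) }
    where
    table : ∀ {t} → DoubleFirst t → firstImages t ≡ s₀ᴰ
    table B̃/B = refl
    table D̃/D = refl
  reflects (adj {i} {j} j≡) = record
    { at-i = trans (image i) (trans (if-yes {i = suc (toℕ i)} refl) (cong (λ m → + suc m) (sym j≡)))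
    ; at-j = trans (image j) (trans (if-no (λ e → ℕ.1+n≢n {suc (toℕ i)} (trans (cong suc (sym j≡)) e)))
        (if-yes (cong suc j≡)))
    ; fixed = λ k k≢i k≢j → trans (image k) (trans (if-no (≢-suc k≢i)) (if-no λ e → ≢-suc k≢j (trans e (cong suc (sym j≡))))) }
    where
    image : ∀ k → generator (suc i) ⟨$⟩ pos k ≡ adjacent (suc (toℕ i)) (suc (toℕ k))
    image k = trans (images (suc i) k) (cong (λ (f : ℕ → ℤ) → f (suc (toℕ k)))
      (if-no λ e → ℕ.<-irrefl (trans j≡ e) (toℕ<n j)))
  reflects (last₁ single {i} i≡n) = record
    { at-i = at ; at-j = at
    ; fixed = λ k k≢i _ → trans (image k) (if-no (λ e → ≢-suc k≢i (trans e (sym i≡n)))) }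
    where
    table : ∀ {t} → SingleLast t → lastImages t ≡ sₙᶜ
    table C̃/C = refl
    table B̃/B = refl
    image : ∀ k → generator (suc i) ⟨$⟩ pos k ≡ sₙᶜ n (suc (toℕ k))
    image k = trans (lastImage i≡n k) (cong (λ f → f n (suc (toℕ k))) (table single))
    at : generator (suc i) ⟨$⟩ pos i ≡ M ℤ.- pos i
    at = trans (image i) (trans (if-yes i≡n) (trans suc-n≡M-n (cong (λ m → M ℤ.- + m) (sym i≡n))))
  reflects (last₂ double {i} {j} j≡ j≡n) = record
    { at-i = trans (image i) (trans (if-yes (trans (cong suc (sym j≡)) j≡n)) (trans suc-n≡M-n (cong (λ m → M ℤ.- + m) (sym j≡n))))
    ; at-j = trans (image j) (trans (if-no (λ e → ℕ.1+n≢n (trans e (sym j≡n)))) (trans (if-yes j≡n)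
        (N-minus n (suc (suc n)) (suc (toℕ i)) (trans (cong (λ m → suc (suc (n ℕ.+ m))) (sym j≡)) (trans (cong suc (sym (ℕ.+-suc n (toℕ j)))) (trans (cong (λ m → suc (n ℕ.+ m)) j≡n) 1+n+n))))))
    ; fixed = λ k k≢i k≢j → trans (image k) (trans (if-no (λ e → ≢-suc k≢i (trans (ℕ.suc-injective (trans e (sym j≡n))) j≡))) (if-no (λ e → ≢-suc k≢j (trans e (sym j≡n))))) }
    where
    table : ∀ {t} → DoubleLast t → lastImages t ≡ sₙᴰ
    table B̃/D = refl
    table D̃/D = refl
    image : ∀ k → generator (suc j) ⟨$⟩ pos k ≡ sₙᴰ n (suc (toℕ k))
    image k = trans (lastImage j≡n k) (cong (λ f → f n (suc (toℕ k))) (table double))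

  generator-involutive : ∀ g z → generator g ⟨$⟩ (generator g ⟨$⟩ z) ≡ z
  generator-involutive g with view g
  ... | _ , _ , _ , v = involutive (reflects v)

  -- Satisfied by the values w(p), w(q) that decide whether multiplying w on the right
  -- by a parabolic generator, which swaps p and q, shortens it.
  record RootPair (x y : ℤ) : Set where
    field
      0≁x  : ¬ 0ℤ ∼ x
      0≁y  : ¬ 0ℤ ∼ y
      root : ¬ x ∼ y ⊎ SingleLast t × y ≡ M ℤ.- x

  -- 0 and the columns 1, ..., n lie in distinct orbits, and u permutes the orbits and fixes 0. Only
  -- a single last generator has i = j, and then the two positions are mirror images at N/2.
  rootPair : ∀ {g κ i j} → View (suc g) κ i j → ∀ u → RootPair (u ⟨$⟩ pos i) (u ⟨$⟩ img κ (pos j))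
  rootPair {κ = κ} {i} {j} v u = record
    { 0≁x  = λ e → 0≁pos i (⟨$⟩-∼⁻ u (subst (_∼ u ⟨$⟩ pos i) (sym (⟨$⟩-0 u)) e))
    ; 0≁y  = λ e → 0≁pos j (∼-trans (⟨$⟩-∼⁻ u (subst (_∼ u ⟨$⟩ img κ (pos j)) (sym (⟨$⟩-0 u)) e)) (∼-sym (∼-img κ (pos j))))
    ; root = root v }
    where
    distinct : ∀ {κ i j} → i ≢ j → ¬ u ⟨$⟩ pos i ∼ u ⟨$⟩ img κ (pos j)
    distinct {κ} {i} {j} i≢j e = i≢j (pos∼pos⇒≡ i j (∼-trans (⟨$⟩-∼⁻ u e) (∼-sym (∼-img κ (pos j)))))
    root : ∀ {κ i j} → View (suc _) κ i j → ¬ u ⟨$⟩ pos i ∼ u ⟨$⟩ img κ (pos j) ⊎ SingleLast t × u ⟨$⟩ img κ (pos j) ≡ M ℤ.- u ⟨$⟩ pos i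
    root (adj j≡)           = inj₁ (distinct {swap} λ { refl → ℕ.1+n≢n (sym j≡) })
    root (last₁ single {i} _) = inj₂ (single , ⟨$⟩-img u flip (pos i))
    root (last₂ _ {i} {j} j≡ _) = inj₁ (distinct {flip} {i} {j} λ { refl → ℕ.1+n≢n (sym j≡) })

  private
    2q≢1 : ∀ q → 0ℤ ℤ.+ (q ℤ.+ q) ℤ.* M ≢ M
    2q≢1 q e = odd q (proj₂ (divMod-unique n {0} {0} {q ℤ.+ q} {1ℤ} (s≤s z≤n) (s≤s z≤n) (trans e (lemma M))))
      where
      lemma : ∀ m → m ≡ 0ℤ ℤ.+ 1ℤ ℤ.* m
      lemma = solve-∀
      odd : ∀ q → q ℤ.+ q ≢ 1ℤ
      odd (+ suc k) e = ℕ.m+1+n≢0 k (ℕ.suc-injective (ℤ.+-injective e))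

    step-by : ∀ {g κ i j} → View g κ i j → img κ (pos j) ≡ 1ℤ ℤ.+ pos i → img κ (pos i) ≡ 1ℤ ℤ.+ pos j ⊎ pos j ≡ 1ℤ ℤ.+ img κ (pos i) →
              ∀ z → Step z (generator g ⟨$⟩ z)
    step-by v e e′ z with moves (reflects v) z
    ... | inj₁ stays     = inj₁ stays
    ... | inj₂ (inj₁ ij) = moves-step (inj₁ e) ij
    ... | inj₂ (inj₂ ji) = moves-step e′ ji

  adj-step : ∀ {i j} → toℕ j ≡ suc (toℕ i) → ∀ z → Step z (generator (suc i) ⟨$⟩ z)
  adj-step j≡ = step-by (adj j≡) (cong (λ m → + suc m) j≡) (inj₂ (cong (λ m → + suc m) j≡))

  last-step : SingleLast t → ∀ {i} → suc (toℕ i) ≡ n → ∀ z → Step z (generator (suc i) ⟨$⟩ z)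
  last-step single {i} i≡n = step-by (last₁ single i≡n) e (inj₁ e)
    where
    e : M ℤ.- pos i ≡ 1ℤ ℤ.+ pos i
    e = trans (cong (λ m → M ℤ.- + m) i≡n) (trans (sym suc-n≡M-n) (cong (λ m → + suc m) (sym i≡n)))

  -- This is what makes a letter that reverses a root pair equal to the reflection in that pair.
  -- Generators that move integers by at most one reverse neighbours only; for the others the
  -- reversed pairs lie in one block and are tabulated.
  reversal : ∀ {g κ i j x y} → View g κ i j → RootPair x y → x ℤ.< y →
             generator g ⟨$⟩ y ℤ.< generator g ⟨$⟩ x → generator g ⟨$⟩ x ≡ y
  reversal (adj {i} j≡) _ x<y sy<sx = step-reverses {generator (suc i)} (adj-step j≡) x<y sy<sx
  reversal (last₁ single {i} i≡n) _ x<y sy<sx = step-reverses {generator (suc i)} (last-step single i≡n) x<y sy<sx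
  reversal {x = x} {y} v@(first₁ single {i} i≡0) pair x<y sy<sx = conclude (reversed x<y sy<sx)
    where
    open RootPair pair
    S = reflects v
    s = generator zero
    pos≡ : pos i ≡ 1ℤ
    pos≡ = cong (λ m → + suc m) i≡0
    s1 : s ⟨$⟩ 1ℤ ≡ -[1+ 0 ]
    s1 = subst (λ z → s ⟨$⟩ z ≡ ℤ.- z) pos≡ (at-i S)
    high : Preserves s (+ 2)
    high = preserves-affine S lt lt (ℤ.+≤+ (ℕ.m≤n⇒m≤1+n 2≤n))
      where lt = subst (ℤ._< + 2) (sym pos≡) (ℤ.+<+ (s≤s (s≤s z≤n)))
    at : ∀ a → s ⟨$⟩ (-[1+ 0 ] ℤ.+ + toℕ a) ≡ -[1+ 0 ] ℤ.+ + toℕ (opposite {3} a)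
    at zero             = trans (MirroredPerm.odd s 1ℤ) (cong ℤ.-_ s1)
    at (suc zero)       = ⟨$⟩-0 s
    at (suc (suc zero)) = s1
    outside : ∀ z → s ⟨$⟩ z ≡ z ⊎ ∃[ a ] ∃[ q ] z ≡ -[1+ 0 ] ℤ.+ + toℕ {3} a ℤ.+ q ℤ.* M
    outside z with moves S z
    ... | inj₁ e                     = inj₁ e
    ... | inj₂ (inj₁ (up q e _))     = inj₂ (suc (suc zero) , q , trans e (cong (ℤ._+ q ℤ.* M) pos≡))
    ... | inj₂ (inj₁ (down q e _))   = inj₂ (zero , q , trans e (cong (λ p → ℤ.- p ℤ.+ q ℤ.* M) pos≡))
    ... | inj₂ (inj₂ (up q e _))     = inj₂ (suc (suc zero) , q , trans e (cong (ℤ._+ q ℤ.* M) pos≡))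
    ... | inj₂ (inj₂ (down q e _))   = inj₂ (zero , q , trans e (cong (λ p → ℤ.- p ℤ.+ q ℤ.* M) pos≡))
    -- The lower end -1 = 1 - 2 comes from the upper half-line, starting at 2, by the mirror at 0.
    open Block s (involutive S) -[1+ 0 ] {3} opposite at (preserves-reflect {s} affine ℤ.neg-mono-≤ (involutive S) high) high outside
    conclude : (∃[ a ] ∃[ b ] ∃[ q ] x ≡ -[1+ 0 ] ℤ.+ + toℕ {3} a ℤ.+ q ℤ.* M × y ≡ -[1+ 0 ] ℤ.+ + toℕ {3} b ℤ.+ q ℤ.* M
                 × toℕ a ℕ.< toℕ b × toℕ (opposite b) ℕ.< toℕ (opposite a)) → s ⟨$⟩ x ≡ y
    conclude (a , b , q , refl , refl , a<b , πb<πa) with reversed₃ a b a<b πb<πa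
    ... | inj₁ refl       = at-shift q a
    ... | inj₂ (inj₁ a≡1) = contradiction (along q (cong (λ m → -[1+ 0 ] ℤ.+ + m ℤ.+ q ℤ.* M) a≡1)) 0≁x
    ... | inj₂ (inj₂ b≡1) = contradiction (along q (cong (λ m → -[1+ 0 ] ℤ.+ + m ℤ.+ q ℤ.* M) b≡1)) 0≁y
  reversal {x = x} {y} v@(first₂ double {i} {j} i≡0 j≡1) pair x<y sy<sx = conclude (reversed x<y sy<sx)
    where
    open RootPair pair
    S = reflects v
    s = generator zero
    c = -[1+ 1 ]
    posi≡ : pos i ≡ 1ℤ
    posi≡ = cong (λ m → + suc m) i≡0
    posj≡ : pos j ≡ + 2
    posj≡ = cong (λ m → + suc m) j≡1
    s1 : s ⟨$⟩ 1ℤ ≡ c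
    s1 = subst₂ (λ p q → s ⟨$⟩ p ≡ ℤ.- q) posi≡ posj≡ (at-i S)
    s2 : s ⟨$⟩ (+ 2) ≡ -[1+ 0 ]
    s2 = subst₂ (λ p q → s ⟨$⟩ p ≡ ℤ.- q) posj≡ posi≡ (at-j S)
    high : Preserves s (+ 3)
    high = preserves-affine S (subst (ℤ._< + 3) (sym posi≡) (ℤ.+<+ (s≤s (s≤s z≤n))))
      (subst (ℤ._< + 3) (sym posj≡) (ℤ.+<+ (s≤s (s≤s (s≤s z≤n))))) (ℤ.+≤+ (s≤s 2≤n))
    at : ∀ a → s ⟨$⟩ (c ℤ.+ + toℕ a) ≡ c ℤ.+ + toℕ (π₅ a)
    at zero                         = trans (MirroredPerm.odd s (+ 2)) (cong ℤ.-_ s2)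
    at (suc zero)                   = trans (MirroredPerm.odd s 1ℤ) (cong ℤ.-_ s1)
    at (suc (suc zero))             = ⟨$⟩-0 s
    at (suc (suc (suc zero)))       = s1
    at (suc (suc (suc (suc zero)))) = s2
    outside : ∀ z → s ⟨$⟩ z ≡ z ⊎ ∃[ a ] ∃[ q ] z ≡ c ℤ.+ + toℕ {5} a ℤ.+ q ℤ.* M
    outside z with moves S z
    ... | inj₁ e                     = inj₁ e
    ... | inj₂ (inj₁ (up q e _))     = inj₂ (suc (suc (suc zero)) , q , trans e (cong (ℤ._+ q ℤ.* M) posi≡))
    ... | inj₂ (inj₁ (down q e _))   = inj₂ (suc zero , q , trans e (cong (λ p → ℤ.- p ℤ.+ q ℤ.* M) posi≡))
    ... | inj₂ (inj₂ (up q e _))     = inj₂ (suc (suc (suc (suc zero))) , q , trans e (cong (ℤ._+ q ℤ.* M) posj≡))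
    ... | inj₂ (inj₂ (down q e _))   = inj₂ (zero , q , trans e (cong (λ p → ℤ.- p ℤ.+ q ℤ.* M) posj≡))
    open Block s (involutive S) c {5} π₅ at (preserves-reflect {s} affine ℤ.neg-mono-≤ (involutive S) high) high outside
    mirror : ∀ a b q → a ℕ.+ b ≡ 4 → c ℤ.+ + b ℤ.+ q ℤ.* M ≡ ℤ.- (c ℤ.+ + a ℤ.+ q ℤ.* M) ℤ.+ (q ℤ.+ q) ℤ.* M
    mirror a b q e = trans (lemma (+ a) (+ b) q M) (trans
      (cong (λ m → ℤ.- (c ℤ.+ + a ℤ.+ q ℤ.* M) ℤ.+ (+ m ℤ.- + 4 ℤ.+ (q ℤ.+ q) ℤ.* M)) e)
      (cong (λ y → ℤ.- (c ℤ.+ + a ℤ.+ q ℤ.* M) ℤ.+ y) (ℤ.+-identityˡ _)))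
      where
      lemma : ∀ a b q m → ℤ.- (+ 2) ℤ.+ b ℤ.+ q ℤ.* m ≡ ℤ.- (ℤ.- (+ 2) ℤ.+ a ℤ.+ q ℤ.* m) ℤ.+ ((a ℤ.+ b) ℤ.- + 4 ℤ.+ (q ℤ.+ q) ℤ.* m)
      lemma = solve-∀
    conclude : (∃[ a ] ∃[ b ] ∃[ q ] x ≡ c ℤ.+ + toℕ {5} a ℤ.+ q ℤ.* M × y ≡ c ℤ.+ + toℕ {5} b ℤ.+ q ℤ.* M
                 × toℕ a ℕ.< toℕ b × toℕ (π₅ b) ℕ.< toℕ (π₅ a)) → s ⟨$⟩ x ≡ y
    conclude (a , b , q , refl , refl , a<b , πb<πa) with reversed₅ a b a<b πb<πa
    ... | inj₁ refl              = at-shift q a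
    ... | inj₂ (inj₁ a≡2)        = contradiction (along q (cong (λ m → c ℤ.+ + m ℤ.+ q ℤ.* M) a≡2)) 0≁x
    ... | inj₂ (inj₂ (inj₁ b≡2)) = contradiction (along q (cong (λ m → c ℤ.+ + m ℤ.+ q ℤ.* M) b≡2)) 0≁y
    ... | inj₂ (inj₂ (inj₂ e)) with root
    ...   | inj₁ x≁y     = contradiction (across (q ℤ.+ q) (mirror (toℕ a) (toℕ b) q e)) x≁y
    -- The block is centred at q N, so x + y = 2q N; but x + y = N, an odd multiple of N.
    ...   | inj₂ (_ , y≡) = contradiction (cancel M (c ℤ.+ + toℕ a ℤ.+ q ℤ.* M) ((q ℤ.+ q) ℤ.* M) (trans (sym y≡) (mirror (toℕ a) (toℕ b) q e))) (2q≢1 q)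
      where
      cancel : ∀ m x z → m ℤ.- x ≡ ℤ.- x ℤ.+ z → 0ℤ ℤ.+ z ≡ m
      cancel m x z e = trans (left x z) (trans (cong (λ y → x ℤ.+ y) (sym e)) (right x m))
        where
        left : ∀ x z → 0ℤ ℤ.+ z ≡ x ℤ.+ (ℤ.- x ℤ.+ z)
        left = solve-∀
        right : ∀ x m → x ℤ.+ (m ℤ.- x) ≡ m
        right = solve-∀
  reversal {x = x} {y} v@(last₂ double {i} {j} j≡ j≡n) pair x<y sy<sx = conclude (reversed x<y sy<sx)
    where
    open RootPair pair
    S = reflects v
    s = generator (suc j)
    c = pos i
    n≡ : 2 ℕ.+ toℕ i ≡ n
    n≡ = trans (cong suc (sym j≡)) j≡n
    j≡c+1 : pos j ≡ c ℤ.+ + 1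
    j≡c+1 = trans (cong (λ m → + suc m) j≡) (ℤ.+-comm 1ℤ c)
    M-j : M ℤ.- pos j ≡ c ℤ.+ + 2
    M-j = trans (cong (λ m → M ℤ.- + m) j≡n) (trans (sym suc-n≡M-n) (trans (cong (λ m → + suc m) (sym n≡)) (ℤ.+-comm (+ 2) c)))
    M-i : M ℤ.- pos i ≡ c ℤ.+ + 3
    M-i = trans (lemma M c) (trans (cong (ℤ._+ 1ℤ) (trans (cong (λ p → M ℤ.- p) (sym j≡c+1)) M-j)) (ℤ.+-assoc c (+ 2) 1ℤ))
      where
      lemma : ∀ m c → m ℤ.- c ≡ (m ℤ.- (c ℤ.+ 1ℤ)) ℤ.+ 1ℤ
      lemma = solve-∀
    low : Preserves s c
    low = preserves-flip S (ℤ.+≤+ z≤n) ℤ.≤-refl (ℤ.+≤+ (s≤s (ℕ.≤-trans (ℕ.n≤1+n _) (ℕ.≤-reflexive (sym j≡)))))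
    -- The block n-1, ..., n+2 is symmetric about N/2, so its upper end c + 4 = 1 + (N - c) is
    -- obtained from the lower end c.
    high : Preserves s (c ℤ.+ + 4)
    high = subst (Preserves s) (trans (cong ℤ.suc M-i) (lemma c)) (preserves-reflect {s} flip flip-antitone (involutive S) low)
      where
      lemma : ∀ c → 1ℤ ℤ.+ (c ℤ.+ + 3) ≡ c ℤ.+ + 4
      lemma = solve-∀
    at : ∀ a → s ⟨$⟩ (c ℤ.+ + toℕ a) ≡ c ℤ.+ + toℕ (π₄ a)
    at zero                   = trans (cong (s ⟨$⟩_) (ℤ.+-identityʳ c)) (trans (at-i S) M-j)
    at (suc zero)             = trans (cong (s ⟨$⟩_) (sym j≡c+1)) (trans (at-j S) M-i)
    at (suc (suc zero))       = trans (cong (s ⟨$⟩_) (trans (sym M-j) (sym (at-i S)))) (trans (involutive S c) (sym (ℤ.+-identityʳ c)))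
    at (suc (suc (suc zero))) = trans (cong (s ⟨$⟩_) (trans (sym M-i) (sym (at-j S)))) (trans (involutive S (pos j)) j≡c+1)
    negative′ : ∀ p d z q → M ℤ.- p ≡ c ℤ.+ d → z ≡ ℤ.- p ℤ.+ q ℤ.* M → z ≡ c ℤ.+ d ℤ.+ ℤ.pred q ℤ.* M
    negative′ p d z q e e′ = trans e′ (trans (neg-img-flip p q) (cong (ℤ._+ ℤ.pred q ℤ.* M) e))
    outside : ∀ z → s ⟨$⟩ z ≡ z ⊎ ∃[ a ] ∃[ q ] z ≡ c ℤ.+ + toℕ {4} a ℤ.+ q ℤ.* M
    outside z with moves S z
    ... | inj₁ e                     = inj₁ e
    ... | inj₂ (inj₁ (up q e _))     = inj₂ (zero , q , trans e (cong (ℤ._+ q ℤ.* M) (sym (ℤ.+-identityʳ c))))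
    ... | inj₂ (inj₁ (down q e _))   = inj₂ (suc (suc (suc zero)) , ℤ.pred q , negative′ (pos i) (+ 3) z q M-i e)
    ... | inj₂ (inj₂ (up q e _))     = inj₂ (suc zero , q , trans e (cong (ℤ._+ q ℤ.* M) j≡c+1))
    ... | inj₂ (inj₂ (down q e _))   = inj₂ (suc (suc zero) , ℤ.pred q , negative′ (pos j) (+ 2) z q M-j e)
    open Block s (involutive S) c {4} π₄ at low high outside
    mirror : ∀ a b q → a ℕ.+ b ≡ 3 → c ℤ.+ + b ℤ.+ q ℤ.* M ≡ ℤ.- (c ℤ.+ + a ℤ.+ q ℤ.* M) ℤ.+ (1ℤ ℤ.+ (q ℤ.+ q)) ℤ.* M
    mirror a b q e = trans (lemma c (+ a) (+ b) q M) (trans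
      (cong (λ m → ℤ.- (c ℤ.+ + a ℤ.+ q ℤ.* M) ℤ.+ ((c ℤ.+ + m) ℤ.- (M ℤ.- c) ℤ.+ (1ℤ ℤ.+ (q ℤ.+ q)) ℤ.* M)) e)
      (cong (λ y → ℤ.- (c ℤ.+ + a ℤ.+ q ℤ.* M) ℤ.+ y) (trans (cong (ℤ._+ (1ℤ ℤ.+ (q ℤ.+ q)) ℤ.* M) (ℤ.i≡j⇒i-j≡0 (sym M-i))) (ℤ.+-identityˡ _))))
      where
      lemma : ∀ c a b q m → c ℤ.+ b ℤ.+ q ℤ.* m ≡ ℤ.- (c ℤ.+ a ℤ.+ q ℤ.* m) ℤ.+ ((c ℤ.+ (a ℤ.+ b)) ℤ.- (m ℤ.- c) ℤ.+ (1ℤ ℤ.+ (q ℤ.+ q)) ℤ.* m)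
      lemma = solve-∀
    conclude : (∃[ a ] ∃[ b ] ∃[ q ] x ≡ c ℤ.+ + toℕ {4} a ℤ.+ q ℤ.* M × y ≡ c ℤ.+ + toℕ {4} b ℤ.+ q ℤ.* M
                 × toℕ a ℕ.< toℕ b × toℕ (π₄ b) ℕ.< toℕ (π₄ a)) → s ⟨$⟩ x ≡ y
    conclude (a , b , q , refl , refl , a<b , πb<πa) with reversed₄ a b a<b πb<πa
    ... | inj₁ refl = at-shift q a
    ... | inj₂ e with root
    ...   | inj₁ x≁y          = contradiction (across (1ℤ ℤ.+ (q ℤ.+ q)) (mirror (toℕ a) (toℕ b) q e)) x≁y
    ...   | inj₂ (single , _) = contradiction double (single-double single)

-- Levels and sorted windows

-- The effect of a kind on levels. The window is closed under x ↦ N - x, which takes (N - c) + l N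
-- to c - l N and -c + l N to c + (1 - l) N. So the mirror at N/2 negates levels, while the mirror
-- at 0 reflects them at 1/2.
φ : Kind → ℤ → ℤ
φ swap   x = x
φ flip   x = ℤ.- x
φ affine x = 1ℤ ℤ.- x

module _ {n : ℕ} {c} {A : Set c} where

  -- When i = j the first test applies f to that one entry, so single and double generators share
  -- the formula. The entries are integers for levels and scalars for points of V.
  pairMap : (A → A) → Fin n → Fin n → (Fin n → A) → Fin n → A
  pairMap f i j a k with k Fin.≟ i | k Fin.≟ j
  ... | yes _ | _     = f (a j)
  ... | no _  | yes _ = f (a i)
  ... | no _  | no _  = a k

  module _ (f : A → A) (i j : Fin n) (a : Fin n → A) where

    pairMap-i : pairMap f i j a i ≡ f (a j)
    pairMap-i with i Fin.≟ i | i Fin.≟ j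
    ... | yes _  | _ = refl
    ... | no i≢i | _ = contradiction refl i≢i

    pairMap-j : pairMap f i j a j ≡ f (a i)
    pairMap-j with j Fin.≟ i | j Fin.≟ j
    ... | yes refl | _      = refl
    ... | no _     | yes _  = refl
    ... | no _     | no j≢j = contradiction refl j≢j

    pairMap-other : ∀ {k} → k ≢ i → k ≢ j → pairMap f i j a k ≡ a k
    pairMap-other {k} k≢i k≢j with k Fin.≟ i | k Fin.≟ j
    ... | yes k≡i | _       = contradiction k≡i k≢i
    ... | no _    | yes k≡j = contradiction k≡j k≢j
    ... | no _    | no _    = refl

module Levels (n : ℕ) where

  open Mirrored n
  open Reflections n

  private
    M = + N n

  InRange : ℤ → Set
  InRange z = 1ℤ ℤ.≤ z × z ℤ.< M

  window⇒range : ∀ {w : MirroredPerm n} {x} → InWindow w x → ∃[ z ] InRange z × x ≡ w ⟨$⟩ z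
  window⇒range (j , e) = + suc (toℕ j) , (ℤ.+≤+ (s≤s z≤n) , ℤ.+<+ (s≤s (toℕ<n j))) , e

  range⇒window : ∀ {w : MirroredPerm n} {x z} → InRange z → x ≡ w ⟨$⟩ z → InWindow w x
  range⇒window {w} {z = + suc r} (_ , ℤ.+<+ (s≤s r<2n)) e =
    fromℕ< r<2n , trans e (cong (λ m → w ⟨$⟩ (+ suc m)) (sym (toℕ-fromℕ< r<2n)))
  range⇒window {z = + zero} (ℤ.+≤+ () , _)

  range-flip : ∀ {z} → InRange z → InRange (M ℤ.- z)
  range-flip {z} (1≤z , z<M) =
    ℤ.i<j⇒suc[i]≤j (subst (ℤ._< M ℤ.- z) (ℤ.+-inverseʳ z) (ℤ.+-monoˡ-< (ℤ.- z) z<M)) ,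
    ℤ.≤-<-trans (ℤ.+-monoʳ-≤ M (ℤ.neg-mono-≤ 1≤z)) (ℤ.suc[i]≤j⇒i<j (ℤ.≤-reflexive (lemma M)))
    where
    lemma : ∀ m → 1ℤ ℤ.+ (m ℤ.- 1ℤ) ≡ m
    lemma = solve-∀

  window-flip : ∀ (w : MirroredPerm n) {x} → InWindow w x → InWindow w (M ℤ.- x)
  window-flip w {x} x∈ with window⇒range {w} {x} x∈
  ... | z , z∈ , refl = range⇒window {w} (range-flip z∈) (sym (⟨$⟩-img w flip z))

  range-unique : ∀ {y z} q → InRange y → InRange z → z ≡ y ℤ.+ q ℤ.* M → q ≡ 0ℤ
  range-unique {+ y} {+ z} q (_ , ℤ.+<+ y<N) (_ , ℤ.+<+ z<N) e =
    sym (proj₂ (divMod-unique n {p = 0ℤ} {q} z<N y<N (trans (sym (+0*M (+ z))) e)))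

  -- Window elements that differ by a multiple of N come from positions that differ by the same
  -- multiple, and 1, ..., 2n are distinct modulo N.
  window-unique : ∀ (w : MirroredPerm n) x {p q} → InWindow w (x ℤ.+ p ℤ.* M) → InWindow w (x ℤ.+ q ℤ.* M) → p ≡ q
  window-unique w x {p} {q} p∈ q∈ with window⇒range {w} {x ℤ.+ p ℤ.* M} p∈ | window⇒range {w} {x ℤ.+ q ℤ.* M} q∈
  ... | y , y∈ , ey | z , z∈ , ez = sym (ℤ.i-j≡0⇒i≡j q p (range-unique (q ℤ.- p) y∈ z∈ (⟨$⟩-injective w (begin
    w ⟨$⟩ z                                       ≡⟨ ez ⟨
    x ℤ.+ q ℤ.* M                                 ≡⟨ lemma x p q M ⟩
    x ℤ.+ p ℤ.* M ℤ.+ (q ℤ.- p) ℤ.* M             ≡⟨ cong (ℤ._+ (q ℤ.- p) ℤ.* M) ey ⟩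
    w ⟨$⟩ y ℤ.+ (q ℤ.- p) ℤ.* M                   ≡⟨ shiftBy w (q ℤ.- p) y ⟨
    w ⟨$⟩ (y ℤ.+ (q ℤ.- p) ℤ.* M)                 ∎))))
    where
    open ≡-Reasoning
    lemma : ∀ x p q m → x ℤ.+ q ℤ.* m ≡ x ℤ.+ p ℤ.* m ℤ.+ (q ℤ.- p) ℤ.* m
    lemma = solve-∀

  level-window : ∀ (w : MirroredPerm n) k → InWindow w (pos k ℤ.+ level w k ℤ.* M)
  level-window w k = subst (InWindow w)
    (trans (ℤ.+-comm (level w k ℤ.* M) (+ suc (toℕ k′))) (cong (λ m → + suc m ℤ.+ level w k ℤ.* M) (Fin.toℕ-inject≤ k _)))
    (lowestBead-inWindow w k′ (level w k) (proj₂ (lowestBead w k′)))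
    where k′ = inject≤ k (ℕ.m≤m+n n _)

  -- The working form of the definition: to compute a level it is enough to exhibit a window element
  -- on that runner.
  level-≡ : ∀ (w : MirroredPerm n) k {m} → InWindow w (pos k ℤ.+ m ℤ.* M) → level w k ≡ m
  level-≡ w k = window-unique w (pos k) (level-window w k)

  window-cong : ∀ {v w : MirroredPerm n} → v ≈ₘ w → ∀ {x} → InWindow v x → InWindow w x
  window-cong v≈w (j , e) = j , trans e (v≈w _)

  level-cong : ∀ {v w : MirroredPerm n} → v ≈ₘ w → ∀ k → level v k ≡ level w k
  level-cong {v} {w} v≈w k = sym (level-≡ w k (window-cong {v} {w} v≈w (level-window v k)))

  level-id : ∀ k → level (idₘ {n}) k ≡ 0ℤ
  level-id k = level-≡ idₘ k (range⇒window {idₘ} (ℤ.+≤+ (s≤s z≤n) , ℤ.+<+ (pos<N k)) (sym (+0*M (pos k))))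

  level-moved : ∀ (s w : MirroredPerm n) κ i j → s ⟨$⟩ pos j ≡ img κ (pos i) → level (s ∘ₘ w) i ≡ φ κ (level w j)
  level-moved s w κ i j e = level-≡ (s ∘ₘ w) i (arrange κ (pushed κ e))
    where
    ℓ = level w j
    pushed : ∀ κ → s ⟨$⟩ pos j ≡ img κ (pos i) → InWindow (s ∘ₘ w) (img κ (pos i) ℤ.+ ℓ ℤ.* M)
    pushed κ e with level-window w j
    ... | l , eq = l , trans (cong (ℤ._+ ℓ ℤ.* M) (sym e)) (trans (sym (shiftBy s ℓ (pos j))) (cong (s ⟨$⟩_) eq))
    arrange : ∀ κ → InWindow (s ∘ₘ w) (img κ (pos i) ℤ.+ ℓ ℤ.* M) → InWindow (s ∘ₘ w) (pos i ℤ.+ φ κ ℓ ℤ.* M)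
    arrange swap   x∈ = x∈
    arrange flip   x∈ = subst (InWindow (s ∘ₘ w)) (lemma (pos i) ℓ M) (window-flip (s ∘ₘ w) x∈)
      where
      lemma : ∀ x l m → m ℤ.- ((m ℤ.- x) ℤ.+ l ℤ.* m) ≡ x ℤ.+ (ℤ.- l) ℤ.* m
      lemma = solve-∀
    arrange affine x∈ = subst (InWindow (s ∘ₘ w)) (lemma (pos i) ℓ M) (window-flip (s ∘ₘ w) x∈)
      where
      lemma : ∀ x l m → m ℤ.- (ℤ.- x ℤ.+ l ℤ.* m) ≡ x ℤ.+ (1ℤ ℤ.- l) ℤ.* m
      lemma = solve-∀

  level-reflects : ∀ {s κ i j} → Reflects s κ i j → ∀ w k → level (s ∘ₘ w) k ≡ pairMap (φ κ) i j (level w) k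
  level-reflects {s} {κ} {i} {j} S w k with k Fin.≟ i | k Fin.≟ j
  ... | yes refl | _        = level-moved s w κ k j (Reflects.at-j S)
  ... | no _     | yes refl = level-moved s w κ k i (Reflects.at-i S)
  ... | no k≢i   | no k≢j   = level-moved s w swap k k (Reflects.fixed S k k≢i k≢j)

  -- Multiplying on the right by x only rearranges the window.
  level-∘ₘ : ∀ w x → (∀ {z} → InRange z → InRange (x ⟨$⟩ z)) → ∀ k → level (w ∘ₘ x) k ≡ level w k
  level-∘ₘ w x x-range k = sym (level-≡ w k (transfer (window⇒range {w ∘ₘ x} (level-window (w ∘ₘ x) k))))
    where
    transfer : ∀ {y} → ∃[ z ] InRange z × y ≡ w ⟨$⟩ (x ⟨$⟩ z) → InWindow w y
    transfer (z , z∈ , e) = range⇒window {w} (x-range z∈) e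

  -- The range is what lies between the half-lines from 1 and from N, and the mirror at N/2 derives
  -- the second from the first.
  preserves⇒range : ∀ {s} → (∀ z → s ⟨$⟩ (s ⟨$⟩ z) ≡ z) → Preserves s 1ℤ → ∀ {z} → InRange z → InRange (s ⟨$⟩ z)
  preserves⇒range {s} invol low {z} (1≤z , z<M) = low z 1≤z , preserves-< {s} invol high z z<M
    where
    high : Preserves s M
    high = subst (Preserves s) (lemma M) (preserves-reflect {s} flip flip-antitone invol low)
      where
      lemma : ∀ m → 1ℤ ℤ.+ (m ℤ.- 1ℤ) ≡ m
      lemma = solve-∀

  SameWindow : MirroredPerm n → MirroredPerm n → Set
  SameWindow v w = ∀ z → InRange z → InRange (w ⁻¹ₘ ⟨$⟩ (v ⟨$⟩ z))

  windows⇒same : ∀ {v w} → (∀ x → InWindow v x → InWindow w x) → SameWindow v w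
  windows⇒same {v} {w} v⊆w z z∈ with window⇒range {w} (v⊆w (v ⟨$⟩ z) (range⇒window {v} z∈ refl))
  ... | y , y∈ , e = subst InRange (trans (sym (inverseʳ w y)) (cong (w ⁻¹ₘ ⟨$⟩_) (sym e))) y∈

  0≁range : ∀ {z} q → InRange z → z ≢ 0ℤ ℤ.+ q ℤ.* M
  0≁range {+ r} q (ℤ.+≤+ 1≤r , ℤ.+<+ r<N) e = no-multiple r q 1≤r r<N (trans e (ℤ.+-identityˡ _))

  -- Closure of the window under x ↦ N - x lets the levels of the columns 1, ..., n determine those
  -- of the other n. Multiples of N never occur in a window, because they are the values at
  -- multiples of N.
  levels⇒window : ∀ v w → (∀ k → level v k ≡ level w k) → ∀ x → InWindow v x → InWindow w x
  levels⇒window v w same x x∈ with columnOf x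
  ... | origin q with window⇒range {v} x∈
  ...   | z , z∈ , e = contradiction (⟨$⟩-injective v (trans (sym e)
            (sym (⟨$⟩-agree v idₘ (along q refl) (⟨$⟩-0 v))))) (0≁range q z∈)
  levels⇒window v w same x x∈ | positive k q =
    subst (λ m → InWindow w (pos k ℤ.+ m ℤ.* M)) (trans (sym (same k)) (level-≡ v k {q} x∈)) (level-window w k)
  levels⇒window v w same x x∈ | negative k q = subst (InWindow w) (lemma (pos k) q M) (window-flip w
    (subst (λ m → InWindow w (pos k ℤ.+ m ℤ.* M)) (trans (sym (same k)) (level-≡ v k {1ℤ ℤ.- q}
      (subst (InWindow v) (lemma′ (pos k) q M) (window-flip v x∈)))) (level-window w k)))
    where
    lemma : ∀ x q m → m ℤ.- (x ℤ.+ (1ℤ ℤ.- q) ℤ.* m) ≡ ℤ.- x ℤ.+ q ℤ.* m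
    lemma = solve-∀
    lemma′ : ∀ x q m → m ℤ.- (ℤ.- x ℤ.+ q ℤ.* m) ≡ x ℤ.+ (1ℤ ℤ.- q) ℤ.* m
    lemma′ = solve-∀

  levels⇒sameWindow : ∀ v w → (∀ k → level v k ≡ level w k) → SameWindow v w
  levels⇒sameWindow v w same = windows⇒same {v} {w} (levels⇒window v w same)

  -- The second condition is w(n) < w(n+1). The mirror at N/2 repeats the first one on n+1, ..., 2n,
  -- so the whole window ascends.
  record Sorted (w : MirroredPerm n) : Set where
    field
      ascending : ∀ (i j : Fin n) → toℕ j ≡ suc (toℕ i) → w ⟨$⟩ pos i ℤ.< w ⟨$⟩ pos j
      middle    : ∀ (i : Fin n) → suc (toℕ i) ≡ n → w ⟨$⟩ pos i ℤ.< M ℤ.- w ⟨$⟩ pos i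

  module _ {w : MirroredPerm n} (sorted : Sorted w) where

    open Sorted sorted

    private
      ascending-ℕ : ∀ k → 1 ≤ k → suc k ≤ n → w ⟨$⟩ (+ k) ℤ.< w ⟨$⟩ (+ suc k)
      ascending-ℕ (suc k) _ k<n = subst₂ (λ a b → w ⟨$⟩ (+ suc a) ℤ.< w ⟨$⟩ (+ suc b)) ea eb
          (ascending (fromℕ< (ℕ.<⇒≤ k<n)) (fromℕ< k<n) (trans eb (cong suc (sym ea))))
        where
        ea : toℕ (fromℕ< (ℕ.<⇒≤ k<n)) ≡ k
        ea = toℕ-fromℕ< (ℕ.<⇒≤ k<n)
        eb : toℕ (fromℕ< k<n) ≡ suc k
        eb = toℕ-fromℕ< k<n

      middle-ℕ : ∀ k → suc k ≡ n → w ⟨$⟩ (+ suc k) ℤ.< w ⟨$⟩ (+ suc (suc k))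
      middle-ℕ k refl = subst₂ (λ a b → w ⟨$⟩ (+ suc a) ℤ.< b) ek
        (trans (sym (⟨$⟩-img w flip (pos i))) (cong (w ⟨$⟩_) (trans (cong (λ m → M ℤ.- (+ suc m)) ek) (sym suc-n≡M-n)))) (middle i (cong suc ek))
        where
        i = fromℕ< {k} {suc k} ℕ.≤-refl
        ek : toℕ i ≡ k
        ek = toℕ-fromℕ< (ℕ.≤-refl {suc k})

    sorted-step : ∀ k → 1 ≤ k → suc k ℕ.< N n → w ⟨$⟩ (+ k) ℤ.< w ⟨$⟩ (+ suc k)
    sorted-step k@(suc k′) 1≤k k<N with ℕ.<-cmp k n
    ... | tri< k<n _ _ = ascending-ℕ k 1≤k k<n
    ... | tri≈ _ k≡n _ = middle-ℕ k′ k≡n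
    -- The positions k and k + 1 are the mirror images of l + 1 and l, where l = N - (k + 1) < n.
    ... | tri> _ _ n<k = subst₂ ℤ._<_ (mirror (suc l) k (trans (cong suc (ℕ.+-comm l k)) (ℕ.m+[n∸m]≡n (ℕ.<⇒≤ k<N))))
                           (mirror l (suc k) (trans (ℕ.+-comm l (suc k)) (ℕ.m+[n∸m]≡n (ℕ.<⇒≤ k<N))))
                           (ℤ.+-monoʳ-< M (ℤ.neg-mono-< (ascending-ℕ l (ℕ.m<n⇒0<n∸m k<N) l<n)))
      where
      l = N n ℕ.∸ suc k
      l<n : l ℕ.< n
      l<n = ℕ.+-cancelˡ-≤ (suc n) _ _ (ℕ.≤-trans (ℕ.≤-reflexive (ℕ.+-suc (suc n) l)) (ℕ.≤-trans (s≤s (ℕ.+-monoˡ-≤ l n<k)) (ℕ.≤-trans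
        (ℕ.≤-reflexive (ℕ.m+[n∸m]≡n (ℕ.<⇒≤ k<N))) (ℕ.≤-reflexive (sym 1+n+n)))))
      mirror : ∀ a b → a ℕ.+ b ≡ N n → M ℤ.- w ⟨$⟩ (+ a) ≡ w ⟨$⟩ (+ b)
      mirror a b e = trans (sym (⟨$⟩-img w flip (+ a))) (cong (w ⟨$⟩_) (sym (N-minus n b a (trans (ℕ.+-comm b a) e))))

    sorted-mono : ∀ a d → 1 ≤ a → a ℕ.+ d ℕ.< N n → w ⟨$⟩ (+ a) ℤ.≤ w ⟨$⟩ (+ (a ℕ.+ d))
    sorted-mono a zero 1≤a _ = ℤ.≤-reflexive (cong (λ m → w ⟨$⟩ (+ m)) (sym (ℕ.+-identityʳ a)))
    sorted-mono a (suc d) 1≤a lt with ℕ.≤-trans (ℕ.≤-reflexive (cong suc (sym (ℕ.+-suc a d)))) lt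
    ... | lt′ = ℤ.≤-trans (sorted-mono a d 1≤a (ℕ.<⇒≤ lt′)) (ℤ.≤-trans
        (ℤ.<⇒≤ (sorted-step (a ℕ.+ d) (ℕ.≤-trans 1≤a (ℕ.m≤m+n a d)) lt′))
        (ℤ.≤-reflexive (cong (λ m → w ⟨$⟩ (+ m)) (sym (ℕ.+-suc a d)))))

    sorted-reflects-< : ∀ {x y} → InRange x → InRange y → w ⟨$⟩ x ℤ.< w ⟨$⟩ y → x ℤ.< y
    sorted-reflects-< {+ a} {+ b} _ (ℤ.+≤+ 1≤b , _) wx<wy with ℕ.<-≤-connex a b
    ... | inj₁ a<b = ℤ.+<+ a<b
    sorted-reflects-< {+ a} {+ b} (_ , ℤ.+<+ a<N) (ℤ.+≤+ 1≤b , _) wx<wy | inj₂ b≤a = contradiction wx<wy (ℤ.≤⇒≯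
      (subst (λ m → w ⟨$⟩ (+ b) ℤ.≤ w ⟨$⟩ (+ m)) (ℕ.m+[n∸m]≡n b≤a)
        (sorted-mono b (a ℕ.∸ b) 1≤b (subst (ℕ._< N n) (sym (ℕ.m+[n∸m]≡n b≤a)) a<N))))

  -- An increasing self-map of {1, …, 2n} is pointwise at least the identity, and
  -- so is its conjugate under the mirror, hence it is the identity.
  sorted-unique : ∀ {v w} → Sorted v → Sorted w → SameWindow v w → v ≈ₘ w
  sorted-unique {v} {w} sv sw same = ⟨$⟩-ext v w λ k →
      trans (sym (inverseˡ w (v ⟨$⟩ pos k))) (cong (w ⟨$⟩_) (ℤ.≤-antisym (above k) (below-π (suc (toℕ k)) (s≤s z≤n) (pos<N k))))
    where
    π = w ⁻¹ₘ ∘ₘ v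
    in-range : ∀ {k} → 1 ≤ k → k ℕ.< N n → InRange (+ k)
    in-range 1≤k k<N = ℤ.+≤+ 1≤k , ℤ.+<+ k<N
    below-π : ∀ k → 1 ≤ k → k ℕ.< N n → + k ℤ.≤ π ⟨$⟩ (+ k)
    below-π 1 1≤k k<N = proj₁ (same 1ℤ (in-range 1≤k k<N))
    below-π (suc k@(suc _)) 1≤k k<N = ℤ.≤-trans (ℤ.+≤+ (s≤s ℕ.≤-refl)) (ℤ.i<j⇒suc[i]≤j
      (ℤ.≤-<-trans (below-π k (s≤s z≤n) (ℕ.<⇒≤ k<N)) (sorted-reflects-< sw
        (same (+ k) (in-range (s≤s z≤n) (ℕ.<⇒≤ k<N))) (same (+ suc k) (in-range 1≤k k<N))
        (subst₂ ℤ._<_ (sym (inverseˡ w _)) (sym (inverseˡ w _)) (sorted-step sv k (s≤s z≤n) k<N)))))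
    above : ∀ k → π ⟨$⟩ pos k ℤ.≤ pos k
    above k = subst₂ ℤ._≤_ (img-involutive flip _) (img-involutive flip _) (flip-antitone (begin
      M ℤ.- pos k                    ≡⟨ N-minus n _ _ (ℕ.m∸n+n≡m (ℕ.<⇒≤ (pos<N k))) ⟨
      + (N n ℕ.∸ suc (toℕ k))        ≤⟨ below-π _ (ℕ.m<n⇒0<n∸m (pos<N k)) (s≤s (ℕ.m∸n≤m _ (toℕ k))) ⟩
      π ⟨$⟩ (+ (N n ℕ.∸ suc (toℕ k))) ≡⟨ cong (π ⟨$⟩_) (N-minus n _ _ (ℕ.m∸n+n≡m (ℕ.<⇒≤ (pos<N k)))) ⟩
      π ⟨$⟩ (M ℤ.- pos k)            ≡⟨ ⟨$⟩-img π flip (pos k) ⟩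
      M ℤ.- π ⟨$⟩ pos k              ∎))
      where open ℤ.≤-Reasoning

-- Parity of crossings

-- For proof-irrelevant P this is the bijection in `EvenlyMany`, spread out so that single elements
-- can be inserted and removed.
record Enumeration (P : ℤ → Set) (k : ℕ) : Set where
  field
    elem      : Fin k → ℤ
    holds     : ∀ i → P (elem i)
    injective : ∀ {i j} → elem i ≡ elem j → i ≡ j
    covers    : ∀ {x} → P x → ∃[ i ] elem i ≡ x

open Enumeration

enumeration-≤ : ∀ {P k l} → Enumeration P k → Enumeration P l → k ≤ l
enumeration-≤ E F = Fin.injective⇒≤ {f = λ i → proj₁ (covers F (holds E i))} λ {i} {j} e → injective E
  (trans (sym (proj₂ (covers F (holds E i)))) (trans (cong (elem F) e) (proj₂ (covers F (holds E j)))))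

enumeration-cong : ∀ {P Q k} → (∀ x → P x → Q x) → (∀ x → Q x → P x) → Enumeration P k → Enumeration Q k
enumeration-cong P⇒Q Q⇒P E = record
  { elem = elem E ; holds = λ i → P⇒Q _ (holds E i) ; injective = injective E ; covers = λ q → covers E (Q⇒P _ q) }

Consecutive : ℕ → ℕ → Set
Consecutive k l = l ≡ suc k ⊎ k ≡ suc l

record Differ (P Q : ℤ → Set) (a : ℤ) : Set where
  field
    elsewhere : ∀ x → x ≢ a → (P x → Q x) × (Q x → P x)
    at        : P a × ¬ Q a ⊎ ¬ P a × Q a

enumeration-toggle : ∀ {P Q a k} → Differ P Q a → Enumeration P k → ∃[ l ] Enumeration Q l × Consecutive k l
enumeration-toggle {P} {Q} {a} {k} D E with Differ.at D
... | inj₂ (¬Pa , Qa) = suc k , record { elem = elem′ ; holds = holds′ ; injective = injective′ ; covers = covers′ } , inj₁ refl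
  where
  elem′ : Fin (suc k) → ℤ
  elem′ zero    = a
  elem′ (suc i) = elem E i
  ≢a : ∀ i → elem E i ≢ a
  ≢a i e = ¬Pa (subst P e (holds E i))
  holds′ : ∀ i → Q (elem′ i)
  holds′ zero    = Qa
  holds′ (suc i) = proj₁ (Differ.elsewhere D _ (≢a i)) (holds E i)
  injective′ : ∀ {i j} → elem′ i ≡ elem′ j → i ≡ j
  injective′ {zero}  {zero}  _ = refl
  injective′ {zero}  {suc j} e = contradiction (sym e) (≢a j)
  injective′ {suc i} {zero}  e = contradiction e (≢a i)
  injective′ {suc i} {suc j} e = cong suc (injective E e)
  covers′ : ∀ {x} → Q x → ∃[ i ] elem′ i ≡ x
  covers′ {x} Qx with x ℤ.≟ a
  ... | yes refl = zero , refl
  ... | no x≢a with covers E (proj₂ (Differ.elsewhere D x x≢a) Qx)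
  ...   | i , e = suc i , e
... | inj₁ (Pa , ¬Qa) = remove k E
  where
  remove : ∀ k → Enumeration P k → ∃[ l ] Enumeration Q l × Consecutive k l
  remove zero    E = contradiction (proj₁ (covers E Pa)) Fin.¬Fin0
  remove (suc k) E = k , record
    { elem      = elem E ∘ punchIn i₀
    ; holds     = λ i → proj₁ (Differ.elsewhere D _ λ e → Fin.punchInᵢ≢i i₀ i (injective E (trans e (sym e₀)))) (holds E _)
    ; injective = λ e → Fin.punchIn-injective i₀ _ _ (injective E e)
    ; covers    = covers′ } , inj₂ refl
    where
    i₀ = proj₁ (covers E Pa)
    e₀ = proj₂ (covers E Pa)
    covers′ : ∀ {x} → Q x → ∃[ i ] elem E (punchIn i₀ i) ≡ x
    covers′ {x} Qx with covers E (proj₂ (Differ.elsewhere D x λ { refl → ¬Qa Qx }) Qx)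
    ... | i , e = punchOut i₀≢i , trans (cong (elem E) (Fin.punchIn-punchOut i₀≢i)) e
      where
      i₀≢i : i₀ ≢ i
      i₀≢i i₀≡i = ¬Qa (subst Q (trans (sym e) (trans (cong (elem E) (sym i₀≡i)) e₀)) Qx)

even-step₂ : ∀ {k l m} → 2 ∣ k → Consecutive k l → Consecutive l m → 2 ∣ m
even-step₂ 2∣k (inj₁ refl) (inj₁ refl) = ∣m∣n⇒∣m+n ∣-refl 2∣k
even-step₂ 2∣k (inj₁ refl) (inj₂ refl) = 2∣k
even-step₂ 2∣k (inj₂ refl) (inj₁ refl) = 2∣k
even-step₂ 2∣k (inj₂ refl) (inj₂ refl) = ∣m+n∣m⇒∣n 2∣k ∣-refl

even-step₁ : ∀ {k l} → 2 ∣ k → 2 ∣ l → ¬ Consecutive k l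
even-step₁ 2∣k 2∣l (inj₁ refl) = contradiction (∣1⇒≡1 (∣m+n∣m⇒∣n (subst (2 ∣_) (ℕ.+-comm 1 _) 2∣l) 2∣k)) λ ()
even-step₁ 2∣k 2∣l (inj₂ refl) = contradiction (∣1⇒≡1 (∣m+n∣m⇒∣n (subst (2 ∣_) (ℕ.+-comm 1 _) 2∣k) 2∣l)) λ ()

EvenCount : (ℤ → Set) → Set
EvenCount P = ∃[ k ] 2 ∣ k × Enumeration P k

evenlyMany⇒count : ∀ {P} → (∀ x → Irrelevant (P x)) → EvenlyMany P → EvenCount P
evenlyMany⇒count {P} irr (k , 2∣k , f) = k , 2∣k , record
  { elem      = proj₁ ∘ to
  ; holds     = proj₂ ∘ to
  ; injective = λ {i} {j} e → trans (sym (strictlyInverseʳ i)) (trans (cong from (Σ-≡ e)) (strictlyInverseʳ j))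
  ; covers    = λ {x} p → from (x , p) , cong proj₁ (strictlyInverseˡ (x , p)) }
  where
  open Inverse f
  Σ-≡ : ∀ {y z : Σ ℤ P} → proj₁ y ≡ proj₁ z → y ≡ z
  Σ-≡ {x , p} {x , q} refl = cong (x ,_) (irr x p q)

count⇒evenlyMany : ∀ {P} → (∀ x → Irrelevant (P x)) → EvenCount P → EvenlyMany P
count⇒evenlyMany {P} irr (k , 2∣k , E) = k , 2∣k , mk↔ₛ′ (λ i → elem E i , holds E i)
  (λ (x , p) → proj₁ (covers E p)) (λ (x , p) → Σ-≡ (proj₂ (covers E p)))
  λ i → injective E (proj₂ (covers E (holds E i)))
  where
  Σ-≡ : ∀ {y z : Σ ℤ P} → proj₁ y ≡ proj₁ z → y ≡ z
  Σ-≡ {x , p} {x , q} refl = cong (x ,_) (irr x p q)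

module Crossings (n : ℕ) where

  open Mirrored n
  open Reflections n

  private
    M = + N n

  -- T = 0 and T = n give the two conditions in `Member`.
  Crosses : ℤ → MirroredPerm n → ℤ → Set
  Crosses T w i = i ℤ.≤ T × ℤ.suc T ℤ.≤ w ⟨$⟩ i

  crosses-irrelevant : ∀ T w i → Irrelevant (Crosses T w i)
  crosses-irrelevant T w i (p , q) (p′ , q′) = cong₂ _,_ (ℤ.≤-irrelevant p p′) (ℤ.≤-irrelevant q q′)

  crosses-id : ∀ T → EvenCount (Crosses T idₘ)
  crosses-id T = 0 , 2 ∣0 , record
    { elem = λ () ; holds = λ () ; injective = λ { {()} }
    ; covers = λ {x} (x≤T , T<x) → contradiction (ℤ.≤-trans T<x x≤T) (ℤ.<⇒≱ (ℤ.suc[i]≤j⇒i<j ℤ.≤-refl)) }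

  crosses-preserves : ∀ {s w T} → (∀ z → s ⟨$⟩ (s ⟨$⟩ z) ≡ z) → Preserves s (ℤ.suc T) →
                      EvenCount (Crosses T w) → EvenCount (Crosses T (s ∘ₘ w))
  crosses-preserves {s} {w} {T} invol P (k , 2∣k , E) = k , 2∣k , enumeration-cong
    (λ x (x≤T , T<wx) → x≤T , P _ T<wx)
    (λ x (x≤T , T<swx) → x≤T , subst (ℤ.suc T ℤ.≤_) (invol _) (P _ T<swx)) E

  crosses-cong : ∀ {v w T} → v ≈ₘ w → EvenCount (Crosses T v) → EvenCount (Crosses T w)
  crosses-cong {T = T} v≈w (k , 2∣k , E) = k , 2∣k , enumeration-cong
    (λ x (x≤T , T<vx) → x≤T , subst (ℤ.suc T ℤ.≤_) (v≈w x) T<vx)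
    (λ x (x≤T , T<wx) → x≤T , subst (ℤ.suc T ℤ.≤_) (sym (v≈w x)) T<wx) E

  Special : Kind → Fin n → Fin n → ℤ → Set
  Special κ i j z = (z ≡ pos i ⊎ z ≡ img κ (pos i)) ⊎ (z ≡ pos j ⊎ z ≡ img κ (pos j))

  -- The special integers are those that s moves across T + 1/2, and img κ is the
  -- mirror at T + 1/2 or, if T = 0, at 0.
  record Toggles (s : MirroredPerm n) (κ : Kind) (i j : Fin n) (T : ℤ) : Set where
    field
      involutive : ∀ z → s ⟨$⟩ (s ⟨$⟩ z) ≡ z
      keeps-> : ∀ z → ¬ Special κ i j z → T ℤ.< z → T ℤ.< s ⟨$⟩ z
      lowers  : ∀ z → Special κ i j z → T ℤ.< z → s ⟨$⟩ z ℤ.≤ T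
      raises  : ∀ z → Special κ i j z → z ℤ.≤ T → T ℤ.< s ⟨$⟩ z
      closed  : ∀ z → Special κ i j z → Special κ i j (s ⟨$⟩ z)
      mirror-low  : ∀ z → ¬ 0ℤ ∼ z → z ℤ.≤ T → T ℤ.< img κ z
      mirror-high : ∀ z → T ℤ.< z → img κ z ℤ.≤ T

    keeps-≤ : ∀ z → ¬ Special κ i j z → z ℤ.≤ T → s ⟨$⟩ z ℤ.≤ T
    keeps-≤ z ¬sp z≤T = ℤ.≮⇒≥ λ T<sz → ℤ.≤⇒≯ z≤T (subst (T ℤ.<_) (involutive z)
      (keeps-> (s ⟨$⟩ z) (λ sp → ¬sp (subst (Special κ i j) (involutive z) (closed _ sp))) T<sz))

  module _ {s κ i j} (S : Reflects s κ i j) where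

    open Reflects S

    special-closed : ∀ z → Special κ i j z → Special κ i j (s ⟨$⟩ z)
    special-closed z (inj₁ (inj₁ refl)) = inj₂ (inj₂ at-i)
    special-closed z (inj₁ (inj₂ refl)) = inj₂ (inj₁ (trans (⟨$⟩-img s κ (pos i)) (trans (cong (img κ) at-i) (img-involutive κ (pos j)))))
    special-closed z (inj₂ (inj₁ refl)) = inj₁ (inj₂ at-j)
    special-closed z (inj₂ (inj₂ refl)) = inj₁ (inj₁ (trans (⟨$⟩-img s κ (pos j)) (trans (cong (img κ) at-j) (img-involutive κ (pos i)))))

  -- The special integers are the moved ones around 0. Every other moved integer lies around some q
  -- N with q ≠ 0, and so does its image, on the same side of 1/2.
  toggles-affine : ∀ {s i j} → Reflects s affine i j → Toggles s affine i j 0ℤ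
  toggles-affine {s} {i} {j} S = record
    { involutive = Reflects.involutive S
    ; keeps->    = λ z ¬sp 0<z → keep z ¬sp 0<z (moves S z)
    ; lowers     = λ { z (inj₁ (inj₁ refl)) _ → subst (ℤ._≤ 0ℤ) (sym (Reflects.at-i S)) ℤ.-≤+
                     ; z (inj₂ (inj₁ refl)) _ → subst (ℤ._≤ 0ℤ) (sym (Reflects.at-j S)) ℤ.-≤+ 
                     ; z (inj₁ (inj₂ refl)) () ; z (inj₂ (inj₂ refl)) () }
    ; raises     = λ { z (inj₁ (inj₁ refl)) (ℤ.+≤+ ()) ; z (inj₂ (inj₁ refl)) (ℤ.+≤+ ())
                     ; z (inj₁ (inj₂ refl)) _ → subst (0ℤ ℤ.<_) (sym (trans (⟨$⟩-img s affine (pos i)) (cong ℤ.-_ (Reflects.at-i S)))) (ℤ.+<+ (s≤s z≤n))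
                     ; z (inj₂ (inj₂ refl)) _ → subst (0ℤ ℤ.<_) (sym (trans (⟨$⟩-img s affine (pos j)) (cong ℤ.-_ (Reflects.at-j S)))) (ℤ.+<+ (s≤s z≤n)) }
    ; closed      = special-closed S
    ; mirror-low  = λ { (+ zero) 0≁0 _ → contradiction ∼-refl 0≁0 ; (+ suc _) _ (ℤ.+≤+ ()) ; -[1+ _ ] _ _ → ℤ.+<+ (s≤s z≤n) }
    ; mirror-high = λ { (+ suc _) _ → ℤ.-≤+ ; (+ zero) (ℤ.+<+ ()) } }
    where
    up-keeps : ∀ i j {z z′} → z ≢ pos i → Moves affine i j z z′ → 1ℤ ℤ.≤ z → 1ℤ ℤ.≤ z′
    up-keeps i j {z} z≢i (up q refl refl) 1≤z = raise (ℤ.- pos j) q 1≤q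
        (ℤ.≤-trans (ℤ.+≤+ (s≤s z≤n)) (subst (+ suc n ℤ.≤_) (M-x (pos j)) (suc-n≤M-pos j)))
      where
      0≤q : 0ℤ ℤ.≤ q
      0≤q = quotient-≥ 0ℤ (pos i) q (ℤ.<-trans (subst (ℤ._< 0ℤ) (lemma (pos i) M) (M-pos-M<0 i)) (ℤ.+<+ (s≤s z≤n))) 1≤z
        where
        lemma : ∀ x m → x ℤ.- m ≡ x ℤ.+ ℤ.- 1ℤ ℤ.* m
        lemma = solve-∀
      1≤q : 1ℤ ℤ.≤ q
      1≤q = ℤ.i<j⇒suc[i]≤j (ℤ.≤∧≢⇒< 0≤q λ { refl → z≢i (sym (+0*M (pos i))) })
    up-keeps i j _ (down q refl refl) 1≤z = raise (ℤ.- ℤ.- pos j) q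
      (quotient-≥ 1ℤ (ℤ.- pos i) q (subst (ℤ._< 1ℤ) (+0*M _) ℤ.-<+) 1≤z)
      (ℤ.≤-trans (ℤ.+≤+ (s≤s z≤n)) (suc-n≤M+pos j))
    keep : ∀ z → ¬ Special affine i j z → 0ℤ ℤ.< z → _ → 0ℤ ℤ.< s ⟨$⟩ z
    keep z ¬sp 0<z (inj₁ e)         = subst (0ℤ ℤ.<_) (sym e) 0<z
    keep z ¬sp 0<z (inj₂ (inj₁ ij)) = ℤ.suc[i]≤j⇒i<j (up-keeps i j (¬sp ∘ inj₁ ∘ inj₁) ij (ℤ.i<j⇒suc[i]≤j 0<z))
    keep z ¬sp 0<z (inj₂ (inj₂ ji)) = ℤ.suc[i]≤j⇒i<j (up-keeps j i (¬sp ∘ inj₂ ∘ inj₁) ji (ℤ.i<j⇒suc[i]≤j 0<z))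

  toggles-flip : ∀ {s i j} → Reflects s flip i j → Toggles s flip i j (+ n)
  toggles-flip {s} {i} {j} S = record
    { involutive = Reflects.involutive S
    ; keeps->    = λ z ¬sp n<z → keep z ¬sp n<z (moves S z)
    ; lowers     = λ { z (inj₁ (inj₁ refl)) n<z → contradiction (pos≤n i) (ℤ.<⇒≱ n<z)
                     ; z (inj₂ (inj₁ refl)) n<z → contradiction (pos≤n j) (ℤ.<⇒≱ n<z)
                     ; z (inj₁ (inj₂ refl)) _ → subst (ℤ._≤ + n) (sym (trans (⟨$⟩-img s flip (pos i)) (trans (cong (img flip) (Reflects.at-i S)) (img-involutive flip (pos j))))) (pos≤n j)
                     ; z (inj₂ (inj₂ refl)) _ → subst (ℤ._≤ + n) (sym (trans (⟨$⟩-img s flip (pos j)) (trans (cong (img flip) (Reflects.at-j S)) (img-involutive flip (pos i))))) (pos≤n i) }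
    ; raises     = λ { z (inj₁ (inj₁ refl)) _ → ℤ.suc[i]≤j⇒i<j (subst (+ suc n ℤ.≤_) (sym (Reflects.at-i S)) (suc-n≤M-pos j))
                     ; z (inj₂ (inj₁ refl)) _ → ℤ.suc[i]≤j⇒i<j (subst (+ suc n ℤ.≤_) (sym (Reflects.at-j S)) (suc-n≤M-pos i))
                     ; z (inj₁ (inj₂ refl)) z≤T → contradiction (suc-n≤M-pos i) (ℤ.<⇒≱ (ℤ.≤-<-trans z≤T (ℤ.+<+ (ℕ.n<1+n n))))
                     ; z (inj₂ (inj₂ refl)) z≤T → contradiction (suc-n≤M-pos j) (ℤ.<⇒≱ (ℤ.≤-<-trans z≤T (ℤ.+<+ (ℕ.n<1+n n)))) }
    ; closed      = special-closed S
    ; mirror-low  = λ z _ z≤T → ℤ.suc[i]≤j⇒i<j (subst (ℤ._≤ M ℤ.- z) (sym suc-n≡M-n) (flip-antitone z≤T))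
    ; mirror-high = λ z n<z → subst (M ℤ.- z ℤ.≤_) (trans (cong (λ m → M ℤ.- m) suc-n≡M-n) (img-involutive flip (+ n))) (flip-antitone (ℤ.i<j⇒suc[i]≤j n<z)) }
    where
    up-keeps : ∀ i j {z z′} → z ≢ img flip (pos i) → Moves flip i j z z′ → + suc n ℤ.≤ z → + suc n ℤ.≤ z′
    up-keeps i j _ (up q refl refl) n<z = raise (M ℤ.- pos j) q
      (quotient-≥ 1ℤ (pos i) q (subst (ℤ._< + suc n) (+0*M _) (ℤ.≤-<-trans (pos≤n i) (ℤ.+<+ (ℕ.n<1+n n)))) n<z)
      (ℤ.≤-trans (suc-n≤M-pos j) (subst (M ℤ.- pos j ℤ.≤_) (cong (λ m → M ℤ.- pos j ℤ.+ m) (sym (ℤ.*-identityˡ M))) (ℤ.i≤i+j _ M)))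
    up-keeps i j z≢i (down q refl refl) n<z = raise (ℤ.- (M ℤ.- pos j)) q 2≤q
        (subst (+ suc n ℤ.≤_) (lemma (pos j) M) (suc-n≤M+pos j))
      where
      lemma : ∀ x m → x ℤ.+ 1ℤ ℤ.* m ≡ ℤ.- (m ℤ.- x) ℤ.+ + 2 ℤ.* m
      lemma = solve-∀
      1≤q : 1ℤ ℤ.≤ q
      1≤q = quotient-≥ 1ℤ (ℤ.- pos i) q (subst (ℤ._< + suc n) (+0*M _) ℤ.-<+) n<z
      -- q = 1 would give N - pos i, which is special.
      2≤q : + 2 ℤ.≤ q
      2≤q = ℤ.i<j⇒suc[i]≤j (ℤ.≤∧≢⇒< 1≤q λ { refl → z≢i (sym (M-x (pos i))) })
    keep : ∀ z → ¬ Special flip i j z → + n ℤ.< z → _ → + n ℤ.< s ⟨$⟩ z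
    keep z ¬sp n<z (inj₁ e)         = subst (+ n ℤ.<_) (sym e) n<z
    keep z ¬sp n<z (inj₂ (inj₁ ij)) = ℤ.suc[i]≤j⇒i<j (up-keeps i j (¬sp ∘ inj₁ ∘ inj₂) ij (ℤ.i<j⇒suc[i]≤j n<z))
    keep z ¬sp n<z (inj₂ (inj₂ ji)) = ℤ.suc[i]≤j⇒i<j (up-keeps j i (¬sp ∘ inj₂ ∘ inj₂) ji (ℤ.i<j⇒suc[i]≤j n<z))

  -- The positions where w takes the values pos k and `img κ (pos k)` are mirror images, so exactly
  -- one of them is at most T. Multiplying by s changes whether w crosses there, for k = i and for k
  -- = j, and nowhere else: two toggles keep the parity.
  crosses-toggles : ∀ {s κ i j T} → Toggles s κ i j T → i ≢ j → ∀ w →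
                    EvenCount (Crosses T w) → EvenCount (Crosses T (s ∘ₘ w))
  crosses-toggles {s} {κ} {i} {j} {T} t i≢j w (k , 2∣k , E) =
    let _ , E′ , k~k′  = enumeration-toggle P-R E
        m , E″ , k′~m = enumeration-toggle R-Q E′
    in m , even-step₂ 2∣k k~k′ k′~m , E″
    where
    open Toggles t
    On : Fin n → ℤ → Set
    On k z = z ≡ pos k ⊎ z ≡ img κ (pos k)
    anchor : ∀ k → ∃[ a ] a ℤ.≤ T × On k (w ⟨$⟩ a) × (∀ x → x ℤ.≤ T → On k (w ⟨$⟩ x) → x ≡ a)
    anchor k = choose (y ℤ.≤? T)
      where
      y = w ⁻¹ₘ ⟨$⟩ pos k
      0≁y : ¬ 0ℤ ∼ y
      0≁y e = 0≁pos k (subst₂ _∼_ (⟨$⟩-0 w) (inverseˡ w (pos k)) (⟨$⟩-∼ w e))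
      is-y : ∀ {x} → w ⟨$⟩ x ≡ pos k → x ≡ y
      is-y e = trans (sym (inverseʳ w _)) (cong (w ⁻¹ₘ ⟨$⟩_) e)
      is-img-y : ∀ {x} → w ⟨$⟩ x ≡ img κ (pos k) → x ≡ img κ y
      is-img-y e = trans (sym (inverseʳ w _)) (trans (cong (w ⁻¹ₘ ⟨$⟩_) e) (⟨$⟩-img (w ⁻¹ₘ) κ (pos k)))
      choose : Dec (y ℤ.≤ T) → ∃[ a ] a ℤ.≤ T × On k (w ⟨$⟩ a) × (∀ x → x ℤ.≤ T → On k (w ⟨$⟩ x) → x ≡ a)
      choose (yes y≤T) = y , y≤T , inj₁ (inverseˡ w (pos k)) , λ
        { x _ (inj₁ e) → is-y e
        ; x x≤T (inj₂ e) → contradiction (subst (ℤ._≤ T) (is-img-y e) x≤T) (ℤ.<⇒≱ (mirror-low y 0≁y y≤T)) }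
      choose (no y≰T) = img κ y , mirror-high y (ℤ.≰⇒> y≰T)
        , inj₂ (trans (⟨$⟩-img w κ y) (cong (img κ) (inverseˡ w (pos k)))) , λ
        { x x≤T (inj₁ e) → contradiction (subst (ℤ._≤ T) (is-y e) x≤T) y≰T
        ; x _ (inj₂ e) → is-img-y e }
    P Q R : ℤ → Set
    P = Crosses T w
    Q = Crosses T (s ∘ₘ w)
    a = proj₁ (anchor i)
    b = proj₁ (anchor j)
    -- Half way from `P` to `Q`: the first toggle happens at a, the second at b.
    R x = (x ≡ a × Q x) ⊎ (x ≢ a × P x)
    on⇒∼ : ∀ {k z} → On k z → pos k ∼ z
    on⇒∼ {k} (inj₁ refl) = ∼-refl
    on⇒∼ {k} (inj₂ refl) = ∼-img κ (pos k)
    b≢a : b ≢ a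
    b≢a b≡a = i≢j (pos∼pos⇒≡ i j (∼-trans (on⇒∼ (proj₁ (proj₂ (proj₂ (anchor i)))))
      (∼-sym (subst (λ x → pos j ∼ w ⟨$⟩ x) b≡a (on⇒∼ (proj₁ (proj₂ (proj₂ (anchor j)))))))))
    point : ∀ x → x ℤ.≤ T → Special κ i j (w ⟨$⟩ x) → P x × ¬ Q x ⊎ ¬ P x × Q x
    point x x≤T sp with (w ⟨$⟩ x) ℤ.≤? T
    ... | yes wx≤T = inj₂ ((λ (_ , T<wx) → ℤ.<⇒≱ (ℤ.suc[i]≤j⇒i<j T<wx) wx≤T) , x≤T , ℤ.i<j⇒suc[i]≤j (raises _ sp wx≤T))
    ... | no wx≰T  = inj₁ ((x≤T , ℤ.i<j⇒suc[i]≤j T<wx) , λ (_ , T<swx) → ℤ.<⇒≱ (ℤ.suc[i]≤j⇒i<j T<swx) (lowers _ sp T<wx))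
      where T<wx = ℤ.≰⇒> wx≰T
    P-R : Differ P R a
    P-R = record
      { elsewhere = λ x x≢a → (λ p → inj₂ (x≢a , p)) , λ { (inj₁ (x≡a , _)) → contradiction x≡a x≢a ; (inj₂ (_ , p)) → p }
      ; at = at (point a (proj₁ (proj₂ (anchor i))) (inj₁ (proj₁ (proj₂ (proj₂ (anchor i)))))) }
      where
      at : P a × ¬ Q a ⊎ ¬ P a × Q a → P a × ¬ R a ⊎ ¬ P a × R a
      at (inj₁ (p , ¬q)) = inj₁ (p , λ { (inj₁ (_ , q)) → ¬q q ; (inj₂ (a≢a , _)) → a≢a refl })
      at (inj₂ (¬p , q)) = inj₂ (¬p , inj₁ (refl , q))
    R-Q : Differ R Q b
    R-Q = record
      { elsewhere = λ x x≢b → R⇒Q x x≢b , Q⇒R x x≢b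
      ; at = at (point b (proj₁ (proj₂ (anchor j))) (inj₂ (proj₁ (proj₂ (proj₂ (anchor j)))))) }
      where
      ordinary : ∀ x → x ≢ a → x ≢ b → x ℤ.≤ T → ¬ Special κ i j (w ⟨$⟩ x)
      ordinary x x≢a x≢b x≤T (inj₁ on) = x≢a (proj₂ (proj₂ (proj₂ (anchor i))) x x≤T on)
      ordinary x x≢a x≢b x≤T (inj₂ on) = x≢b (proj₂ (proj₂ (proj₂ (anchor j))) x x≤T on)
      R⇒Q : ∀ x → x ≢ b → R x → Q x
      R⇒Q x x≢b (inj₁ (_ , q)) = q
      R⇒Q x x≢b (inj₂ (x≢a , x≤T , T<wx)) = x≤T
        , ℤ.i<j⇒suc[i]≤j (keeps-> _ (ordinary x x≢a x≢b x≤T) (ℤ.suc[i]≤j⇒i<j T<wx))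
      Q⇒R : ∀ x → x ≢ b → Q x → R x
      Q⇒R x x≢b q@(x≤T , T<swx) with x ℤ.≟ a
      ... | yes x≡a = inj₁ (x≡a , q)
      ... | no x≢a  = inj₂ (x≢a , x≤T , ℤ.i<j⇒suc[i]≤j (ℤ.≰⇒> λ wx≤T →
          ℤ.<⇒≱ (ℤ.suc[i]≤j⇒i<j T<swx) (keeps-≤ _ (ordinary x x≢a x≢b x≤T) wx≤T)))
      at : P b × ¬ Q b ⊎ ¬ P b × Q b → R b × ¬ Q b ⊎ ¬ R b × Q b
      at (inj₁ (p , ¬q)) = inj₁ (inj₂ (b≢a , p) , ¬q)
      at (inj₂ (¬p , q)) = inj₂ ((λ { (inj₁ (b≡a , _)) → b≢a b≡a ; (inj₂ (_ , p)) → ¬p p }) , q)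

  -- Transported along f, the crossings of w f are the x with f x ≤ T < w x. They differ from those
  -- of w only at a special x with w x > T. The special positions are pos j and its mirror image,
  -- and exactly one of them has such a value, so the count changes by one.
  crosses-odd : ∀ {f κ j T} → Toggles f κ j j T → ∀ w → EvenCount (Crosses T w) → ¬ EvenCount (Crosses T (w ∘ₘ f))
  crosses-odd {f} {κ} {j} {T} t w (k , 2∣k , E) (l , 2∣l , F) =
    let m , E′ , k~m = enumeration-toggle differ E
    in even-step₁ 2∣k (subst (2 ∣_) (ℕ.≤-antisym (enumeration-≤ F′ E′) (enumeration-≤ E′ F′)) 2∣l) k~m
    where
    open Toggles t
    P Q : ℤ → Set
    P = Crosses T w
    Q x = f ⟨$⟩ x ℤ.≤ T × ℤ.suc T ℤ.≤ w ⟨$⟩ x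
    F′ : Enumeration Q l
    F′ = record
      { elem      = λ i → f ⟨$⟩ elem F i
      ; holds     = λ i → subst (ℤ._≤ T) (sym (involutive _)) (proj₁ (holds F i)) , proj₂ (holds F i)
      ; injective = λ e → injective F (⟨$⟩-injective f e)
      ; covers    = λ {x} (fx≤T , T<wx) →
          let i , e = covers F {f ⟨$⟩ x} (fx≤T , subst (λ z → ℤ.suc T ℤ.≤ w ⟨$⟩ z) (sym (involutive x)) T<wx)
          in i , trans (cong (f ⟨$⟩_) e) (involutive x) }
    z = w ⟨$⟩ pos j
    0≁z : ¬ 0ℤ ∼ z
    0≁z e = 0≁pos j (⟨$⟩-∼⁻ w (subst (_∼ z) (sym (⟨$⟩-0 w)) e))
    w-img : w ⟨$⟩ img κ (pos j) ≡ img κ z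
    w-img = ⟨$⟩-img w κ (pos j)
    anchor : ∃[ a ] T ℤ.< w ⟨$⟩ a × Special κ j j a × (∀ x → x ≢ a → Special κ j j x → ¬ T ℤ.< w ⟨$⟩ x)
    anchor with z ℤ.≤? T
    ... | no z≰T = pos j , ℤ.≰⇒> z≰T , inj₁ (inj₁ refl) , λ
      { x x≢ (inj₁ (inj₁ e)) _ → x≢ e ; x x≢ (inj₂ (inj₁ e)) _ → x≢ e
      ; x _ (inj₁ (inj₂ refl)) T<wx → ℤ.<⇒≱ T<wx (subst (ℤ._≤ T) (sym w-img) (mirror-high z (ℤ.≰⇒> z≰T)))
      ; x _ (inj₂ (inj₂ refl)) T<wx → ℤ.<⇒≱ T<wx (subst (ℤ._≤ T) (sym w-img) (mirror-high z (ℤ.≰⇒> z≰T))) }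
    ... | yes z≤T = img κ (pos j) , subst (T ℤ.<_) (sym w-img) (mirror-low z 0≁z z≤T) , inj₁ (inj₂ refl) , λ
      { x x≢ (inj₁ (inj₂ e)) _ → x≢ e ; x x≢ (inj₂ (inj₂ e)) _ → x≢ e
      ; x _ (inj₁ (inj₁ refl)) T<wx → ℤ.<⇒≱ T<wx z≤T
      ; x _ (inj₂ (inj₁ refl)) T<wx → ℤ.<⇒≱ T<wx z≤T }
    a = proj₁ anchor
    T<wa = ℤ.i<j⇒suc[i]≤j (proj₁ (proj₂ anchor))
    differ : Differ P Q a
    differ = record { elsewhere = λ x x≢a → P⇒Q x x≢a , Q⇒P x x≢a ; at = at (a ℤ.≤? T) }
      where
      ordinary : ∀ x → x ≢ a → ℤ.suc T ℤ.≤ w ⟨$⟩ x → ¬ Special κ j j x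
      ordinary x x≢a T<wx sp = proj₂ (proj₂ (proj₂ anchor)) x x≢a sp (ℤ.suc[i]≤j⇒i<j T<wx)
      P⇒Q : ∀ x → x ≢ a → P x → Q x
      P⇒Q x x≢a (x≤T , T<wx) = keeps-≤ x (ordinary x x≢a T<wx) x≤T , T<wx
      Q⇒P : ∀ x → x ≢ a → Q x → P x
      Q⇒P x x≢a (fx≤T , T<wx) = ℤ.≮⇒≥ (λ T<x → ℤ.<⇒≱ (keeps-> x (ordinary x x≢a T<wx) T<x) fx≤T) , T<wx
      at : Dec (a ℤ.≤ T) → P a × ¬ Q a ⊎ ¬ P a × Q a
      at (yes a≤T) = inj₁ ((a≤T , T<wa) , λ (fa≤T , _) → ℤ.<⇒≱ (raises a (proj₁ (proj₂ (proj₂ anchor))) a≤T) fa≤T)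
      at (no a≰T)  = inj₂ ((λ (a≤T , _) → a≰T a≤T) , lowers a (proj₁ (proj₂ (proj₂ anchor))) (ℤ.≰⇒> a≰T) , T<wa)

-- Exchange and uniqueness of minimal representatives

module Membership {n : ℕ} {w : MirroredPerm n} where

  open Crossings n

  member-intro : ∀ t → (DoubleFirst t → EvenCount (Crosses 0ℤ w)) → (DoubleLast t → EvenCount (Crosses (+ n) w)) →
                 Member t w
  member-intro C̃/C _ _ = tt
  member-intro B̃/B z _ = count⇒evenlyMany (crosses-irrelevant 0ℤ w) (z B̃/B)
  member-intro B̃/D _ m = count⇒evenlyMany (crosses-irrelevant (+ n) w) (m B̃/D)
  member-intro D̃/D z m = count⇒evenlyMany (crosses-irrelevant 0ℤ w) (z D̃/D)
                       , count⇒evenlyMany (crosses-irrelevant (+ n) w) (m D̃/D)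

  member-middle : ∀ {t} → DoubleLast t → Member t w → EvenCount (Crosses (+ n) w)
  member-middle B̃/D m       = evenlyMany⇒count (crosses-irrelevant (+ n) w) m
  member-middle D̃/D (_ , m) = evenlyMany⇒count (crosses-irrelevant (+ n) w) m

module Representatives (t : Quotient) (n : ℕ) (rank : minRank t ≤ n) where

  open Generators t n rank public
  open Levels n public
  open Crossings n
  open Reflects

  private
    M = + N n

  preserves-swap : ∀ {s i j} → Reflects s swap i j → Preserves s (+ suc n)
  preserves-swap S = preserves S half half
    where
    half : ∀ {i j z z′} → Moves swap i j z z′ → + suc n ℤ.≤ z → + suc n ℤ.≤ z′
    half {i} {j} (up q refl refl) n<z = raise (pos j) q
      (quotient-≥ 1ℤ (pos i) q (subst (ℤ._< + suc n) (+0*M _) (ℤ.+<+ (s≤s (toℕ<n i)))) n<z) (suc-n≤M+pos j)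
    half {i} {j} (down q refl refl) n<z = raise (ℤ.- pos j) q
      (quotient-≥ 1ℤ (ℤ.- pos i) q (subst (ℤ._< + suc n) (+0*M _) ℤ.-<+) n<z)
      (subst (+ suc n ℤ.≤_) (M-x (pos j)) (suc-n≤M-pos j))

  -- 1 could leave the positive integers only by going to 0, but 0 is fixed.
  step-preserves-1 : ∀ {s} → (∀ z → Step z (s ⟨$⟩ z)) → (∀ z → s ⟨$⟩ (s ⟨$⟩ z) ≡ z) → Preserves s 1ℤ
  step-preserves-1 {s} step invol = step-preserves {s} step (from-step (step 1ℤ) refl)
    where
    from-step : ∀ {y} → Step 1ℤ y → y ≡ s ⟨$⟩ 1ℤ → 1ℤ ℤ.≤ y
    from-step (inj₁ refl)        _ = ℤ.≤-refl
    from-step (inj₂ (inj₁ refl)) _ = ℤ.+≤+ (s≤s z≤n)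
    from-step {+ zero} (inj₂ (inj₂ _)) e = contradiction (trans (sym (⟨$⟩-0 s)) (trans (cong (s ⟨$⟩_) e) (invol 1ℤ))) λ ()
    from-step {+ suc _} (inj₂ (inj₂ _)) _ = ℤ.+≤+ (s≤s z≤n)
    from-step { -[1+ zero ]} (inj₂ (inj₂ ()))
    from-step { -[1+ suc _ ]} (inj₂ (inj₂ ()))

  1≤pos : ∀ (k : Fin n) → 1ℤ ℤ.≤ pos k
  1≤pos k = ℤ.+≤+ (s≤s z≤n)

  -- s₁, ..., sₙ preserve the positive integers, and s₀ᴰ makes two toggles. In `crosses-middle` the
  -- two ends exchange roles.
  crosses-zero : ∀ {g κ i j} → View g κ i j → DoubleFirst t → ∀ w →
                 EvenCount (Crosses 0ℤ w) → EvenCount (Crosses 0ℤ (generator g ∘ₘ w))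
  crosses-zero (first₁ C̃/C _) ()
  crosses-zero (first₁ B̃/D _) ()
  crosses-zero v@(first₂ _ i≡0 j≡1) _ w = crosses-toggles (toggles-affine (reflects v))
    (λ { refl → contradiction (trans (sym i≡0) j≡1) λ () }) w
  crosses-zero {g} v@(adj j≡) _ w = crosses-preserves {generator g} {w} (involutive (reflects v))
    (step-preserves-1 {generator g} (adj-step j≡) (involutive (reflects v)))
  crosses-zero {g} v@(last₁ single i≡n) _ w = crosses-preserves {generator g} {w} (involutive (reflects v))
    (step-preserves-1 {generator g} (last-step single i≡n) (involutive (reflects v)))
  crosses-zero {g} {i = i} {j} v@(last₂ _ _ _) _ w = crosses-preserves {generator g} {w} (involutive (reflects v))
    (preserves-flip (reflects v) (ℤ.+≤+ z≤n) (1≤pos i) (1≤pos j))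

  crosses-middle : ∀ {g κ i j} → View g κ i j → DoubleLast t → ∀ w →
                   EvenCount (Crosses (+ n) w) → EvenCount (Crosses (+ n) (generator g ∘ₘ w))
  crosses-middle {g} {i = i} {j} v@(first₁ _ _) _ w = crosses-preserves {generator g} {w} (involutive (reflects v))
    (preserves-affine (reflects v) (ℤ.+<+ (s≤s (toℕ<n i))) (ℤ.+<+ (s≤s (toℕ<n j))) ℤ.≤-refl)
  crosses-middle {g} {i = i} {j} v@(first₂ _ _ _) _ w = crosses-preserves {generator g} {w} (involutive (reflects v))
    (preserves-affine (reflects v) (ℤ.+<+ (s≤s (toℕ<n i))) (ℤ.+<+ (s≤s (toℕ<n j))) ℤ.≤-refl)
  crosses-middle {g} v@(adj _) _ w = crosses-preserves {generator g} {w} (involutive (reflects v)) (preserves-swap (reflects v))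
  crosses-middle (last₁ single _) double = contradiction double (single-double single)
  crosses-middle v@(last₂ _ j≡ _) _ w = crosses-toggles (toggles-flip (reflects v))
    (λ { refl → ℕ.1+n≢n (sym j≡) }) w

  product-member : ∀ is → Member t (product is)
  product-member is = Membership.member-intro t (zeros is) (middles is)
    where
    zeros : ∀ is → DoubleFirst t → EvenCount (Crosses 0ℤ (product is))
    zeros []       _ = crosses-id 0ℤ
    zeros (g ∷ is) d = crosses-zero (proj₂ (proj₂ (proj₂ (view g)))) d (product is) (zeros is d)
    middles : ∀ is → DoubleLast t → EvenCount (Crosses (+ n) (product is))
    middles []       _ = crosses-id (+ n)
    middles (g ∷ is) d = crosses-middle (proj₂ (proj₂ (proj₂ (view g)))) d (product is) (middles is d)

  root-< : ∀ {g κ i j} → View (suc g) κ i j → pos i ℤ.< img κ (pos j)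
  root-< (adj j≡)             = ℤ.+<+ (ℕ.≤-reflexive (cong suc (sym j≡)))
  root-< (last₁ _ {i} _)      = ℤ.<-≤-trans (ℤ.+<+ (s≤s (toℕ<n i))) (suc-n≤M-pos i)
  root-< (last₂ _ {i} {j} _ _) = ℤ.<-≤-trans (ℤ.+<+ (s≤s (toℕ<n i))) (suc-n≤M-pos j)

  exchange : ∀ {g κ i j} → View (suc g) κ i j → ∀ is → product is ⟨$⟩ img κ (pos j) ℤ.< product is ⟨$⟩ pos i →
             ∃[ js ] suc (length js) ≡ length is × product js ≈ₘ product is ∘ₘ generator (suc g)
  exchange v [] descent = contradiction (root-< v) (ℤ.<-asym descent)
  exchange {g} {κ} {i} {j} v (h ∷ is) descent
    with ℤ.<-cmp (product is ⟨$⟩ pos i) (product is ⟨$⟩ img κ (pos j)) | view h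
  ... | tri> _ _ descent′ | _ with exchange v is descent′
  ...   | js , len , js≈ = h ∷ js , cong suc len , λ z → cong (generator h ⟨$⟩_) (js≈ z)
  exchange {g} {κ} {i} {j} v (h ∷ is) descent | tri≈ _ e _ | _ =
    contradiction (⟨$⟩-injective (product is) e) (ℤ.<⇒≢ (root-< v))
  -- With u the product of the tail, s the parabolic generator and h the letter that makes the
  -- reversal, h exchanges the two values. Hence h u = u s, and h u s = u is expressed by the tail.
  exchange {g} {κ} {i} {j} v (h ∷ is) descent | tri< lt _ _ | _ , _ , _ , hv = is , refl , λ z → begin
      product is ⟨$⟩ z                                          ≡⟨ cong (product is ⟨$⟩_) (generator-involutive (suc g) z) ⟨
      product is ⟨$⟩ (generator (suc g) ⟨$⟩ (generator (suc g) ⟨$⟩ z)) ≡⟨ twine (generator (suc g) ⟨$⟩ z) ⟨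
      generator h ⟨$⟩ (product is ⟨$⟩ (generator (suc g) ⟨$⟩ z)) ∎
    where
    open ≡-Reasoning
    twine : generator h ∘ₘ product is ≈ₘ product is ∘ₘ generator (suc g)
    twine = intertwine {u = product is} (reflects hv) (reflects v) (ℤ.<⇒≢ lt)
      (reversal hv (rootPair v (product is)) lt descent)

  -- The hypothesis speaks of shortest words only. By induction on its length, a word shorter than k
  -- would have no word shorter than itself, hence witness a length below k.
  no-shorter : ∀ {u k} → (∀ l → HasLength u l → k ≤ l) → ∀ js → js Expresses u → k ≤ length js
  no-shorter {u} {k} bound js e = go (suc (length js)) js ℕ.≤-refl e
    where
    go : ∀ m js → length js ℕ.< m → js Expresses u → k ≤ length js
    go (suc m) js (s≤s js≤m) e = ℕ.≮⇒≥ λ js<k → ℕ.<⇒≱ js<k (bound (length js) record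
      { word = js ; express = e ; length≡k = refl
      ; shortest = λ ks e′ → ℕ.≮⇒≥ λ ks<js → ℕ.<⇒≱ (ℕ.<-trans ks<js js<k) (go m ks (ℕ.<-≤-trans ks<js js≤m) e′) })

  minimal-ascends : ∀ (w : MinimalRep) {g κ i j} → View (suc g) κ i j →
                    element w ⟨$⟩ pos i ℤ.< element w ⟨$⟩ img κ (pos j)
  minimal-ascends w {g} {κ} {i} {j} v with ℤ.<-cmp (element w ⟨$⟩ pos i) (element w ⟨$⟩ img κ (pos j))
  ... | tri< lt _ _ = lt
  ... | tri≈ _ e _  = contradiction (⟨$⟩-injective (element w) e) (ℤ.<⇒≢ (root-< v))
  ... | tri> _ _ gt = contradiction shorter (ℕ.<⇒≱ (ℕ.≤-reflexive (trans (proj₁ (proj₂ swapped)) length≡k)))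
    where
    open MinimalRep w using (hasLength; minimal)
    open HasLength hasLength
    swapped = exchange v word (subst₂ ℤ._<_ (sym (express _)) (sym (express _)) gt)
    shorter : MinimalRep.len w ≤ length (proj₁ swapped)
    shorter = no-shorter (minimal (generator (suc g)) (g ∷ [] , λ _ → refl)) (proj₁ swapped)
      λ z → trans (proj₂ (proj₂ swapped) z) (express _)

  minimal-sorted : SingleLast t → ∀ w → Sorted (element w)
  minimal-sorted single w = record
    { ascending = λ i j j≡ → minimal-ascends w (adj j≡)
    ; middle    = λ i i≡n → subst (element w ⟨$⟩ pos i ℤ.<_) (⟨$⟩-img (element w) flip (pos i))
                              (minimal-ascends w (last₁ single i≡n)) }

  -- The exchange of n and n + 1. For a double last generator it lies outside the group, but it
  -- still permutes 1, ..., 2n and so respects levels.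
  flipLast : MirroredPerm n
  flipLast = Extend.mirrored n (sₙᶜ n) (sₙᶜ-involution n)

  last : Fin n
  last = fromℕ< (ℕ.≤-reflexive (ℕ.suc-pred n {{ℕ.>-nonZero (ℕ.<⇒≤ 2≤n)}}))

  suc-last : suc (toℕ last) ≡ n
  suc-last = trans (cong suc (toℕ-fromℕ< _)) (ℕ.suc-pred n {{ℕ.>-nonZero (ℕ.<⇒≤ 2≤n)}})

  last-unique : ∀ {i : Fin n} → suc (toℕ i) ≡ n → i ≡ last
  last-unique i≡n = toℕ-injective (ℕ.suc-injective (trans i≡n (sym suc-last)))

  flipLast-reflects : Reflects flipLast flip last last
  flipLast-reflects = record { at-i = at ; at-j = at ; fixed = λ k k≢ _ → trans (image k)
      (if-no λ e → k≢ (last-unique e)) }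
    where
    image : ∀ k → flipLast ⟨$⟩ pos k ≡ sₙᶜ n (suc (toℕ k))
    image k = Extend.low n (sₙᶜ n) (suc (toℕ k)) (s≤s z≤n) (toℕ<n k)
    at : flipLast ⟨$⟩ pos last ≡ M ℤ.- pos last
    at = trans (image last) (trans (if-yes suc-last) (trans suc-n≡M-n (cong (λ m → M ℤ.- + m) (sym suc-last))))

  flipLast-involutive : ∀ z → flipLast ⟨$⟩ (flipLast ⟨$⟩ z) ≡ z
  flipLast-involutive = involutive flipLast-reflects

  level-flipLast : ∀ w k → level (w ∘ₘ flipLast) k ≡ level w k
  level-flipLast w = level-∘ₘ w flipLast (preserves⇒range {flipLast} flipLast-involutive
    (preserves-flip flipLast-reflects (ℤ.+≤+ z≤n) (1≤pos last) (1≤pos last)))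

  -- In the types with a double last generator the window of a minimal element is
  -- sorted up to exchanging w(n) and w(n+1).
  record SortedTo (w : MirroredPerm n) : Set where
    field
      twist  : MirroredPerm n
      sorted : Sorted twist
      levels : ∀ k → level twist k ≡ level w k
      twist≈ : w ≈ₘ twist ⊎ w ∘ₘ flipLast ≈ₘ twist

  minimal-sortedTo : DoubleLast t → ∀ w → SortedTo (element w)
  minimal-sortedTo double w with ℤ.<-cmp (element w ⟨$⟩ pos last) (element w ⟨$⟩ img flip (pos last))
  ... | tri< lt _ _ = record { twist = element w ; levels = λ _ → refl ; twist≈ = inj₁ λ _ → refl ; sorted = record
      { ascending = λ i j j≡ → minimal-ascends w (adj j≡)
      ; middle    = λ i i≡n → subst (λ i → element w ⟨$⟩ pos i ℤ.< M ℤ.- element w ⟨$⟩ pos i) (sym (last-unique i≡n))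
          (subst (element w ⟨$⟩ pos last ℤ.<_) (⟨$⟩-img (element w) flip (pos last)) lt) } }
  ... | tri≈ _ e _  = contradiction (⟨$⟩-injective (element w) e)
      (ℤ.<⇒≢ (ℤ.<-≤-trans (ℤ.+<+ (s≤s (toℕ<n last))) (suc-n≤M-pos last)))
  ... | tri> _ _ gt = record { twist = u ∘ₘ flipLast ; levels = level-flipLast u ; twist≈ = inj₂ λ _ → refl
      ; sorted = record { ascending = ascending ; middle = middle } }
    where
    u = element w
    at-last : ∀ {i} → i ≡ last → (u ∘ₘ flipLast) ⟨$⟩ pos i ≡ u ⟨$⟩ img flip (pos i)
    at-last refl = cong (u ⟨$⟩_) (at-i flipLast-reflects)
    off-last : ∀ {i} → i ≢ last → (u ∘ₘ flipLast) ⟨$⟩ pos i ≡ u ⟨$⟩ pos i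
    off-last i≢ = cong (u ⟨$⟩_) (fixed flipLast-reflects _ i≢ i≢)
    ascending : ∀ i j → toℕ j ≡ suc (toℕ i) → (u ∘ₘ flipLast) ⟨$⟩ pos i ℤ.< (u ∘ₘ flipLast) ⟨$⟩ pos j
    ascending i j j≡ = go (j Fin.≟ last)
      where
      i≢last : i ≢ last
      i≢last refl = ℕ.<⇒≢ (toℕ<n j) (trans j≡ suc-last)
      go : Dec (j ≡ last) → (u ∘ₘ flipLast) ⟨$⟩ pos i ℤ.< (u ∘ₘ flipLast) ⟨$⟩ pos j
      -- After the exchange, w(n+1) stands at position n, and w(n-1) < w(n+1) is the ascent at the
      -- double last generator.
      go (yes j≡last) = subst₂ ℤ._<_ (sym (off-last i≢last)) (sym (at-last j≡last))
        (minimal-ascends w (last₂ double j≡ (trans (cong (λ j → suc (toℕ j)) j≡last) suc-last)))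
      go (no j≢last)  = subst₂ ℤ._<_ (sym (off-last i≢last)) (sym (off-last j≢last)) (minimal-ascends w (adj j≡))
    middle : ∀ i → suc (toℕ i) ≡ n → (u ∘ₘ flipLast) ⟨$⟩ pos i ℤ.< M ℤ.- (u ∘ₘ flipLast) ⟨$⟩ pos i
    middle i i≡n with last-unique i≡n
    ... | refl = subst₂ ℤ._<_ (sym (at-last refl)) (trans (sym (img-involutive flip _))
        (cong (λ y → M ℤ.- y) (sym (trans (at-last refl) (⟨$⟩-img u flip (pos last)))))) gt

  minimal-unique : ∀ v w → (∀ k → level (element v) k ≡ level (element w) k) → v ≈ᵣ w
  minimal-unique v w same with last? t
  ... | inj₁ single = sorted-unique (minimal-sorted single v) (minimal-sorted single w)
          (levels⇒sameWindow (element v) (element w) same)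
  ... | inj₂ double = resolve (SortedTo.twist≈ tv) (SortedTo.twist≈ tw)
    where
    tv = minimal-sortedTo double v
    tw = minimal-sortedTo double w
    twists≈ : SortedTo.twist tv ≈ₘ SortedTo.twist tw
    twists≈ = sorted-unique (SortedTo.sorted tv) (SortedTo.sorted tw) (levels⇒sameWindow (SortedTo.twist tv) (SortedTo.twist tw)
      (λ k → trans (SortedTo.levels tv k) (trans (same k) (sym (SortedTo.levels tw k)))))
    even : ∀ w → EvenCount (Crosses (+ n) (element w))
    even w = Membership.member-middle double (MinimalRep.member w)
    excluded : ∀ v w → ¬ element v ≈ₘ element w ∘ₘ flipLast
    excluded v w e = crosses-odd (toggles-flip flipLast-reflects) (element w) (even w)
      (crosses-cong {element v} {element w ∘ₘ flipLast} e (even v))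
    resolve : element v ≈ₘ SortedTo.twist tv ⊎ element v ∘ₘ flipLast ≈ₘ SortedTo.twist tv →
              element w ≈ₘ SortedTo.twist tw ⊎ element w ∘ₘ flipLast ≈ₘ SortedTo.twist tw → v ≈ᵣ w
    resolve (inj₁ ev) (inj₁ ew) z = trans (ev z) (trans (twists≈ z) (sym (ew z)))
    resolve (inj₁ ev) (inj₂ ew)   = contradiction (λ z → trans (ev z) (trans (twists≈ z) (sym (ew z)))) (excluded v w)
    resolve (inj₂ ev) (inj₁ ew)   = contradiction (λ z → trans (ew z) (trans (sym (twists≈ z)) (sym (ev z)))) (excluded w v)
    resolve (inj₂ ev) (inj₂ ew) z = begin
      element v ⟨$⟩ z                                    ≡⟨ cong (element v ⟨$⟩_) (flipLast-involutive z) ⟨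
      element v ⟨$⟩ (flipLast ⟨$⟩ (flipLast ⟨$⟩ z))      ≡⟨ trans (ev (flipLast ⟨$⟩ z)) (trans (twists≈ (flipLast ⟨$⟩ z)) (sym (ew (flipLast ⟨$⟩ z)))) ⟩
      element w ⟨$⟩ (flipLast ⟨$⟩ (flipLast ⟨$⟩ z))      ≡⟨ cong (element w ⟨$⟩_) (flipLast-involutive z) ⟩
      element w ⟨$⟩ z                                    ∎
      where open ≡-Reasoning

-- Shortest words and existence of minimal representatives

open CommutativeMonoidSum ℕ.+-0-commutativeMonoid using () renaming (sum to sumℕ; sum-cong-≗ to sumℕ-cong)

zeroAt : ∀ {n} → Fin n → (Fin n → ℕ) → Fin n → ℕ
zeroAt i f k with k Fin.≟ i
... | yes _ = 0
... | no _  = f k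

sumℕ-zero : ∀ {n} (f : Fin n → ℕ) → (∀ k → f k ≡ 0) → sumℕ f ≡ 0
sumℕ-zero {zero}  f _   = refl
sumℕ-zero {suc n} f f≡0 = cong₂ ℕ._+_ (f≡0 zero) (sumℕ-zero (f ∘ suc) (f≡0 ∘ suc))

sumℕ-zeroAt : ∀ {n} (i : Fin n) f → sumℕ f ≡ f i ℕ.+ sumℕ (zeroAt i f)
sumℕ-zeroAt {suc n} zero f = refl
sumℕ-zeroAt {suc n} (suc i) f = begin
  f zero ℕ.+ sumℕ (f ∘ suc)                                      ≡⟨ cong (f zero ℕ.+_) (sumℕ-zeroAt i (f ∘ suc)) ⟩
  f zero ℕ.+ (f (suc i) ℕ.+ sumℕ (zeroAt i (f ∘ suc)))           ≡⟨ lemma (f zero) (f (suc i)) _ ⟩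
  f (suc i) ℕ.+ (f zero ℕ.+ sumℕ (zeroAt i (f ∘ suc)))           ≡⟨ cong (λ m → f (suc i) ℕ.+ (f zero ℕ.+ m)) (sumℕ-cong tail) ⟩
  f (suc i) ℕ.+ sumℕ (zeroAt (suc i) f)                          ∎
  where
  open ≡-Reasoning
  lemma : ∀ a b c → a ℕ.+ (b ℕ.+ c) ≡ b ℕ.+ (a ℕ.+ c)
  lemma = ℕSolver.solve-∀
  tail : ∀ k → zeroAt i (f ∘ suc) k ≡ zeroAt (suc i) f (suc k)
  tail k with k Fin.≟ i
  ... | yes _ = refl
  ... | no _  = refl

zeroAt-≢ : ∀ {n} {i k : Fin n} f → k ≢ i → zeroAt i f k ≡ f k
zeroAt-≢ {i = i} {k} f k≢i with k Fin.≟ i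
... | yes k≡i = contradiction k≡i k≢i
... | no _    = refl

2∣m+m : ∀ m → 2 ∣ m ℕ.+ m
2∣m+m m = subst (2 ∣_) (cong (m ℕ.+_) (ℕ.+-identityʳ m)) (m∣m*n m)

-- In the total of both sums every entry other than i and j is counted twice.
even-sum-pair : ∀ {n} {i j : Fin n} (f g : Fin n → ℕ) → i ≢ j → (∀ k → k ≢ i → k ≢ j → f k ≡ g k) →
                2 ∣ (f i ℕ.+ f j) ℕ.+ (g i ℕ.+ g j) → 2 ∣ sumℕ f → 2 ∣ sumℕ g
even-sum-pair {n} {i} {j} f g i≢j same 2∣pairs 2∣f = ∣m+n∣m⇒∣n
  (subst (2 ∣_) (sym total) (∣m∣n⇒∣m+n 2∣pairs (2∣m+m (sumℕ (rest f))))) 2∣f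
  where
  rest : (Fin n → ℕ) → Fin n → ℕ
  rest f = zeroAt j (zeroAt i f)
  split : ∀ f → sumℕ f ≡ f i ℕ.+ (f j ℕ.+ sumℕ (rest f))
  split f = trans (sumℕ-zeroAt i f) (cong (f i ℕ.+_) (trans (sumℕ-zeroAt j (zeroAt i f))
    (cong (ℕ._+ sumℕ (rest f)) (zeroAt-≢ f (i≢j ∘ sym)))))
  rest-same : ∀ k → rest g k ≡ rest f k
  rest-same k with k Fin.≟ j
  ... | yes _ = refl
  ... | no k≢j with k Fin.≟ i
  ...   | yes _  = refl
  ...   | no k≢i = sym (same k k≢i k≢j)
  lemma : ∀ a b c d r → (a ℕ.+ (b ℕ.+ r)) ℕ.+ (c ℕ.+ (d ℕ.+ r)) ≡ ((a ℕ.+ b) ℕ.+ (c ℕ.+ d)) ℕ.+ (r ℕ.+ r)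
  lemma = ℕSolver.solve-∀
  total : sumℕ f ℕ.+ sumℕ g ≡ ((f i ℕ.+ f j) ℕ.+ (g i ℕ.+ g j)) ℕ.+ (sumℕ (rest f) ℕ.+ sumℕ (rest f))
  total = trans (cong₂ ℕ._+_ (split f) (trans (split g) (cong (λ m → g i ℕ.+ (g j ℕ.+ m)) (sumℕ-cong rest-same))))
    (lemma (f i) (f j) (g i) (g j) (sumℕ (rest f)))

-- a and 1 - a have opposite parity, and so have their absolute values.
even-∣a∣+∣1-a∣ : ∀ a → 2 ∣ suc (ℤ.∣ a ∣ ℕ.+ ℤ.∣ 1ℤ ℤ.- a ∣)
even-∣a∣+∣1-a∣ (+ zero)    = ∣-refl
even-∣a∣+∣1-a∣ (+ suc m)   = subst (2 ∣_) (cong (λ l → suc (suc (m ℕ.+ l))) (sym (abs m))) (∣m∣n⇒∣m+n ∣-refl (2∣m+m m))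
  where
  abs : ∀ m → ℤ.∣ 1ℤ ℤ.- + suc m ∣ ≡ m
  abs zero    = refl
  abs (suc m) = refl
even-∣a∣+∣1-a∣ -[1+ m ]    = subst (2 ∣_) (lemma m) (2∣m+m (suc (suc m)))
  where
  lemma : ∀ m → suc (suc m) ℕ.+ suc (suc m) ≡ suc (suc m ℕ.+ suc (suc m))
  lemma m = refl

module Search (n : ℕ) {P : List (Fin n) → Set} (P? : Decidable P) where

  ofLength? : ∀ {Q : List (Fin n) → Set} → Decidable Q → ∀ m → Dec (∃[ ks ] (length ks ≡ m × Q ks))
  ofLength? Q? zero    = map′ (λ q → [] , refl , q) (λ { ([] , _ , q) → q }) (Q? [])
  ofLength? Q? (suc m) = map′ (λ { (i , is , e , q) → i ∷ is , cong suc e , q })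
    (λ { (i ∷ is , e , q) → i , is , ℕ.suc-injective e , q }) (Fin.any? λ i → ofLength? (Q? ∘ (i ∷_)) m)

  -- There are finitely many words of each length, so it can be decided whether a shorter word has
  -- the property; repeated shortening stops.
  shortest : ∃ P → ∃[ ks ] P ks × (∀ js → P js → length ks ≤ length js)
  shortest (is , p) = go (suc (length is)) is ℕ.≤-refl p
    where
    go : ∀ m is → length is ℕ.< m → P is → ∃[ ks ] P ks × (∀ js → P js → length ks ≤ length js)
    go (suc m) is (s≤s is≤m) p with Fin.any? {length is} (λ l → ofLength? P? (toℕ l))
    ... | yes (l , js , e , q) = go m js (ℕ.<-≤-trans (subst (ℕ._< length is) (sym e) (toℕ<n l)) is≤m) q
    ... | no none = is , p , λ js q → ℕ.≮⇒≥ λ js<is → none (fromℕ< js<is , js , sym (toℕ-fromℕ< js<is) , q)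

pairMap-cong : ∀ {n} {A : Set} (f : A → A) (i j : Fin n) {a b : Fin n → A} →
               (∀ k → a k ≡ b k) → ∀ k → pairMap f i j a k ≡ pairMap f i j b k
pairMap-cong f i j a≗b k with k Fin.≟ i | k Fin.≟ j
... | yes _ | _     = cong f (a≗b j)
... | no _  | yes _ = cong f (a≗b i)
... | no _  | no _  = a≗b k

φ-involutive : ∀ κ x → φ κ (φ κ x) ≡ x
φ-involutive swap   x = refl
φ-involutive flip   x = ℤ.neg-involutive x
φ-involutive affine x = lemma x
  where
  lemma : ∀ x → 1ℤ ℤ.- (1ℤ ℤ.- x) ≡ x
  lemma = solve-∀

pairMap-φ : ∀ {n} κ (i j : Fin n) a k → pairMap (φ κ) i j (pairMap (φ κ) i j a) k ≡ a k
pairMap-φ κ i j a k = go (k Fin.≟ i) (k Fin.≟ j)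
  where
  f = φ κ
  go : Dec (k ≡ i) → Dec (k ≡ j) → pairMap f i j (pairMap f i j a) k ≡ a k
  go (yes refl) _      = trans (pairMap-i f i j (pairMap f i j a)) (trans (cong f (pairMap-j f i j a)) (φ-involutive κ _))
  go (no _) (yes refl) = trans (pairMap-j f i j (pairMap f i j a)) (trans (cong f (pairMap-i f i j a)) (φ-involutive κ _))
  go (no k≢i) (no k≢j) = trans (pairMap-other f i j (pairMap f i j a) k≢i k≢j) (pairMap-other f i j a k≢i k≢j)

module Orbit (t : Quotient) (n : ℕ) (rank : minRank t ≤ n) where

  open Representatives t n rank public

  private
    M = + N n

  generator-range : ∀ g {z} → InRange z → InRange (generator (suc g) ⟨$⟩ z)
  generator-range g = preserves⇒range {generator (suc g)} (generator-involutive (suc g)) (low (proj₂ (proj₂ (proj₂ (view (suc g))))))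
    where
    low : ∀ {κ i j} → View (suc g) κ i j → Preserves (generator (suc g)) 1ℤ
    low (adj j≡)           = step-preserves-1 {generator (suc g)} (adj-step j≡) (generator-involutive (suc g))
    low (last₁ single i≡n) = step-preserves-1 {generator (suc g)} (last-step single i≡n) (generator-involutive (suc g))
    low v@(last₂ _ {i} {j} _ _) = preserves-flip (reflects v) (ℤ.+≤+ z≤n) (1≤pos i) (1≤pos j)

  parabolic-range : ∀ is {z} → InRange z → InRange (product (map suc is) ⟨$⟩ z)
  parabolic-range []       z∈ = z∈
  parabolic-range (g ∷ is) z∈ = generator-range g (parabolic-range is z∈)

  level-parabolic : ∀ w x → InParabolic x → ∀ k → level (w ∘ₘ x) k ≡ level w k
  level-parabolic w x (is , e) = level-∘ₘ w x λ {z} z∈ → subst InRange (e z) (parabolic-range is z∈)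

  infix 4 _HasLevels_
  _HasLevels_ : Word → (Fin n → ℤ) → Set
  is HasLevels a = ∀ k → level (product is) k ≡ a k

  -- W permutes 1, ..., 2n, so levels are constant on cosets wW. A word that is shortest among all
  -- those with levels a therefore competes with every word for every element of its coset.
  representative : ∀ a → ∃ (_HasLevels a) → Σ MinimalRep λ w → ∀ k → level (element w) k ≡ a k
  representative a found with Search.shortest (suc n) (λ is → Fin.all? λ k → level (product is) k ℤ.≟ a k) found
  ... | is , has , bound = record
    { element   = product is
    ; member    = product-member is
    ; len       = length is
    ; hasLength = record { word = is ; express = λ _ → refl ; length≡k = refl
                         ; shortest = λ js e → bound js λ k → trans (level-cong {product js} {product is} e k) (has k) }
    ; minimal   = λ x x∈ l hl → subst (length is ≤_) (HasLength.length≡k hl) (bound (HasLength.word hl) λ k →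
        trans (level-cong {product (HasLength.word hl)} {product is ∘ₘ x} (HasLength.express hl) k)
          (trans (level-parabolic (product is) x x∈ k) (has k)))
    } , has

-- Transitivity on lattice points

Even : ∀ {n} → (Fin n → ℤ) → Set
Even a = 2 ∣ sumℕ λ k → ℤ.∣ a k ∣

inImage-intro : ∀ t {n} {a : Fin n → ℤ} → (DoubleFirst t → Even a) → InImage t a
inImage-intro C̃/C _    = tt
inImage-intro B̃/B even = even B̃/B
inImage-intro B̃/D _    = tt
inImage-intro D̃/D even = even D̃/D

inImage-even : ∀ {t} → DoubleFirst t → ∀ {n} {a : Fin n → ℤ} → InImage t a → Even a
inImage-even B̃/B even = even
inImage-even D̃/D even = even

even-cong : ∀ {n} {a b : Fin n → ℤ} → (∀ k → a k ≡ b k) → Even a → Even b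
even-cong a≗b = subst (2 ∣_) (sumℕ-cong λ k → cong ℤ.∣_∣ (a≗b k))

even-pairMap : ∀ {n} {i j : Fin n} κ a → i ≢ j → Even a → Even (pairMap (φ κ) i j a)
even-pairMap {i = i} {j} κ a i≢j = even-sum-pair _ _ i≢j
  (λ k k≢i k≢j → cong ℤ.∣_∣ (sym (pairMap-other (φ κ) i j a k≢i k≢j)))
  (subst₂ (λ x y → 2 ∣ (ℤ.∣ a i ∣ ℕ.+ ℤ.∣ a j ∣) ℕ.+ (ℤ.∣ x ∣ ℕ.+ ℤ.∣ y ∣))
    (sym (pairMap-i (φ κ) i j a)) (sym (pairMap-j (φ κ) i j a)) (even κ (a i) (a j)))
  where
  same : ∀ x y → 2 ∣ (x ℕ.+ y) ℕ.+ (y ℕ.+ x)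
  same x y = subst (λ m → 2 ∣ (x ℕ.+ y) ℕ.+ m) (ℕ.+-comm x y) (2∣m+m (x ℕ.+ y))
  even : ∀ κ x y → 2 ∣ (ℤ.∣ x ∣ ℕ.+ ℤ.∣ y ∣) ℕ.+ (ℤ.∣ φ κ y ∣ ℕ.+ ℤ.∣ φ κ x ∣)
  even swap   x y = same ℤ.∣ x ∣ ℤ.∣ y ∣
  even flip   x y = subst₂ (λ p q → 2 ∣ (ℤ.∣ x ∣ ℕ.+ ℤ.∣ y ∣) ℕ.+ (p ℕ.+ q)) (sym (ℤ.∣-i∣≡∣i∣ y)) (sym (ℤ.∣-i∣≡∣i∣ x))
                      (same ℤ.∣ x ∣ ℤ.∣ y ∣)
  even affine x y = ∣m+n∣m⇒∣n (subst (2 ∣_) (lemma ℤ.∣ x ∣ ℤ.∣ 1ℤ ℤ.- x ∣ ℤ.∣ y ∣ ℤ.∣ 1ℤ ℤ.- y ∣)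
                      (∣m∣n⇒∣m+n (even-∣a∣+∣1-a∣ x) (even-∣a∣+∣1-a∣ y))) ∣-refl
    where
    lemma : ∀ a b c d → suc (a ℕ.+ b) ℕ.+ suc (c ℕ.+ d) ≡ 2 ℕ.+ ((a ℕ.+ c) ℕ.+ (d ℕ.+ b))
    lemma = ℕSolver.solve-∀

module Transitivity (t : Quotient) (n : ℕ) (rank : minRank t ≤ n) where

  open Orbit t n rank public

  inImage-generator : ∀ {g κ i j} → View g κ i j → ∀ a → InImage t a → InImage t (pairMap (φ κ) i j a)
  inImage-generator v a a∈ = inImage-intro t λ double → go double v (inImage-even double a∈)
    where
    go : DoubleFirst t → ∀ {g κ i j} → View g κ i j → Even a → Even (pairMap (φ κ) i j a)
    go () (first₁ C̃/C _)
    go () (first₁ B̃/D _)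
    go _ (first₂ _ i≡0 j≡1) = even-pairMap affine a λ { refl → contradiction (trans (sym i≡0) j≡1) λ () }
    go _ (adj j≡)           = even-pairMap swap a λ { refl → ℕ.1+n≢n (sym j≡) }
    go _ (last₂ _ j≡ _)     = even-pairMap flip a λ { refl → ℕ.1+n≢n (sym j≡) }
    go _ (last₁ _ {i} _)    = subst (2 ∣_) (sumℕ-cong abs)
      where
      abs : ∀ k → ℤ.∣ a k ∣ ≡ ℤ.∣ pairMap ℤ.-_ i i a k ∣
      abs k with k Fin.≟ i
      ... | yes refl = sym (ℤ.∣-i∣≡∣i∣ (a k))
      ... | no _     = refl

  inImage-cong : ∀ {a b : Fin n → ℤ} → (∀ k → a k ≡ b k) → InImage t a → InImage t b
  inImage-cong a≗b a∈ = inImage-intro t λ double → even-cong a≗b (inImage-even double a∈)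

  product-inImage : ∀ is → InImage t (level (product is))
  product-inImage [] = inImage-intro t λ _ → subst (2 ∣_) (sym (sumℕ-zero _ λ k → cong ℤ.∣_∣ (level-id k))) (2 ∣0)
  product-inImage (g ∷ is) with view g
  ... | _ , _ , _ , v = inImage-cong (λ k → sym (level-reflects (reflects v) (product is) k))
                          (inImage-generator v _ (product-inImage is))

  Reach : (Fin n → ℤ) → Set
  Reach a = ∃ (_HasLevels a)

  infix 4 _⇝_
  -- The parity condition is carried forwards and reachability backwards, so a path from a to the
  -- origin reaches a.
  _⇝_ : (Fin n → ℤ) → (Fin n → ℤ) → Set
  a ⇝ b = (InImage t a → InImage t b) × (Reach b → Reach a)

  ⇝-trans : ∀ {a b c} → a ⇝ b → b ⇝ c → a ⇝ c
  ⇝-trans (p , q) (p′ , q′) = p′ ∘ p , q ∘ q′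

  ≗⇒⇝ : ∀ {a b} → (∀ k → a k ≡ b k) → a ⇝ b
  ≗⇒⇝ a≗b = inImage-cong a≗b , λ (is , h) → is , λ k → trans (h k) (sym (a≗b k))

  -- Reflections in arbitrary pairs of coordinates

  Available : Kind → Fin n → Fin n → Set
  Available κ i j = ∀ a → a ⇝ pairMap (φ κ) i j a

  view-available : ∀ {g κ i j} → View g κ i j → Available κ i j
  view-available {g} {κ} {i} {j} v a = inImage-generator v a , λ (is , h) → g ∷ is , λ k →
    trans (level-reflects (reflects v) (product is) k)
      (trans (pairMap-cong (φ κ) i j h k) (pairMap-φ κ i j a k))

  available-sym : ∀ {κ i j} → Available κ i j → Available κ j i
  available-sym {κ} {i} {j} av a = ⇝-trans (av a) (≗⇒⇝ λ k → go k (k Fin.≟ i) (k Fin.≟ j))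
    where
    f = φ κ
    go : ∀ k → Dec (k ≡ i) → Dec (k ≡ j) → pairMap f i j a k ≡ pairMap f j i a k
    go k (yes refl) _        = trans (pairMap-i f i j a) (sym (pairMap-j f j i a))
    go k (no _) (yes refl)   = trans (pairMap-j f i j a) (sym (pairMap-i f j i a))
    go k (no k≢i) (no k≢j)   = trans (pairMap-other f i j a k≢i k≢j) (sym (pairMap-other f j i a k≢j k≢i))

  -- Conjugation by the transposition of j and k. It spreads a generator, given at one pair, to all
  -- pairs.
  available-conj : ∀ {κ i j k} → i ≢ j → i ≢ k → j ≢ k → Available κ i j → Available swap j k → Available κ i k
  available-conj {κ} {i} {j} {k} i≢j i≢k j≢k av sw a = ⇝-trans (sw a) (⇝-trans (av b) (⇝-trans (sw c)
      (≗⇒⇝ λ l → go l (l Fin.≟ i) (l Fin.≟ j) (l Fin.≟ k))))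
    where
    f = φ κ
    τ = pairMap (φ swap) j k
    b = τ a
    c = pairMap f i j b
    go : ∀ l → Dec (l ≡ i) → Dec (l ≡ j) → Dec (l ≡ k) → τ c l ≡ pairMap f i k a l
    go l (yes refl) _ _ = trans (pairMap-other _ j k c i≢j i≢k) (trans (pairMap-i f i j b)
      (trans (cong f (pairMap-i _ j k a)) (sym (pairMap-i f i k a))))
    go l (no l≢i) (yes refl) _ = trans (pairMap-i _ j k c) (trans (pairMap-other f i j b (i≢k ∘ sym) (j≢k ∘ sym))
      (trans (pairMap-j _ j k a) (sym (pairMap-other f i k a l≢i j≢k))))
    go l (no l≢i) (no l≢j) (yes refl) = trans (pairMap-j _ j k c) (trans (pairMap-j f i j b)
      (trans (cong f (pairMap-other _ j k a i≢j i≢k)) (sym (pairMap-j f i k a))))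
    go l (no l≢i) (no l≢j) (no l≢k) = trans (pairMap-other _ j k c l≢j l≢k) (trans (pairMap-other f i j b l≢i l≢j)
      (trans (pairMap-other _ j k a l≢j l≢k) (sym (pairMap-other f i k a l≢i l≢k))))

  available-conj₁ : ∀ {κ j k} → Available κ j j → Available swap j k → Available κ k k
  available-conj₁ {κ} {j} {k} av sw a = ⇝-trans (sw a) (⇝-trans (av b) (⇝-trans (sw c)
      (≗⇒⇝ λ l → go l (l Fin.≟ k) (l Fin.≟ j))))
    where
    f = φ κ
    τ = pairMap (φ swap) j k
    b = τ a
    c = pairMap f j j b
    go : ∀ l → Dec (l ≡ k) → Dec (l ≡ j) → τ c l ≡ pairMap f k k a l
    go l (yes refl) _ = trans (pairMap-j _ j k c) (trans (pairMap-i f j j b)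
      (trans (cong f (pairMap-i _ j k a)) (sym (pairMap-i f k k a))))
    go l (no l≢k) (yes refl) = trans (pairMap-i _ j k c) (trans (pairMap-other f j j b (l≢k ∘ sym) (l≢k ∘ sym))
      (trans (pairMap-j _ j k a) (sym (pairMap-other f k k a l≢k l≢k))))
    go l (no l≢k) (no l≢j) = trans (pairMap-other _ j k c l≢j l≢k) (trans (pairMap-other f j j b l≢j l≢j)
      (trans (pairMap-other _ j k a l≢j l≢k) (sym (pairMap-other f k k a l≢k l≢k))))

  available-pair : ∀ {κ i j} → i ≢ j → Available κ i i → Available κ j j → Available swap i j → Available κ i j
  available-pair {κ} {i} {j} i≢j avᵢ avⱼ sw a = ⇝-trans (sw a) (⇝-trans (avᵢ b) (⇝-trans (avⱼ c)
      (≗⇒⇝ λ l → go l (l Fin.≟ i) (l Fin.≟ j))))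
    where
    f = φ κ
    b = pairMap (φ swap) i j a
    c = pairMap f i i b
    go : ∀ l → Dec (l ≡ i) → Dec (l ≡ j) → pairMap f j j c l ≡ pairMap f i j a l
    go l (yes refl) _ = trans (pairMap-other f j j c i≢j i≢j) (trans (pairMap-i f i i b)
      (trans (cong f (pairMap-i _ i j a)) (sym (pairMap-i f i j a))))
    go l (no l≢i) (yes refl) = trans (pairMap-i f j j c) (trans (cong f (trans (pairMap-other f i i b l≢i l≢i)
      (pairMap-j _ i j a))) (sym (pairMap-j f i j a)))
    go l (no l≢i) (no l≢j) = trans (pairMap-other f j j c l≢j l≢j) (trans (pairMap-other f i i b l≢i l≢i)
      (trans (pairMap-other _ i j a l≢i l≢j) (sym (pairMap-other f i j a l≢i l≢j))))

  origin₀ : Fin n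
  origin₀ = fromℕ< (ℕ.<⇒≤ 2≤n)

  toℕ-origin₀ : toℕ origin₀ ≡ 0
  toℕ-origin₀ = toℕ-fromℕ< (ℕ.<⇒≤ 2≤n)

  toℕ-≢ : ∀ {i j : Fin n} → toℕ i ≢ toℕ j → i ≢ j
  toℕ-≢ ne refl = ne refl

  swap-origin : ∀ m k → toℕ k ≡ suc m → Available swap origin₀ k
  swap-origin zero    k k≡1 = view-available (adj (trans k≡1 (cong suc (sym toℕ-origin₀))))
  swap-origin (suc m) k k≡ = available-conj {swap} {i = origin₀} {k′} {k}
      (toℕ-≢ λ e → contradiction (trans (sym toℕ-origin₀) (trans e k′≡)) λ ())
      (toℕ-≢ λ e → contradiction (trans (sym toℕ-origin₀) (trans e k≡)) λ ())
      (toℕ-≢ λ e → ℕ.1+n≢n (sym (trans (sym k′≡) (trans e k≡))))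
      (swap-origin m k′ k′≡) (view-available (adj (trans k≡ (cong suc (sym k′≡)))))
    where
    m<n : suc m ℕ.< n
    m<n = ℕ.<⇒≤ (subst (ℕ._< n) k≡ (toℕ<n k))
    k′ = fromℕ< m<n
    k′≡ : toℕ k′ ≡ suc m
    k′≡ = toℕ-fromℕ< m<n

  swap-from-origin : ∀ k → k ≢ origin₀ → Available swap origin₀ k
  swap-from-origin k k≢ = go (toℕ k) refl
    where
    go : ∀ m → toℕ k ≡ m → Available swap origin₀ k
    go zero    e = contradiction (toℕ-injective (trans e (sym toℕ-origin₀))) k≢
    go (suc m) e = swap-origin m k e

  swap-available : ∀ i j → i ≢ j → Available swap i j
  swap-available i j i≢j with i Fin.≟ origin₀ | j Fin.≟ origin₀
  ... | yes refl | _        = swap-from-origin j (i≢j ∘ sym)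
  ... | no i≢    | yes refl = available-sym {swap} (swap-from-origin i i≢)
  ... | no i≢    | no j≢    = available-conj {swap} i≢ i≢j (j≢ ∘ sym)
                                (available-sym {swap} (swap-from-origin i i≢)) (swap-from-origin j j≢)

  available-from : ∀ {κ i j} → i ≢ j → Available κ i j → ∀ k → i ≢ k → Available κ i k
  available-from {κ} {i} {j} i≢j av k i≢k with j Fin.≟ k
  ... | yes refl = av
  ... | no j≢k   = available-conj {κ} i≢j i≢k j≢k av (swap-available j k j≢k)

  available-pairs : ∀ {κ i j} → i ≢ j → Available κ i j → ∀ k l → k ≢ l → Available κ k l
  available-pairs {κ} {i} {j} i≢j av k l k≢l with i Fin.≟ k
  ... | yes refl = available-from {κ} i≢j av l k≢l
  ... | no i≢k   = available-from {κ} (i≢k ∘ sym) (available-sym {κ} (available-from {κ} i≢j av k i≢k)) l k≢l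

  available-singles : ∀ {κ j} → Available κ j j → ∀ k → Available κ k k
  available-singles {κ} {j} av k with j Fin.≟ k
  ... | yes refl = av
  ... | no j≢k   = available-conj₁ {κ} av (swap-available j k j≢k)

  origin₁ : Fin n
  origin₁ = fromℕ< 2≤n

  toℕ-origin₁ : toℕ origin₁ ≡ 1
  toℕ-origin₁ = toℕ-fromℕ< 2≤n

  affine-single : SingleFirst t → ∀ k → Available affine k k
  affine-single single = available-singles {affine} {origin₀} (view-available (first₁ single toℕ-origin₀))

  flip-single : SingleLast t → ∀ k → Available flip k k
  flip-single single = available-singles {flip} {last} (view-available (last₁ single suc-last))

  affine-available : ∀ i j → i ≢ j → Available affine i j
  affine-available i j i≢j with first? t
  ... | inj₁ single = available-pair {affine} i≢j (affine-single single i) (affine-single single j) (swap-available i j i≢j)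
  ... | inj₂ double = available-pairs {affine} {origin₀} {origin₁}
          (toℕ-≢ λ e → contradiction (trans (sym toℕ-origin₀) (trans e toℕ-origin₁)) λ ())
          (view-available (first₂ double toℕ-origin₀ toℕ-origin₁)) i j i≢j

  flip-available : ∀ i j → i ≢ j → Available flip i j
  flip-available i j i≢j with last? t
  ... | inj₁ single = available-pair {flip} i≢j (flip-single single i) (flip-single single j) (swap-available i j i≢j)
  ... | inj₂ double = available-pairs {flip} {secondLast} {last} (toℕ-≢ λ e → ℕ.1+n≢n (trans (sym last≡) (sym e)))
          (view-available (last₂ double last≡ suc-last)) i j i≢j
    where
    pred-last : suc (ℕ.pred (toℕ last)) ≡ toℕ last
    pred-last = ℕ.suc-pred (toℕ last) {{ℕ.>-nonZero (ℕ.≤-pred (ℕ.≤-trans 2≤n (ℕ.≤-reflexive (sym suc-last))))}}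
    secondLast : Fin n
    secondLast = fromℕ< (ℕ.≤-<-trans (ℕ.pred[n]≤n {toℕ last}) (toℕ<n last))
    last≡ : toℕ last ≡ suc (toℕ secondLast)
    last≡ = trans (sym pred-last) (cong suc (sym (toℕ-fromℕ< _)))

  -- Translation by c(eᵢ + eⱼ). For c = ±1 it is the composite of the flip and the affine reflection
  -- at the same pair, which are available in all four types.
  translate : ℤ → Fin n → Fin n → (Fin n → ℤ) → Fin n → ℤ
  translate c i j a k with k Fin.≟ i | k Fin.≟ j
  ... | yes _ | _     = c ℤ.+ a k
  ... | no _  | yes _ = c ℤ.+ a k
  ... | no _  | no _  = a k

  translate-i : ∀ c i j a → translate c i j a i ≡ c ℤ.+ a i
  translate-i c i j a with i Fin.≟ i
  ... | yes _  = refl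
  ... | no i≢i = contradiction refl i≢i

  translate-j : ∀ c i j a → translate c i j a j ≡ c ℤ.+ a j
  translate-j c i j a with j Fin.≟ i | j Fin.≟ j
  ... | yes _ | _      = refl
  ... | no _  | yes _  = refl
  ... | no _  | no j≢j = contradiction refl j≢j

  translate-other : ∀ c i j a {k} → k ≢ i → k ≢ j → translate c i j a k ≡ a k
  translate-other c i j a {k} k≢i k≢j with k Fin.≟ i | k Fin.≟ j
  ... | yes k≡i | _       = contradiction k≡i k≢i
  ... | no _    | yes k≡j = contradiction k≡j k≢j
  ... | no _    | no _    = refl

  translate-+ : ∀ c d i j a k → translate c i j (translate d i j a) k ≡ translate (c ℤ.+ d) i j a k
  translate-+ c d i j a k = go (k Fin.≟ i) (k Fin.≟ j)
    where
    b = translate d i j a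
    go : Dec (k ≡ i) → Dec (k ≡ j) → translate c i j b k ≡ translate (c ℤ.+ d) i j a k
    go (yes refl) _ = trans (translate-i c i j b) (trans (cong (λ z → c ℤ.+ z) (translate-i d i j a))
      (trans (sym (ℤ.+-assoc c d _)) (sym (translate-i (c ℤ.+ d) i j a))))
    go (no _) (yes refl) = trans (translate-j c i j b) (trans (cong (λ z → c ℤ.+ z) (translate-j d i j a))
      (trans (sym (ℤ.+-assoc c d _)) (sym (translate-j (c ℤ.+ d) i j a))))
    go (no k≢i) (no k≢j) = trans (translate-other c i j b k≢i k≢j)
      (trans (translate-other d i j a k≢i k≢j) (sym (translate-other (c ℤ.+ d) i j a k≢i k≢j)))

  translate-0 : ∀ i j a k → a k ≡ translate 0ℤ i j a k
  translate-0 i j a k with k Fin.≟ i | k Fin.≟ j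
  ... | yes _ | _     = sym (ℤ.+-identityˡ (a k))
  ... | no _  | yes _ = sym (ℤ.+-identityˡ (a k))
  ... | no _  | no _  = refl

  private
    two-step : ∀ {κ λ′ c} → (∀ x → φ λ′ (φ κ x) ≡ c ℤ.+ x) → ∀ i j a k →
               pairMap (φ λ′) i j (pairMap (φ κ) i j a) k ≡ translate c i j a k
    two-step {κ} {λ′} {c} e i j a k = go (k Fin.≟ i) (k Fin.≟ j)
      where
      b = pairMap (φ κ) i j a
      go : Dec (k ≡ i) → Dec (k ≡ j) → pairMap (φ λ′) i j b k ≡ translate c i j a k
      go (yes refl) _      = trans (pairMap-i (φ λ′) i j b) (trans (cong (φ λ′) (pairMap-j (φ κ) i j a)) (trans (e _) (sym (translate-i c i j a))))
      go (no _) (yes refl) = trans (pairMap-j (φ λ′) i j b) (trans (cong (φ λ′) (pairMap-i (φ κ) i j a)) (trans (e _) (sym (translate-j c i j a))))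
      go (no k≢i) (no k≢j) = trans (pairMap-other (φ λ′) i j b k≢i k≢j) (trans (pairMap-other (φ κ) i j a k≢i k≢j) (sym (translate-other c i j a k≢i k≢j)))

    translate-suc : ∀ i j → i ≢ j → ∀ a → a ⇝ translate 1ℤ i j a
    translate-suc i j i≢j a = ⇝-trans (flip-available i j i≢j a) (⇝-trans (affine-available i j i≢j _)
      (≗⇒⇝ (two-step {flip} {affine} (λ x → cong ℤ.suc (ℤ.neg-involutive x)) i j a)))

    translate-pred : ∀ i j → i ≢ j → ∀ a → a ⇝ translate (ℤ.- 1ℤ) i j a
    translate-pred i j i≢j a = ⇝-trans (affine-available i j i≢j a) (⇝-trans (flip-available i j i≢j _)
      (≗⇒⇝ (two-step {affine} {flip} lemma i j a)))
      where
      lemma : ∀ x → ℤ.- (1ℤ ℤ.- x) ≡ ℤ.- 1ℤ ℤ.+ x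
      lemma = solve-∀

  translate-⇝ : ∀ i j → i ≢ j → ∀ c a → a ⇝ translate c i j a
  translate-⇝ i j i≢j (+ zero)       a = ≗⇒⇝ (translate-0 i j a)
  translate-⇝ i j i≢j (+ suc m)      a = ⇝-trans (translate-⇝ i j i≢j (+ m) a)
    (⇝-trans (translate-suc i j i≢j _) (≗⇒⇝ (translate-+ 1ℤ (+ m) i j a)))
  translate-⇝ i j i≢j -[1+ zero ]    a = translate-pred i j i≢j a
  translate-⇝ i j i≢j -[1+ suc m ]   a = ⇝-trans (translate-⇝ i j i≢j -[1+ m ] a)
    (⇝-trans (translate-pred i j i≢j _) (≗⇒⇝ (translate-+ (ℤ.- 1ℤ) -[1+ m ] i j a)))

  -- Reduction of lattice points to the origin

  record Supported (a : Fin n → ℤ) (x y : ℤ) : Set where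
    field
      at₁     : a origin₁ ≡ x
      at₀     : a origin₀ ≡ y
      outside : ∀ k → k ≢ origin₁ → k ≢ origin₀ → a k ≡ 0ℤ

  open Supported

  origin₁≢origin₀ : origin₁ ≢ origin₀
  origin₁≢origin₀ = toℕ-≢ λ e → contradiction (trans (sym toℕ-origin₁) (trans e toℕ-origin₀)) λ ()

  supported-zero : ∀ {a} → Supported a 0ℤ 0ℤ → Reach a
  supported-zero {a} s = [] , λ k → trans (level-id k) (sym (go k))
    where
    go : ∀ k → a k ≡ 0ℤ
    go k with k Fin.≟ origin₁ | k Fin.≟ origin₀
    ... | yes refl | _        = at₁ s
    ... | no _     | yes refl = at₀ s
    ... | no k≢₁   | no k≢₀   = outside s k k≢₁ k≢₀

  supported-translate : ∀ {a x y} c → Supported a x y → Supported (translate c origin₁ origin₀ a) (c ℤ.+ x) (c ℤ.+ y)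
  supported-translate {a} c s = record
    { at₁ = trans (translate-i c _ _ a) (cong (λ z → c ℤ.+ z) (at₁ s))
    ; at₀ = trans (translate-j c _ _ a) (cong (λ z → c ℤ.+ z) (at₀ s))
    ; outside = λ k k≢₁ k≢₀ → trans (translate-other c _ _ a k≢₁ k≢₀) (outside s k k≢₁ k≢₀) }

  -- With a double last generator signs change in pairs, so a vanishing third
  -- coordinate absorbs the second sign.
  supported-negate : ∀ {a x y} → Supported a x y → ∃[ b ] a ⇝ b × Supported b (ℤ.- x) y
  supported-negate {a} {x} {y} s with last? t
  ... | inj₁ single = _ , flip-single single origin₁ a , record
    { at₁ = trans (pairMap-i ℤ.-_ origin₁ origin₁ a) (cong ℤ.-_ (at₁ s))
    ; at₀ = trans (pairMap-other ℤ.-_ origin₁ origin₁ a (origin₁≢origin₀ ∘ sym) (origin₁≢origin₀ ∘ sym)) (at₀ s)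
    ; outside = λ k k≢₁ k≢₀ → trans (pairMap-other ℤ.-_ origin₁ origin₁ a k≢₁ k≢₁) (outside s k k≢₁ k≢₀) }
  ... | inj₂ double = _ , ⇝-trans (swap-available origin₁ q o₁≢q a) (flip-available origin₁ q o₁≢q b) , record
    { at₁ = trans (pairMap-i ℤ.-_ origin₁ q b) (cong ℤ.-_ (trans (pairMap-j _ origin₁ q a) (at₁ s)))
    ; at₀ = trans (pairMap-other ℤ.-_ origin₁ q b (origin₁≢origin₀ ∘ sym) o₀≢q)
              (trans (pairMap-other _ origin₁ q a (origin₁≢origin₀ ∘ sym) o₀≢q) (at₀ s))
    ; outside = λ k k≢₁ k≢₀ → outside′ k k≢₁ k≢₀ (k Fin.≟ q) }
    where
    3≤n : ∀ {t} → DoubleLast t → minRank t ≤ n → 3 ≤ n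
    3≤n B̃/D r = r
    3≤n D̃/D r = ℕ.<⇒≤ r
    q = fromℕ< (3≤n double rank)
    toℕ-q : toℕ q ≡ 2
    toℕ-q = toℕ-fromℕ< (3≤n double rank)
    o₁≢q : origin₁ ≢ q
    o₁≢q = toℕ-≢ λ e → contradiction (trans (sym toℕ-origin₁) (trans e toℕ-q)) λ ()
    o₀≢q : origin₀ ≢ q
    o₀≢q = toℕ-≢ λ e → contradiction (trans (sym toℕ-origin₀) (trans e toℕ-q)) λ ()
    b = pairMap (φ swap) origin₁ q a
    outside′ : ∀ k → k ≢ origin₁ → k ≢ origin₀ → Dec (k ≡ q) → pairMap ℤ.-_ origin₁ q b k ≡ 0ℤ
    outside′ k k≢₁ k≢₀ (yes refl) = trans (pairMap-j ℤ.-_ origin₁ q b)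
      (cong ℤ.-_ (trans (pairMap-i _ origin₁ q a) (outside s q k≢₁ k≢₀)))
    outside′ k k≢₁ k≢₀ (no k≢q)   = trans (pairMap-other ℤ.-_ origin₁ q b k≢₁ k≢q)
      (trans (pairMap-other _ origin₁ q a k≢₁ k≢q) (outside s k k≢₁ k≢₀))

  -- (0, 2h) ⇝ (−h, h) ⇝ (h, h) ⇝ (0, 0).
  supported-even : ∀ {a} h → Supported a 0ℤ (h ℤ.+ h) → Reach a
  supported-even {a} h s with supported-negate (supported-translate (ℤ.- h) s)
  ... | b , a⇝b , s′ = proj₂ (⇝-trans (translate-⇝ origin₁ origin₀ origin₁≢origin₀ (ℤ.- h) a)
        (⇝-trans a⇝b (translate-⇝ origin₁ origin₀ origin₁≢origin₀ (ℤ.- h) b)))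
      (supported-zero (subst₂ (Supported _) (lemma₁ h) (lemma₀ h) (supported-translate (ℤ.- h) s′)))
    where
    lemma₁ : ∀ h → ℤ.- h ℤ.+ ℤ.- (ℤ.- h ℤ.+ 0ℤ) ≡ 0ℤ
    lemma₁ = solve-∀
    lemma₀ : ∀ h → ℤ.- h ℤ.+ (ℤ.- h ℤ.+ (h ℤ.+ h)) ≡ 0ℤ
    lemma₀ = solve-∀

  halves : ∀ x → (∃[ h ] x ≡ h ℤ.+ h) ⊎ (∃[ h ] 1ℤ ℤ.- x ≡ h ℤ.+ h)
  halves = λ { (+ m) → halves-ℕ m ; -[1+ m ] → negate (halves-ℕ (suc m)) }
    where
    Halves : ℤ → Set
    Halves x = (∃[ h ] x ≡ h ℤ.+ h) ⊎ (∃[ h ] 1ℤ ℤ.- x ≡ h ℤ.+ h)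
    negate : ∀ {x} → Halves x → Halves (ℤ.- x)
    negate (inj₁ (h , e)) = inj₁ (ℤ.- h , trans (cong ℤ.-_ e) (ℤ.neg-distrib-+ h h))
    negate {x} (inj₂ (h , e)) = inj₂ (1ℤ ℤ.- h , trans (lemma x) (trans (cong (λ z → 1ℤ ℤ.+ 1ℤ ℤ.- z) e) (lemma′ h)))
      where
      lemma : ∀ x → 1ℤ ℤ.- (ℤ.- x) ≡ 1ℤ ℤ.+ 1ℤ ℤ.- (1ℤ ℤ.- x)
      lemma = solve-∀
      lemma′ : ∀ h → 1ℤ ℤ.+ 1ℤ ℤ.- (h ℤ.+ h) ≡ (1ℤ ℤ.- h) ℤ.+ (1ℤ ℤ.- h)
      lemma′ = solve-∀
    complement : ∀ {x} → Halves x → Halves (1ℤ ℤ.- x)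
    complement (inj₁ (h , e)) = inj₂ (h , trans (φ-involutive affine _) e)
    complement (inj₂ h)       = inj₁ h
    halves-ℕ : ∀ m → Halves (+ m)
    halves-ℕ zero    = inj₁ (0ℤ , refl)
    -- m + 1 = 1 - (-m).
    halves-ℕ (suc m) = subst Halves (cong ℤ.suc (ℤ.neg-involutive (+ m))) (complement (negate (halves-ℕ m)))

  even-halves : ∀ x → 2 ∣ ℤ.∣ x ∣ → ∃[ h ] x ≡ h ℤ.+ h
  even-halves x 2∣x with halves x
  ... | inj₁ h       = h
  ... | inj₂ (h , e) = contradiction (even-∣a∣+∣1-a∣ x) λ 2∣ → even-step₁ 2∣x+ 2∣ (inj₁ refl)
    where
    2∣x+ : 2 ∣ ℤ.∣ x ∣ ℕ.+ ℤ.∣ 1ℤ ℤ.- x ∣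
    2∣x+ = ∣m∣n⇒∣m+n 2∣x (subst (λ z → 2 ∣ ℤ.∣ z ∣) (sym e) (double h))
      where
      double : ∀ h → 2 ∣ ℤ.∣ h ℤ.+ h ∣
      double (+ m)    = 2∣m+m m
      double -[1+ m ] = subst (2 ∣_) (cong suc (ℕ.+-suc m m)) (2∣m+m (suc m))

  -- An odd y becomes the even 1 - y under a single affine reflection. With a double first generator
  -- the parity condition makes y even.
  supported-reach : ∀ {a y} → Supported a 0ℤ y → InImage t a → Reach a
  supported-reach {a} {y} s a∈ with halves y | first? t
  ... | inj₁ (h , e) | _ = supported-even h (subst (Supported a 0ℤ) e s)
  ... | inj₂ (h , e) | inj₁ single = proj₂ (affine-single single origin₀ a) (supported-even h record
    { at₁ = trans (pairMap-other (φ affine) origin₀ origin₀ a origin₁≢origin₀ origin₁≢origin₀) (at₁ s)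
    ; at₀ = trans (pairMap-i (φ affine) origin₀ origin₀ a) (trans (cong (λ z → 1ℤ ℤ.- z) (at₀ s)) e)
    ; outside = λ k k≢₁ k≢₀ → trans (pairMap-other (φ affine) origin₀ origin₀ a k≢₀ k≢₀) (outside s k k≢₁ k≢₀) })
  ... | inj₂ _ | inj₂ double = supported-even (proj₁ half) (subst (Supported a 0ℤ) (proj₂ half) s)
    where
    elsewhere : ∀ k → zeroAt origin₀ (λ k → ℤ.∣ a k ∣) k ≡ 0
    elsewhere k with k Fin.≟ origin₀ | k Fin.≟ origin₁
    ... | yes _   | _        = refl
    ... | no _    | yes refl = cong ℤ.∣_∣ (at₁ s)
    ... | no k≢₀  | no k≢₁   = cong ℤ.∣_∣ (outside s k k≢₁ k≢₀)
    total : sumℕ (λ k → ℤ.∣ a k ∣) ≡ ℤ.∣ y ∣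
    total = trans (sumℕ-zeroAt origin₀ _) (trans (cong₂ ℕ._+_ (cong ℤ.∣_∣ (at₀ s)) (sumℕ-zero _ elsewhere)) (ℕ.+-identityʳ _))
    half = even-halves y (subst (2 ∣_) total (inImage-even double a∈))

  -- Coordinates are cleared from the last downwards: translation along e₁ + eⱼ makes coordinate j
  -- vanish at the expense of the first, which collects everything.
  reach : ∀ a → InImage t a → Reach a
  reach a = clear n a λ k n≤k → contradiction (toℕ<n k) (ℕ.≤⇒≯ n≤k)
    where
    clear : ∀ m a → (∀ k → m ≤ toℕ k → k ≢ origin₀ → a k ≡ 0ℤ) → InImage t a → Reach a
    clear zero a zeros = supported-reach record
      { at₁ = zeros origin₁ z≤n origin₁≢origin₀ ; at₀ = refl ; outside = λ k _ → zeros k z≤n }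
    clear (suc m) a zeros with m ℕ.<? n
    ... | no m≮n = clear m a λ k m≤k → contradiction (toℕ<n k) (ℕ.≤⇒≯ (ℕ.≤-trans (ℕ.≮⇒≥ m≮n) m≤k))
    ... | yes m<n with fromℕ< m<n Fin.≟ origin₀
    ...   | yes j≡ = clear m a λ k m≤k k≢ → zeros k (ℕ.≤∧≢⇒< m≤k λ e → k≢ (trans (toℕ-injective (trans (sym e) (sym (toℕ-fromℕ< m<n)))) j≡)) k≢
    ...   | no j≢ = λ a∈ → proj₂ moved (clear m b zeros′ (proj₁ moved a∈))
      where
      j = fromℕ< m<n
      b = translate (ℤ.- a j) j origin₀ a
      moved : a ⇝ b
      moved = translate-⇝ j origin₀ j≢ (ℤ.- a j) a
      zeros′ : ∀ k → m ≤ toℕ k → k ≢ origin₀ → b k ≡ 0ℤ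
      zeros′ k m≤k k≢ = go (k Fin.≟ j)
        where
        go : Dec (k ≡ j) → b k ≡ 0ℤ
        go (yes refl) = trans (translate-i _ j origin₀ a) (ℤ.+-inverseˡ (a j))
        go (no k≢j)   = trans (translate-other _ j origin₀ a k≢j k≢) (zeros k (ℕ.≤∧≢⇒< m≤k λ e →
            k≢j (toℕ-injective (trans (sym e) (sym (toℕ-fromℕ< m<n))))) k≢)

-- Root lattice coordinates

module Coordinates {c ℓ₁ ℓ₂} (K : HeytingField c ℓ₁ ℓ₂) (char0 : CharacteristicZero K)
                   (t : Quotient) (n : ℕ) (rank : minRank t ≤ n) where

  open Transitivity t n rank
  open Action K char0 t n rank
    using (V; _≈ᵥ_; ⟨_,_⟩; e; 0ᵥ; fromℤ; latticePoint; 2#; 2/⟨_⟩; lastRoot; α; α̃; generatorAct; act; rootLatticeCoordinate)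
  open VectorSpace.RootsNonzero K n char0 using (2#0; e-yes; e-no; ⟨e,⟩; sum-single; sum-combination; norm)
  open HeytingField K hiding (sym; trans; refl; zero)
  open HeytingField K using () renaming (sym to ≈-sym; trans to ≈-trans; refl to ≈-refl)
  open CommutativeRing (HeytingCommutativeRing.commutativeRing heytingCommutativeRing)
    using (ring; semiring; +-monoid)
  open MonoidMult +-monoid using (×-homo-+) renaming (_×_ to _×#_)
  open SemiringSum semiring using (sum; sum-cong-≋; *-distribˡ-sum)
  open RingProperties ring
    using (-‿involutive; -‿injective; -‿distribʳ-*; -‿distribˡ-*; -0#≈0#; +-cancelˡ; -1*x≈-x; -‿+-comm)
    renaming (⁻¹-anti-homo‿- to neg-minus)
  open SetoidReasoning setoid

  φK : Kind → Carrier → Carrier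
  φK swap   x = x
  φK flip   x = - x
  φK affine x = 1# - x

  minus-minus : ∀ x y → x - (x - y) ≈ y
  minus-minus x y = begin
    x - (x - y)      ≈⟨ +-congˡ (neg-minus x y) ⟩
    x + (y - x)      ≈⟨ +-comm x (y - x) ⟩
    (y - x) + x      ≈⟨ +-assoc y (- x) x ⟩
    y + (- x + x)    ≈⟨ +-congˡ (-‿inverseˡ x) ⟩
    y + 0#           ≈⟨ +-identityʳ y ⟩
    y                ∎

  φK-cong : ∀ κ {x y} → x ≈ y → φK κ x ≈ φK κ y
  φK-cong swap   x≈y = x≈y
  φK-cong flip   x≈y = -‿cong x≈y
  φK-cong affine x≈y = +-congˡ (-‿cong x≈y)

  fromℤ-neg : ∀ x → fromℤ (ℤ.- x) ≈ - fromℤ x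
  fromℤ-neg (+ zero)  = ≈-sym -0#≈0#
  fromℤ-neg (+ suc _) = ≈-refl
  fromℤ-neg -[1+ _ ]  = ≈-sym (-‿involutive _)

  fromℤ-1- : ∀ x → fromℤ (1ℤ ℤ.- x) ≈ 1# - fromℤ x
  fromℤ-1- (+ zero)        = +-congˡ (≈-sym -0#≈0#)
  fromℤ-1- (+ suc zero)    = ≈-sym (≈-trans (+-congˡ (-‿cong (+-identityʳ 1#))) (-‿inverseʳ 1#))
  fromℤ-1- (+ suc (suc m)) = begin
    - (1# + m ×# 1#)                          ≈⟨ +-identityˡ _ ⟨
    0# - (1# + m ×# 1#)                       ≈⟨ +-congʳ (-‿inverseʳ 1#) ⟨
    (1# - 1#) - (1# + m ×# 1#)                ≈⟨ +-assoc 1# (- 1#) _ ⟩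
    1# + (- 1# - (1# + m ×# 1#))              ≈⟨ +-congˡ (-‿+-comm 1# _) ⟩
    1# - (1# + (1# + m ×# 1#))                ∎
  fromℤ-1- -[1+ m ] = +-congˡ (≈-sym (-‿involutive _))

  fromℤ-φ : ∀ κ x → fromℤ (φ κ x) ≈ φK κ (fromℤ x)
  fromℤ-φ swap   x = ≈-refl
  fromℤ-φ flip   x = fromℤ-neg x
  fromℤ-φ affine x = fromℤ-1- x

  suc×≉0 : ∀ m → ¬ suc m ×# 1# ≈ 0#
  suc×≉0 m e = #-irrefl e (char0 m)

  ×1-injective : ∀ k l → k ×# 1# ≈ l ×# 1# → k ≡ l
  ×1-injective zero    zero    _ = refl
  ×1-injective zero    (suc l) e = contradiction (≈-sym e) (suc×≉0 l)
  ×1-injective (suc k) zero    e = contradiction e (suc×≉0 k)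
  ×1-injective (suc k) (suc l) e = cong suc (×1-injective k l (+-cancelˡ 1# _ _ e))

  ×1≉neg : ∀ k l → ¬ k ×# 1# ≈ - (suc l ×# 1#)
  ×1≉neg k l e = suc×≉0 (l ℕ.+ k) (begin
    suc (l ℕ.+ k) ×# 1#          ≈⟨ ×-homo-+ 1# (suc l) k ⟩
    suc l ×# 1# + k ×# 1#        ≈⟨ +-congˡ e ⟩
    suc l ×# 1# - suc l ×# 1#    ≈⟨ -‿inverseʳ _ ⟩
    0#                           ∎)

  fromℤ-injective : ∀ x y → fromℤ x ≈ fromℤ y → x ≡ y
  fromℤ-injective (+ k)    (+ l)    e = cong +_ (×1-injective k l e)
  fromℤ-injective (+ k)    -[1+ l ] e = contradiction e (×1≉neg k l)
  fromℤ-injective -[1+ k ] (+ l)    e = contradiction (≈-sym e) (×1≉neg l k)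
  fromℤ-injective -[1+ k ] -[1+ l ] e = cong -[1+_] (ℕ.suc-injective (×1-injective (suc k) (suc l) (-‿injective e)))

  basis : Fin n → V
  basis i = e (suc (toℕ i))

  basis-≡ : ∀ i → basis i i ≈ 1#
  basis-≡ i = reflexive (e-yes (suc (toℕ i)) i refl)

  basis-≢ : ∀ {i k} → k ≢ i → basis i k ≈ 0#
  basis-≢ {i} {k} k≢i = reflexive (e-no (suc (toℕ i)) k λ p → k≢i (toℕ-injective (ℕ.suc-injective (sym p))))

  latticePoint-≈ : ∀ a k → latticePoint a k ≈ fromℤ (a k)
  latticePoint-≈ a k = begin
    sum (λ i → fromℤ (a i) * basis i k)    ≈⟨ sum-single _ k (λ j j≢k → ≈-trans (*-congˡ (basis-≢ (j≢k ∘ sym))) (zeroʳ _)) ⟩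
    fromℤ (a k) * basis k k                ≈⟨ *-congˡ (basis-≡ k) ⟩
    fromℤ (a k) * 1#                       ≈⟨ *-identityʳ _ ⟩
    fromℤ (a k)                            ∎

  inner-pair : ∀ (v r : V) i j b → (∀ k → r k ≈ basis i k + b * basis j k) → ⟨ v , r ⟩ ≈ v i + b * v j
  inner-pair v r i j b r≈ = begin
    sum (λ k → v k * r k)                                       ≈⟨ sum-cong-≋ (λ k → ≈-trans (*-comm _ _)
                                                                     (≈-trans (*-congʳ (r≈ k)) (≈-trans (distribʳ _ _ _) (+-congˡ (*-assoc _ _ _))))) ⟩
    sum (λ k → basis i k * v k + b * (basis j k * v k))         ≈⟨ sum-combination b (λ k → basis i k * v k) (λ k → basis j k * v k) ⟩
    ⟨ basis i , v ⟩ + b * ⟨ basis j , v ⟩                       ≈⟨ +-cong (⟨e,⟩ i v) (*-congˡ (⟨e,⟩ j v)) ⟩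
    v i + b * v j                                               ∎

  inner-single : ∀ (v r : V) i a → (∀ k → r k ≈ a * basis i k) → ⟨ v , r ⟩ ≈ a * v i
  inner-single v r i a r≈ = begin
    sum (λ k → v k * r k)                ≈⟨ sum-cong-≋ (λ k → ≈-trans (*-comm _ _) (≈-trans (*-congʳ (r≈ k)) (*-assoc _ _ _))) ⟩
    sum (λ k → a * (basis i k * v k))    ≈⟨ *-distribˡ-sum a (λ k → basis i k * v k) ⟨
    a * ⟨ basis i , v ⟩                  ≈⟨ *-congˡ (⟨e,⟩ i v) ⟩
    a * v i                              ∎

  2/-spec : ∀ {x} (x#0 : x # 0#) → 2/⟨ x#0 ⟩ * x ≈ 2#
  2/-spec {x} x#0 = begin
    2# * x⁻¹ * x             ≈⟨ *-assoc 2# x⁻¹ x ⟩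
    2# * (x⁻¹ * x)           ≈⟨ *-congˡ (*-congˡ (≈-trans (+-congˡ -0#≈0#) (+-identityʳ x))) ⟨
    2# * (x⁻¹ * (x - 0#))    ≈⟨ *-congˡ (proj₁ (proj₂ (#⇒invertible x#0))) ⟩
    2# * 1#                  ≈⟨ *-identityʳ 2# ⟩
    2#                       ∎
    where x⁻¹ = proj₁ (#⇒invertible x#0)

  cancel-2 : ∀ {x} → x * 2# ≈ 2# → x ≈ 1#
  cancel-2 {x} e = begin
    x                      ≈⟨ *-identityʳ x ⟨
    x * 1#                 ≈⟨ *-congˡ 2*½ ⟨
    x * (2# * ½)           ≈⟨ *-assoc x 2# ½ ⟨
    x * 2# * ½             ≈⟨ *-congʳ e ⟩
    2# * ½                 ≈⟨ 2*½ ⟩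
    1#                     ∎
    where
    ½ = proj₁ (#⇒invertible 2#0)
    2*½ : 2# * ½ ≈ 1#
    2*½ = ≈-trans (*-congʳ (≈-sym (≈-trans (+-congˡ -0#≈0#) (+-identityʳ 2#)))) (proj₂ (proj₂ (#⇒invertible 2#0)))

  x*2 : ∀ x → x * 2# ≈ x + x
  x*2 x = ≈-trans (distribˡ x 1# 1#) (+-cong (*-identityʳ x) (*-identityʳ x))

  -- Reflections in roots as maps of coordinates

  reflection-pairMap : ∀ (f : Carrier → Carrier) i j q (r v : V) →
    q * r i ≈ v i - f (v j) → q * r j ≈ v j - f (v i) → (∀ k → k ≢ i → k ≢ j → r k ≈ 0#) →
    ∀ k → v k - q * r k ≈ pairMap f i j v k
  reflection-pairMap f i j q r v at-i at-j outside k = go (k Fin.≟ i) (k Fin.≟ j)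
    where
    go : Dec (k ≡ i) → Dec (k ≡ j) → v k - q * r k ≈ pairMap f i j v k
    go (yes refl) _ = ≈-trans (+-congˡ (-‿cong at-i)) (≈-trans (minus-minus _ _) (reflexive (sym (pairMap-i f i j v))))
    go (no _) (yes refl) = ≈-trans (+-congˡ (-‿cong at-j)) (≈-trans (minus-minus _ _) (reflexive (sym (pairMap-j f i j v))))
    go (no k≢i) (no k≢j) = begin
      v k - q * r k          ≈⟨ +-congˡ (-‿cong (≈-trans (*-congˡ (outside k k≢i k≢j)) (zeroʳ q))) ⟩
      v k - 0#               ≈⟨ ≈-trans (+-congˡ -0#≈0#) (+-identityʳ (v k)) ⟩
      v k                    ≡⟨ pairMap-other f i j v k≢i k≢j ⟨
      pairMap f i j v k      ∎

  -- For the roots eᵢ ± eⱼ the square norm is 2, so the factor 2/⟨r,r⟩ is 1.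
  module PairRoot (r : V) (r#0 : ⟨ r , r ⟩ # 0#) {i j} (i≢j : i ≢ j) (b : Carrier) (b²≈1 : b * b ≈ 1#)
                  (r≈ : ∀ k → r k ≈ basis i k + b * basis j k) where

    scale : 2/⟨ r#0 ⟩ ≈ 1#
    scale = cancel-2 (≈-trans (*-congˡ (≈-sym (≈-trans (norm i j b r i≢j r≈) (+-congˡ b²≈1)))) (2/-spec r#0))

    coefficient : ∀ {s x} → s ≈ x → s * 2/⟨ r#0 ⟩ ≈ x
    coefficient s≈x = ≈-trans (*-cong s≈x scale) (*-identityʳ _)

    root-i : r i ≈ 1#
    root-i = ≈-trans (r≈ i) (≈-trans (+-cong (basis-≡ i) (≈-trans (*-congˡ (basis-≢ i≢j)) (zeroʳ b))) (+-identityʳ 1#))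

    root-j : r j ≈ b
    root-j = ≈-trans (r≈ j) (≈-trans (+-cong (basis-≢ (i≢j ∘ sym)) (≈-trans (*-congˡ (basis-≡ j)) (*-identityʳ b))) (+-identityˡ b))

    root-other : ∀ k → k ≢ i → k ≢ j → r k ≈ 0#
    root-other k k≢i k≢j = ≈-trans (r≈ k) (≈-trans (+-cong (basis-≢ k≢i) (≈-trans (*-congˡ (basis-≢ k≢j)) (zeroʳ b))) (+-identityʳ 0#))

    inner : ∀ v → ⟨ v , r ⟩ ≈ v i + b * v j
    inner v = inner-pair v r i j b r≈

  -- The multiple a is kept general to treat eₙ and 2eₙ together; since 2/⟨r,r⟩ · a² = 2, it cancels
  -- from the linear reflection.
  module SingleRoot (r : V) (r#0 : ⟨ r , r ⟩ # 0#) i (a : Carrier) (r≈ : ∀ k → r k ≈ a * basis i k) where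

    root-i : r i ≈ a
    root-i = ≈-trans (r≈ i) (≈-trans (*-congˡ (basis-≡ i)) (*-identityʳ a))

    root-other : ∀ k → k ≢ i → k ≢ i → r k ≈ 0#
    root-other k k≢i _ = ≈-trans (r≈ k) (≈-trans (*-congˡ (basis-≢ k≢i)) (zeroʳ a))

    inner : ∀ v → ⟨ v , r ⟩ ≈ a * v i
    inner v = inner-single v r i a r≈

    scale : 2/⟨ r#0 ⟩ * (a * a) ≈ 2#
    scale = ≈-trans (*-congˡ (≈-sym (≈-trans (inner r) (*-congˡ root-i)))) (2/-spec r#0)

    linear : ∀ v k → v k - ⟨ v , r ⟩ * 2/⟨ r#0 ⟩ * r k ≈ pairMap -_ i i v k
    linear v = reflection-pairMap -_ i i _ r v at at root-other
      where
      at : ⟨ v , r ⟩ * 2/⟨ r#0 ⟩ * r i ≈ v i - - v i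
      at = begin
        ⟨ v , r ⟩ * 2/⟨ r#0 ⟩ * r i         ≈⟨ *-cong (*-congʳ (≈-trans (inner v) (*-comm a _))) root-i ⟩
        v i * a * 2/⟨ r#0 ⟩ * a             ≈⟨ ≈-trans (*-assoc _ _ a) (*-assoc _ a _) ⟩
        v i * (a * (2/⟨ r#0 ⟩ * a))         ≈⟨ *-congˡ (≈-trans (*-comm a _) (*-assoc _ a a)) ⟩
        v i * (2/⟨ r#0 ⟩ * (a * a))         ≈⟨ *-congˡ scale ⟩
        v i * 2#                            ≈⟨ x*2 (v i) ⟩
        v i + v i                           ≈⟨ +-congˡ (-‿involutive (v i)) ⟨
        v i - - v i                         ∎

  plus-affine : ∀ x y → (x + y) - 1# ≈ x - (1# - y)
  plus-affine x y = ≈-trans (+-assoc x y (- 1#)) (+-congˡ (≈-sym (neg-minus 1# y)))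

  -1²≈1 : - 1# * - 1# ≈ 1#
  -1²≈1 = ≈-trans (-1*x≈-x (- 1#)) (-‿involutive 1#)

  plus-minus : ∀ x y → x + - 1# * y ≈ x - y
  plus-minus x y = +-congˡ (-1*x≈-x y)

  lastRoot-single : ∀ {t} → SingleLast t → ∃[ a ] (∀ k → lastRoot t k ≈ a * e n k)
  lastRoot-single C̃/C = 2# , λ _ → ≈-refl
  lastRoot-single B̃/B = 1# , λ _ → ≈-sym (*-identityˡ _)

  lastRoot-double : ∀ {t} → DoubleLast t → ∀ k → lastRoot t k ≡ e (n ℕ.∸ 1) k + e n k
  lastRoot-double B̃/D _ = refl
  lastRoot-double D̃/D _ = refl

  α̃-single : ∀ {t} → SingleFirst t → ∀ k → α̃ t k ≡ 2# * e 1 k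
  α̃-single C̃/C _ = refl
  α̃-single B̃/D _ = refl

  α̃-double : ∀ {t} → DoubleFirst t → ∀ k → α̃ t k ≡ e 1 k + e 2 k
  α̃-double B̃/B _ = refl
  α̃-double D̃/D _ = refl

  α-last : ∀ {i} → suc (toℕ i) ≡ n → ∀ k → α t (suc (toℕ {n} i)) k ≡ lastRoot t k
  α-last {i} i≡n k = cong (λ b → (if b then lastRoot t else λ k → e (suc (toℕ i)) k - e (suc (suc (toℕ i))) k) k) (dec-true (suc (toℕ i) ℕ.≟ n) i≡n)

  α-inner : ∀ {i j} → toℕ j ≡ suc (toℕ i) → ∀ k → α t (suc (toℕ {n} i)) k ≡ basis i k - basis j k
  α-inner {i} {j} j≡ k = trans
    (cong (λ b → (if b then lastRoot t else λ k → e (suc (toℕ i)) k - e (suc (suc (toℕ i))) k) k)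
      (dec-false (suc (toℕ i) ℕ.≟ n) λ i≡n → ℕ.<⇒≢ (Fin.toℕ<n j) (trans j≡ i≡n)))
    (cong (λ m → basis i k - e (suc m) k) (sym j≡))

  generatorAct-pairMap : ∀ {g κ i j} → View g κ i j → ∀ v k → generatorAct g v k ≈ pairMap (φK κ) i j v k
  generatorAct-pairMap (adj {i} {j} j≡) v = reflection-pairMap (λ x → x) i j _ r v
      (≈-trans (*-cong q root-i) (*-identityʳ _))
      (≈-trans (*-cong q root-j) (≈-trans (≈-sym (-‿distribʳ-* _ 1#)) (≈-trans (-‿cong (*-identityʳ _)) (neg-minus _ _))))
      root-other
    where
    r = α t (suc (toℕ i))
    i≢j : i ≢ j
    i≢j refl = ℕ.1+n≢n (sym j≡)
    open PairRoot r _ i≢j (- 1#) -1²≈1 (λ k → ≈-trans (reflexive (α-inner j≡ k)) (≈-sym (plus-minus _ _)))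
    q = coefficient (≈-trans (inner v) (plus-minus _ _))
  generatorAct-pairMap (last₁ single {i} i≡n) v = SingleRoot.linear (α t (suc (toℕ i))) _ i (proj₁ (lastRoot-single single))
    (λ k → ≈-trans (reflexive (α-last i≡n k)) (≈-trans (proj₂ (lastRoot-single single) k)
      (reflexive (cong (λ m → proj₁ (lastRoot-single single) * e m k) (sym i≡n))))) v
  generatorAct-pairMap (last₂ double {i} {j} j≡ j≡n) v = reflection-pairMap -_ i j _ r v
      (≈-trans (*-cong q root-i) (≈-trans (*-identityʳ _) (+-congˡ (≈-sym (-‿involutive _)))))
      (≈-trans (*-cong q root-j) (≈-trans (*-identityʳ _) (≈-trans (+-comm _ _) (+-congˡ (≈-sym (-‿involutive _))))))
      root-other
    where
    r = α t (suc (toℕ j))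
    i≢j : i ≢ j
    i≢j refl = ℕ.1+n≢n (sym j≡)
    r≈ : ∀ k → r k ≈ basis i k + 1# * basis j k
    r≈ k = ≈-trans (reflexive (trans (α-last j≡n k) (trans (lastRoot-double double k)
      (cong₂ (λ p m → e p k + e m k) (cong ℕ.pred (trans (sym j≡n) (cong suc j≡))) (sym j≡n))))) (+-congˡ (≈-sym (*-identityˡ _)))
    open PairRoot r _ i≢j 1# (*-identityˡ 1#) r≈
    q = coefficient (≈-trans (inner v) (+-congˡ (*-identityˡ _)))
  generatorAct-pairMap (first₁ single {i} i≡0) v = reflection-pairMap (λ x → 1# - x) i i _ (α̃ t) v at at root-other
    where
    open SingleRoot (α̃ t) _ i 2# (λ k → reflexive (trans (α̃-single single k) (cong (λ m → 2# * e (suc m) k) (sym i≡0))))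
    -- Here 2/⟨α̃,α̃⟩ = 1/2 cancels the coordinate 2 of the root, leaving 2vᵢ - 1: the reflection at
    -- vᵢ = 1/2.
    at : (⟨ v , α̃ t ⟩ - 1#) * _ * α̃ t i ≈ v i - (1# - v i)
    at = begin
      (⟨ v , α̃ t ⟩ - 1#) * _ * α̃ t i      ≈⟨ *-assoc _ _ _ ⟩
      (⟨ v , α̃ t ⟩ - 1#) * (_ * α̃ t i)    ≈⟨ *-cong (+-congʳ (≈-trans (inner v) (≈-trans (*-comm _ _) (x*2 (v i)))))
                                               (≈-trans (*-congˡ root-i) (cancel-2 (≈-trans (*-assoc _ _ _) scale))) ⟩
      (v i + v i - 1#) * 1#                ≈⟨ *-identityʳ _ ⟩
      v i + v i - 1#                       ≈⟨ plus-affine (v i) (v i) ⟩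
      v i - (1# - v i)                     ∎
  generatorAct-pairMap (first₂ double {i} {j} i≡0 j≡1) v = reflection-pairMap (λ x → 1# - x) i j _ (α̃ t) v
      (≈-trans (*-cong q root-i) (≈-trans (*-identityʳ _) (plus-affine _ _)))
      (≈-trans (*-cong q root-j) (≈-trans (*-identityʳ _) (≈-trans (+-congʳ (+-comm _ _)) (plus-affine _ _))))
      root-other
    where
    i≢j : i ≢ j
    i≢j refl = contradiction (trans (sym i≡0) j≡1) λ ()
    open PairRoot (α̃ t) _ i≢j 1# (*-identityˡ 1#) (λ k → ≈-trans
      (reflexive (trans (α̃-double double k) (cong₂ (λ p m → e (suc p) k + e (suc m) k) (sym i≡0) (sym j≡1))))
      (+-congˡ (≈-sym (*-identityˡ _))))
    q = coefficient (+-congʳ (≈-trans (inner v) (+-congˡ (*-identityˡ _))))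

  pairMap-fromℤ : ∀ κ i j {v : V} {a : Fin n → ℤ} → (∀ k → v k ≈ fromℤ (a k)) →
                  ∀ k → pairMap (φK κ) i j v k ≈ fromℤ (pairMap (φ κ) i j a k)
  pairMap-fromℤ κ i j {v} {a} v≈a k with k Fin.≟ i | k Fin.≟ j
  ... | yes _ | _     = ≈-trans (φK-cong κ (v≈a j)) (≈-sym (fromℤ-φ κ (a j)))
  ... | no _  | yes _ = ≈-trans (φK-cong κ (v≈a i)) (≈-sym (fromℤ-φ κ (a i)))
  ... | no _  | no _  = v≈a k

  act-level : ∀ is k → act is 0ᵥ k ≈ fromℤ (level (product is) k)
  act-level []       k = reflexive (cong fromℤ (sym (level-id k)))
  act-level (g ∷ is) k with view g
  ... | κ , i , j , v = begin
    generatorAct g (act is 0ᵥ) k                           ≈⟨ generatorAct-pairMap v (act is 0ᵥ) k ⟩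
    pairMap (φK κ) i j (act is 0ᵥ) k                       ≈⟨ pairMap-fromℤ κ i j (act-level is) k ⟩
    fromℤ (pairMap (φ κ) i j (level (product is)) k)       ≡⟨ cong fromℤ (level-reflects (reflects v) (product is) k) ⟨
    fromℤ (level (product (g ∷ is)) k)                     ∎

  -- Levels see only the permutation, so all words for w move 0 to the same point.
  act-expresses : ∀ w is → is Expresses w → ∀ k → act is 0ᵥ k ≈ fromℤ (level w k)
  act-expresses w is e k = ≈-trans (act-level is k) (reflexive (cong fromℤ (level-cong {product is} {w} e k)))

  coordinate-level : ∀ w k → rootLatticeCoordinate w k ≈ fromℤ (level (element w) k)
  coordinate-level w = act-expresses (element w) (HasLength.word (MinimalRep.hasLength w)) (HasLength.express (MinimalRep.hasLength w))

  act≈latticePoint : ∀ (w : MinimalRep) is → is Expresses element w → act is 0ᵥ ≈ᵥ latticePoint (level (element w))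
  act≈latticePoint w is e k = ≈-trans (act-expresses (element w) is e k) (≈-sym (latticePoint-≈ (level (element w)) k))

  coordinate-injective : Injective _≈ᵣ_ _≈ᵥ_ rootLatticeCoordinate
  coordinate-injective {v} {w} e = minimal-unique v w λ k → fromℤ-injective (level (element v) k) (level (element w) k)
    (≈-trans (≈-sym (coordinate-level v k)) (≈-trans (e k) (coordinate-level w k)))

  coordinate-image : ∀ (v : V) → (∃ λ (w : MinimalRep) → rootLatticeCoordinate w ≈ᵥ v)
                     ⇔ (∃ λ (a : Fin n → ℤ) → InImage t a × (v ≈ᵥ latticePoint a))
  coordinate-image v = mk⇔ to from
    where
    to : (∃ λ (w : MinimalRep) → rootLatticeCoordinate w ≈ᵥ v) → ∃ λ (a : Fin n → ℤ) → InImage t a × (v ≈ᵥ latticePoint a)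
    to (w , e) = level (element w) , inImage-cong {level (product word)} {level (element w)} (level-cong {product word} {element w} express) (product-inImage word)
               , λ k → ≈-trans (≈-sym (e k)) (≈-trans (coordinate-level w k) (≈-sym (latticePoint-≈ (level (element w)) k)))
      where open HasLength (MinimalRep.hasLength w) using (word; express)
    from : (∃ λ (a : Fin n → ℤ) → InImage t a × (v ≈ᵥ latticePoint a)) → ∃ λ (w : MinimalRep) → rootLatticeCoordinate w ≈ᵥ v
    from (a , a∈ , e) = w , λ k → ≈-trans (coordinate-level w k)
        (≈-trans (reflexive (cong fromℤ (levels k))) (≈-sym (≈-trans (e k) (latticePoint-≈ a k))))
      where
      w = proj₁ (representative a (reach a a∈))
      levels = proj₂ (representative a (reach a a∈))

theorem4p1 : ∀ {c ℓ₁ ℓ₂} (K : HeytingField c ℓ₁ ℓ₂) (char0 : CharacteristicZero K)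
    (t : Quotient) (n : ℕ) (rank : minRank t ≤ n) →
    let open Action K char0 t n rank in
    (∀ (w : MinimalRep) (is : Word) → is Expresses element w →
    act is 0ᵥ ≈ᵥ latticePoint (level (element w)))
    × Injective _≈ᵣ_ _≈ᵥ_ rootLatticeCoordinate
    × (∀ (v : V) →
    (∃ λ (w : MinimalRep) → rootLatticeCoordinate w ≈ᵥ v)
    ⇔ (∃ λ (a : Fin n → ℤ) → InImage t a × (v ≈ᵥ latticePoint a)))
theorem4p1 K char0 t n rank = act≈latticePoint , (λ {v} {w} → coordinate-injective {v} {w}) , coordinate-image
  where open Coordinates K char0 t n rank
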